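{- If $a\in\mathbb{Q}\cap[-2,2]$ is non-zero and is the square of a rational number, then $a\notin Tri$, i.e. $a$ is not a trisection number.
   Context: Let $S\subseteq\mathbb{R}^2$ contain $(0,0)$ and $(1,0)$. A point is constructible over $S$ if it can be obtained from points of $S$ by a finite sequence of straightedge-and-compass steps: (1) given two distinct points already available, one may draw the line through them, or the circle centered at one of them and passing through the other; (2) given two lines, two circles, or a line and a circle already drawn, one may add their intersection points. $C(S)$ denotes the set of all points constructible over $S$. An angle $\alpha$ (in radians) is trisectable if $(\cos(\alpha/3),\sin(\alpha/3))\in C(\{(0,0),(1,0),(\cos\alpha,\sin\alpha)\})$. A trisection number is a real number of the form $2\cos\alpha$ with $\alpha$ trisectable; $Tri\subseteq[-2,2]$ is the set of all trisection numbers. -}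

module Defs where

import Algebra.Definitions.RawSemiring
open import Data.Integer.Base as ℤ using (+_)
import Data.Integer.Properties as ℤ
open import Data.Nat.Base as ℕ using (ℕ; zero; suc; _!; z≤n; s≤s)
import Data.Nat.Properties as ℕ
open import Data.Product using (∃; _×_; _,_; proj₁; proj₂)
open import Data.Rational.Base as ℚ using (ℚ; 0ℚ; 1ℚ; ½; ∣_∣)
import Data.Rational.Properties as ℚ
import Data.Rational.Unnormalised.Base as ℚᵘ
import Data.Rational.Unnormalised.Properties as ℚᵘ
open import Data.Rational.Solver using (module +-*-Solver)
open import Data.Sum using (_⊎_; inj₁; inj₂)
open import Function.Bundles using (_⇔_)
open import Relation.Binary.PropositionalEquality
open import Relation.Nullary using (¬_)
open import Relation.Unary using (Pred; _∈_)
open import Level using (0ℓ)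

open Algebra.Definitions.RawSemiring ℚ.+-*-rawSemiring using (_^_)

ι : ℕ → ℚ
ι n = + n ℚ./ 1

recip : (n : ℕ) .{{_ : ℕ.NonZero n}} → ℚ
recip n = + 1 ℚ./ n

-- sum f n = f 0 + … + f (n - 1)
sum : (ℕ → ℚ) → ℕ → ℚ
sum f zero    = 0ℚ
sum f (suc n) = sum f n ℚ.+ f n

-- (-1)ᵏ qʲ / j!
term : ℕ → ℚ → ℕ → ℚ
term j q k = (ℚ.- 1ℚ) ^ k ℚ.* (q ^ j ℚ.* recip (j !) {{j ℕ.!≢0}})

module Estimates where

  open +-*-Solver

  toℚᵘ-/ : ∀ i n .{{_ : ℕ.NonZero n}} → ℚ.toℚᵘ (i ℚ./ n) ℚᵘ.≃ (i ℚᵘ./ n)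
  toℚᵘ-/ i (suc n) = ℚ.toℚᵘ-fromℚᵘ (ℚᵘ.mkℚᵘ i n)

  ι-mono : ∀ {m n} → m ℕ.≤ n → ι m ℚ.≤ ι n
  ι-mono {m} {n} m≤n = ℚ.toℚᵘ-cancel-≤
    (ℚᵘ.≤-respˡ-≃ (ℚᵘ.≃-sym (toℚᵘ-/ (+ m) 1))
    (ℚᵘ.≤-respʳ-≃ (ℚᵘ.≃-sym (toℚᵘ-/ (+ n) 1))
    (ℚᵘ.*≤* (ℤ.*-monoʳ-≤-nonNeg (+ 1) (ℤ.+≤+ m≤n)))))

  ι-suc : ∀ n → ι (suc n) ≡ 1ℚ ℚ.+ ι n
  ι-suc n = ℚ.toℚᵘ-injective (begin
    ℚ.toℚᵘ (ι (suc n))              ≈⟨ toℚᵘ-/ (+ suc n) 1 ⟩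
    + suc n ℚᵘ./ 1                  ≈⟨ ℚᵘ.*≡* (cong (λ k → (+ 1 ℤ.+ k) ℤ.* + 1) (sym (ℤ.*-identityʳ (+ n)))) ⟩
    ℚᵘ.1ℚᵘ ℚᵘ.+ (+ n ℚᵘ./ 1)        ≈⟨ ℚᵘ.+-congʳ ℚᵘ.1ℚᵘ (ℚᵘ.≃-sym (toℚᵘ-/ (+ n) 1)) ⟩
    ℚᵘ.1ℚᵘ ℚᵘ.+ ℚ.toℚᵘ (ι n)        ≈⟨ ℚᵘ.≃-sym (ℚ.toℚᵘ-homo-+ 1ℚ (ι n)) ⟩
    ℚ.toℚᵘ (1ℚ ℚ.+ ι n)             ∎)
    where open ℚᵘ.≃-Reasoning

  ι-* : ∀ m n → ι (m ℕ.* n) ≡ ι m ℚ.* ι n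
  ι-* zero    n = sym (ℚ.*-zeroˡ (ι n))
  ι-* (suc m) n = trans (ι-+ n (m ℕ.* n)) (trans (cong (ι n ℚ.+_) (ι-* m n))
      (trans (solve 2 (λ a b → a :+ b :* a := (con 1ℚ :+ b) :* a) refl (ι n) (ι m))
             (cong (ℚ._* ι n) (sym (ι-suc m)))))
    where
    ι-+ : ∀ m n → ι (m ℕ.+ n) ≡ ι m ℚ.+ ι n
    ι-+ zero    n = sym (ℚ.+-identityˡ (ι n))
    ι-+ (suc m) n = trans (ι-suc (m ℕ.+ n)) (trans (cong (1ℚ ℚ.+_) (ι-+ m n))
      (trans (sym (ℚ.+-assoc 1ℚ (ι m) (ι n))) (cong (ℚ._+ ι n) (sym (ι-suc m)))))

  ι-^ : ∀ m n → ι (m ℕ.^ n) ≡ ι m ^ n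
  ι-^ m zero    = refl
  ι-^ m (suc n) = trans (ι-* m (m ℕ.^ n)) (cong (ι m ℚ.*_) (ι-^ m n))

  ι*recip : ∀ n .{{_ : ℕ.NonZero n}} → ι n ℚ.* recip n ≡ 1ℚ
  ι*recip n@(suc _) = ℚ.toℚᵘ-injective (begin
    ℚ.toℚᵘ (ι n ℚ.* recip n)            ≈⟨ ℚ.toℚᵘ-homo-* (ι n) (recip n) ⟩
    ℚ.toℚᵘ (ι n) ℚᵘ.* ℚ.toℚᵘ (recip n)  ≈⟨ ℚᵘ.*-cong (toℚᵘ-/ (+ n) 1) (toℚᵘ-/ (+ 1) n) ⟩
    (+ n ℚᵘ./ 1) ℚᵘ.* (+ 1 ℚᵘ./ n)      ≈⟨ ℚᵘ.*≡* (cong +_ (eq n)) ⟩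
    ℚᵘ.1ℚᵘ                              ∎)
    where
    open ℚᵘ.≃-Reasoning
    eq : ∀ n → n ℕ.* 1 ℕ.* 1 ≡ 1 ℕ.* (1 ℕ.* n)
    eq n = trans (ℕ.*-identityʳ (n ℕ.* 1)) (trans (ℕ.*-identityʳ n)
      (sym (trans (ℕ.*-identityˡ (1 ℕ.* n)) (ℕ.*-identityˡ n))))

  ι≥0 : ∀ n → 0ℚ ℚ.≤ ι n
  ι≥0 n = ι-mono {0} {n} z≤n

  ι-suc>0 : ∀ n → 0ℚ ℚ.< ι (suc n)
  ι-suc>0 n = ℚ.<-≤-trans (ℚ.positive⁻¹ 1ℚ) (ι-mono {1} {suc n} (s≤s z≤n))

  ceil : ∀ q → ∃ λ n → q ℚ.≤ ι n
  ceil q@(ℚ.mkℚ i d _) = ℤ.∣ i ∣ , ℚ.toℚᵘ-cancel-≤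
    (ℚᵘ.≤-respʳ-≃ (ℚᵘ.≃-sym (toℚᵘ-/ (+ ℤ.∣ i ∣) 1))
      (ℚᵘ.*≤* (ℤ.≤-trans (ℤ.≤-reflexive (ℤ.*-identityʳ i)) (i≤ i))))
    where
    i≤ : ∀ i → i ℤ.≤ + ℤ.∣ i ∣ ℤ.* + suc d
    i≤ (+ n)          = subst (+ n ℤ.≤_) (ℤ.pos-* n (suc d)) (ℤ.+≤+ (ℕ.m≤m*n n (suc d)))
    i≤ (ℤ.-[1+ n ])   = ℤ.-≤+

  *-mono : ∀ {a b c d} → 0ℚ ℚ.≤ c → 0ℚ ℚ.≤ b → a ℚ.≤ b → c ℚ.≤ d → a ℚ.* c ℚ.≤ b ℚ.* d
  *-mono {a} {b} {c} {d} 0≤c 0≤b a≤b c≤d = ℚ.≤-trans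
    (ℚ.*-monoʳ-≤-nonNeg c {{ℚ.nonNegative 0≤c}} a≤b)
    (ℚ.*-monoˡ-≤-nonNeg b {{ℚ.nonNegative 0≤b}} c≤d)

  *-nonNeg : ∀ {a b} → 0ℚ ℚ.≤ a → 0ℚ ℚ.≤ b → 0ℚ ℚ.≤ a ℚ.* b
  *-nonNeg {a} {b} 0≤a 0≤b =
    subst (ℚ._≤ a ℚ.* b) (ℚ.*-zeroˡ 0ℚ) (*-mono ℚ.≤-refl 0≤a 0≤a 0≤b)

  *-pos : ∀ {a b} → 0ℚ ℚ.< a → 0ℚ ℚ.< b → 0ℚ ℚ.< a ℚ.* b
  *-pos {a} {b} 0<a 0<b = ℚ.positive⁻¹ (a ℚ.* b)
    {{ℚ.pos*pos⇒pos a {{ℚ.positive 0<a}} b {{ℚ.positive 0<b}}}}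

  ^-nonNeg : ∀ {a} → 0ℚ ℚ.≤ a → ∀ n → 0ℚ ℚ.≤ a ^ n
  ^-nonNeg 0≤a zero    = ℚ.<⇒≤ (ℚ.positive⁻¹ 1ℚ)
  ^-nonNeg 0≤a (suc n) = *-nonNeg 0≤a (^-nonNeg 0≤a n)

  ½≥0 : 0ℚ ℚ.≤ ½
  ½≥0 = ℚ.<⇒≤ (ℚ.positive⁻¹ ½)

  half>0 : ∀ {ε} → 0ℚ ℚ.< ε → 0ℚ ℚ.< ε ℚ.* ½
  half>0 0<ε = *-pos 0<ε (ℚ.positive⁻¹ ½)

  halves : ∀ ε → ε ℚ.* ½ ℚ.+ ε ℚ.* ½ ≡ ε
  halves = solve 1 (λ e → e :* con ½ :+ e :* con ½ := e) refl

  shrink : ∀ K {ε} → 0ℚ ℚ.< ε → ∃ λ δ → 0ℚ ℚ.< δ × ι (suc K) ℚ.* δ ≡ ε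
  shrink K {ε} 0<ε = ε ℚ.* recip (suc K)
    , *-pos 0<ε (ℚ.positive⁻¹ (recip (suc K)) {{ℚ.normalize-pos 1 (suc K)}})
    , trans (solve 3 (λ k e r → k :* (e :* r) := (k :* r) :* e) refl (ι (suc K)) ε (recip (suc K)))
            (trans (cong (ℚ._* ε) (ι*recip (suc K))) (ℚ.*-identityˡ ε))

  archimedean : ∀ K {ε} → 0ℚ ℚ.< ε → ∃ λ n → ι K ℚ.< ι (suc n) ℚ.* ε
  archimedean K {ε} 0<ε = n , (begin-strict
      ι K                              ≡⟨ sym (ℚ.*-identityʳ (ι K)) ⟩
      ι K ℚ.* 1ℚ                       ≡⟨ cong (ι K ℚ.*_) (sym (ℚ.*-inverseˡ ε)) ⟩
      ι K ℚ.* (ℚ.1/ ε ℚ.* ε)           ≡⟨ sym (ℚ.*-assoc (ι K) (ℚ.1/ ε) ε) ⟩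
      ι K ℚ.* ℚ.1/ ε ℚ.* ε             ≤⟨ ℚ.*-monoʳ-≤-nonNeg ε {{ℚ.pos⇒nonNeg ε}} (proj₂ c) ⟩
      ι n ℚ.* ε                        <⟨ ℚ.*-monoˡ-<-pos ε ιn<ι1+n ⟩
      ι (suc n) ℚ.* ε                  ∎)
    where
    open ℚ.≤-Reasoning
    instance
      ε-pos : ℚ.Positive ε
      ε-pos = ℚ.positive 0<ε
      ε-nz : ℚ.NonZero ε
      ε-nz = ℚ.pos⇒nonZero ε
    c = ceil (ι K ℚ.* ℚ.1/ ε)
    n = proj₁ c
    ιn<ι1+n : ι n ℚ.< ι (suc n)
    ιn<ι1+n = subst₂ ℚ._<_ (ℚ.+-identityˡ (ι n)) (sym (ι-suc n))
      (ℚ.+-monoˡ-< (ι n) (ℚ.positive⁻¹ 1ℚ))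

  ∣a-a∣≡0 : ∀ a → ∣ a ℚ.- a ∣ ≡ 0ℚ
  ∣a-a∣≡0 a = cong ∣_∣ (ℚ.+-inverseʳ a)

  ∣a-b∣≡∣b-a∣ : ∀ a b → ∣ a ℚ.- b ∣ ≡ ∣ b ℚ.- a ∣
  ∣a-b∣≡∣b-a∣ a b = trans (sym (ℚ.∣-p∣≡∣p∣ (a ℚ.- b)))
    (cong ∣_∣ (solve 2 (λ a b → :- (a :- b) := b :- a) refl a b))

  ∣-∣-triangle : ∀ a b c → ∣ a ℚ.- c ∣ ℚ.≤ ∣ a ℚ.- b ∣ ℚ.+ ∣ b ℚ.- c ∣
  ∣-∣-triangle a b c = subst (λ t → ∣ t ∣ ℚ.≤ ∣ a ℚ.- b ∣ ℚ.+ ∣ b ℚ.- c ∣)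
    (solve 3 (λ a b c → (a :- b) :+ (b :- c) := a :- c) refl a b c)
    (ℚ.∣p+q∣≤∣p∣+∣q∣ (a ℚ.- b) (b ℚ.- c))

  ∣^∣ : ∀ q n → ∣ q ^ n ∣ ≡ ∣ q ∣ ^ n
  ∣^∣ q zero    = refl
  ∣^∣ q (suc n) = trans (ℚ.∣p*q∣≡∣p∣*∣q∣ q (q ^ n)) (cong (∣ q ∣ ℚ.*_) (∣^∣ q n))

  ^-mono : ∀ {a b} → 0ℚ ℚ.≤ a → a ℚ.≤ b → ∀ n → a ^ n ℚ.≤ b ^ n
  ^-mono 0≤a a≤b zero    = ℚ.≤-refl
  ^-mono 0≤a a≤b (suc n) =
    *-mono (^-nonNeg 0≤a n) (ℚ.≤-trans 0≤a a≤b) a≤b (^-mono 0≤a a≤b n)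

  small : ∀ K {δ ε} a {b} → ι (suc K) ℚ.* δ ≡ ε → ∣ a ∣ ℚ.≤ ι K → ∣ b ∣ ℚ.< δ → ∣ a ℚ.* b ∣ ℚ.< ε
  small K {δ} {ε} a {b} eq a≤K b<δ = begin-strict
    ∣ a ℚ.* b ∣        ≡⟨ ℚ.∣p*q∣≡∣p∣*∣q∣ a b ⟩
    ∣ a ∣ ℚ.* ∣ b ∣    ≤⟨ ℚ.*-monoʳ-≤-nonNeg ∣ b ∣ {{ℚ.∣-∣-nonNeg b}} (ℚ.≤-trans a≤K (ι-mono {K} {suc K} (ℕ.n≤1+n K))) ⟩
    ι (suc K) ℚ.* ∣ b ∣  <⟨ ℚ.*-monoʳ-<-pos (ι (suc K)) {{ℚ.positive (ι-suc>0 K)}} b<δ ⟩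
    ι (suc K) ℚ.* δ    ≡⟨ eq ⟩
    ε                  ∎
    where open ℚ.≤-Reasoning

  ½^-pos : ∀ n → 0ℚ ℚ.< ½ ^ n
  ½^-pos zero    = ℚ.positive⁻¹ 1ℚ
  ½^-pos (suc n) = *-pos (ℚ.positive⁻¹ ½) (½^-pos n)

  ½^-anti : ∀ {m n} → m ℕ.≤′ n → ½ ^ n ℚ.≤ ½ ^ m
  ½^-anti ℕ.≤′-refl = ℚ.≤-refl
  ½^-anti {m} {suc n} (ℕ.≤′-step m≤n) = begin
    ½ ℚ.* ½ ^ n     ≤⟨ ℚ.*-monoʳ-≤-nonNeg (½ ^ n) {{ℚ.pos⇒nonNeg (½ ^ n) {{ℚ.positive (½^-pos n)}}}} (ℚ.≤ᵇ⇒≤ {½} {1ℚ} _) ⟩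
    1ℚ ℚ.* ½ ^ n    ≡⟨ ℚ.*-identityˡ (½ ^ n) ⟩
    ½ ^ n           ≤⟨ ½^-anti m≤n ⟩
    ½ ^ m           ∎
    where open ℚ.≤-Reasoning

  ½^n*[1+n]≤1 : ∀ n → ½ ^ n ℚ.* ι (suc n) ℚ.≤ 1ℚ
  ½^n*[1+n]≤1 zero    = ℚ.≤-refl
  ½^n*[1+n]≤1 (suc n) = begin
    ½ ℚ.* ½ ^ n ℚ.* ι (suc (suc n))
      ≡⟨ cong (½ ℚ.* ½ ^ n ℚ.*_) (trans (ι-suc (suc n)) (cong (1ℚ ℚ.+_) (ι-suc n))) ⟩
    ½ ℚ.* ½ ^ n ℚ.* (1ℚ ℚ.+ (1ℚ ℚ.+ ι n))
      ≡⟨ solve 2 (λ h k → con ½ :* h :* (con 1ℚ :+ (con 1ℚ :+ k)) := h :* (con 1ℚ :+ con ½ :* k)) refl (½ ^ n) (ι n) ⟩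
    ½ ^ n ℚ.* (1ℚ ℚ.+ ½ ℚ.* ι n)
      ≤⟨ ℚ.*-monoˡ-≤-nonNeg (½ ^ n) {{ℚ.nonNegative (ℚ.<⇒≤ (½^-pos n))}} (ℚ.+-monoʳ-≤ 1ℚ half≤) ⟩
    ½ ^ n ℚ.* (1ℚ ℚ.+ ι n)
      ≡⟨ cong (½ ^ n ℚ.*_) (sym (ι-suc n)) ⟩
    ½ ^ n ℚ.* ι (suc n)
      ≤⟨ ½^n*[1+n]≤1 n ⟩
    1ℚ ∎
    where
    open ℚ.≤-Reasoning
    half≤ : ½ ℚ.* ι n ℚ.≤ ι n
    half≤ = subst (½ ℚ.* ι n ℚ.≤_) (ℚ.*-identityˡ (ι n))
      (ℚ.*-monoʳ-≤-nonNeg (ι n) {{ℚ.nonNegative (ι≥0 n)}} (ℚ.≤ᵇ⇒≤ {½} {1ℚ} _))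

  geometric-small : ∀ K {ε} → 0ℚ ℚ.< ε → ∃ λ n → ι K ℚ.* ½ ^ n ℚ.< ε
  geometric-small K {ε} 0<ε = let n , K<nε = archimedean K 0<ε in n , (begin-strict
    ι K ℚ.* ½ ^ n                    <⟨ ℚ.*-monoˡ-<-pos (½ ^ n) {{ℚ.positive (½^-pos n)}} K<nε ⟩
    ι (suc n) ℚ.* ε ℚ.* ½ ^ n        ≡⟨ solve 3 (λ k e h → k :* e :* h := (h :* k) :* e) refl (ι (suc n)) ε (½ ^ n) ⟩
    ½ ^ n ℚ.* ι (suc n) ℚ.* ε        ≤⟨ ℚ.*-monoʳ-≤-nonNeg ε {{ℚ.nonNegative (ℚ.<⇒≤ 0<ε)}} (½^n*[1+n]≤1 n) ⟩
    1ℚ ℚ.* ε                         ≡⟨ ℚ.*-identityˡ ε ⟩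
    ε                                ∎)
    where open ℚ.≤-Reasoning

  sum-diff : ∀ f g n → sum (λ k → f k ℚ.- g k) n ≡ sum f n ℚ.- sum g n
  sum-diff f g zero    = refl
  sum-diff f g (suc n) = trans (cong (ℚ._+ (f n ℚ.- g n)) (sum-diff f g n))
    (solve 4 (λ a b c d → (a :- b) :+ (c :- d) := (a :+ c) :- (b :+ d)) refl (sum f n) (sum g n) (f n) (g n))

  tail′ : ∀ f C → (∀ k → ∣ f k ∣ ℚ.≤ C ℚ.* ½ ^ k) → ∀ m d →
         ∣ sum f (d ℕ.+ m) ℚ.- sum f m ∣ ℚ.≤ (C ℚ.+ C) ℚ.* (½ ^ m ℚ.- ½ ^ (d ℕ.+ m))
  tail′ f C f≤ m zero = ℚ.≤-reflexive (trans (∣a-a∣≡0 (sum f m))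
    (solve 2 (λ c h → con 0ℚ := (c :+ c) :* (h :- h)) refl C (½ ^ m)))
  tail′ f C f≤ m (suc d) = begin
    ∣ sum f (d ℕ.+ m) ℚ.+ f (d ℕ.+ m) ℚ.- sum f m ∣
      ≡⟨ cong ∣_∣ (solve 3 (λ a b c → a :+ b :- c := (a :- c) :+ b) refl (sum f (d ℕ.+ m)) (f (d ℕ.+ m)) (sum f m)) ⟩
    ∣ sum f (d ℕ.+ m) ℚ.- sum f m ℚ.+ f (d ℕ.+ m) ∣
      ≤⟨ ℚ.∣p+q∣≤∣p∣+∣q∣ (sum f (d ℕ.+ m) ℚ.- sum f m) (f (d ℕ.+ m)) ⟩
    ∣ sum f (d ℕ.+ m) ℚ.- sum f m ∣ ℚ.+ ∣ f (d ℕ.+ m) ∣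
      ≤⟨ ℚ.+-mono-≤ (tail′ f C f≤ m d) (f≤ (d ℕ.+ m)) ⟩
    (C ℚ.+ C) ℚ.* (½ ^ m ℚ.- ½ ^ (d ℕ.+ m)) ℚ.+ C ℚ.* ½ ^ (d ℕ.+ m)
      ≡⟨ solve 3 (λ c h g → (c :+ c) :* (h :- g) :+ c :* g := (c :+ c) :* (h :- con ½ :* g)) refl C (½ ^ m) (½ ^ (d ℕ.+ m)) ⟩
    (C ℚ.+ C) ℚ.* (½ ^ m ℚ.- ½ ℚ.* ½ ^ (d ℕ.+ m)) ∎
    where open ℚ.≤-Reasoning

  tail : ∀ f C → 0ℚ ℚ.≤ C → (∀ k → ∣ f k ∣ ℚ.≤ C ℚ.* ½ ^ k) → ∀ m {n} → m ℕ.≤ n →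
         ∣ sum f n ℚ.- sum f m ∣ ℚ.≤ (C ℚ.+ C) ℚ.* ½ ^ m
  tail f C 0≤C f≤ m {n} m≤n = begin
    ∣ sum f n ℚ.- sum f m ∣                     ≡⟨ cong (λ k → ∣ sum f k ℚ.- sum f m ∣) (sym eq) ⟩
    ∣ sum f (d ℕ.+ m) ℚ.- sum f m ∣             ≤⟨ tail′ f C f≤ m d ⟩
    (C ℚ.+ C) ℚ.* (½ ^ m ℚ.- ½ ^ (d ℕ.+ m))     ≤⟨ ℚ.*-monoˡ-≤-nonNeg (C ℚ.+ C) {{ℚ.nonNegative (ℚ.+-mono-≤ 0≤C 0≤C)}} drop ⟩
    (C ℚ.+ C) ℚ.* ½ ^ m                         ∎
    where
    open ℚ.≤-Reasoning
    d : ℕ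
    d = n ℕ.∸ m
    eq : d ℕ.+ m ≡ n
    eq = ℕ.m∸n+n≡m m≤n
    drop : ½ ^ m ℚ.- ½ ^ (d ℕ.+ m) ℚ.≤ ½ ^ m
    drop = subst (½ ^ m ℚ.- ½ ^ (d ℕ.+ m) ℚ.≤_) (ℚ.+-identityʳ (½ ^ m))
      (ℚ.+-monoʳ-≤ (½ ^ m) (ℚ.neg-antimono-≤ (ℚ.<⇒≤ (½^-pos (d ℕ.+ m)))))

  ^-distrib-* : ∀ a b n → (a ℚ.* b) ^ n ≡ a ^ n ℚ.* b ^ n
  ^-distrib-* a b zero    = refl
  ^-distrib-* a b (suc n) = trans (cong (a ℚ.* b ℚ.*_) (^-distrib-* a b n))
    (solve 4 (λ a b c d → a :* b :* (c :* d) := (a :* c) :* (b :* d)) refl a b (a ^ n) (b ^ n))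

  power≤factorial : ∀ N .{{_ : ℕ.NonZero N}} j → N ℕ.^ j ℕ.≤ N ℕ.^ N ℕ.* j !
  power≤factorial N zero = subst (1 ℕ.≤_) (sym (ℕ.*-identityʳ (N ℕ.^ N))) (ℕ.m^n>0 N N)
  power≤factorial N (suc j) with ℕ.≤-total (suc j) N
  ... | inj₁ j<N = ℕ.≤-trans (ℕ.^-monoʳ-≤ N j<N) (ℕ.m≤m*n (N ℕ.^ N) (suc j !) {{suc j ℕ.!≢0}})
  ... | inj₂ N≤j = begin
    N ℕ.* N ℕ.^ j                       ≤⟨ ℕ.*-mono-≤ N≤j (power≤factorial N j) ⟩
    suc j ℕ.* (N ℕ.^ N ℕ.* j !)         ≡⟨ sym (ℕ.*-assoc (suc j) (N ℕ.^ N) (j !)) ⟩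
    suc j ℕ.* N ℕ.^ N ℕ.* j !           ≡⟨ cong (ℕ._* j !) (ℕ.*-comm (suc j) (N ℕ.^ N)) ⟩
    N ℕ.^ N ℕ.* suc j ℕ.* j !           ≡⟨ ℕ.*-assoc (N ℕ.^ N) (suc j) (j !) ⟩
    N ℕ.^ N ℕ.* (suc j ℕ.* j !)         ∎
    where open ℕ.≤-Reasoning

  majorant : ℕ → ℕ
  majorant M = (2 ℕ.* suc M) ℕ.^ (2 ℕ.* suc M)

  recip≥0 : ∀ n .{{_ : ℕ.NonZero n}} → 0ℚ ℚ.≤ recip n
  recip≥0 n = ℚ.nonNegative⁻¹ (recip n) {{ℚ.normalize-nonNeg 1 n}}

  majorises : ∀ M j → ι (suc M) ^ j ℚ.* recip (j !) {{j ℕ.!≢0}} ℚ.≤ ι (majorant M) ℚ.* ½ ^ j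
  majorises M j = begin
    ι (suc M) ^ j ℚ.* r                          ≡⟨ cong (λ t → t ^ j ℚ.* r) halved ⟩
    (ι N ℚ.* ½) ^ j ℚ.* r                        ≡⟨ cong (ℚ._* r) (^-distrib-* (ι N) ½ j) ⟩
    ι N ^ j ℚ.* ½ ^ j ℚ.* r                      ≡⟨ cong (λ t → t ℚ.* ½ ^ j ℚ.* r) (sym (ι-^ N j)) ⟩
    ι (N ℕ.^ j) ℚ.* ½ ^ j ℚ.* r                  ≡⟨ ℚ.*-assoc (ι (N ℕ.^ j)) (½ ^ j) r ⟩
    ι (N ℕ.^ j) ℚ.* (½ ^ j ℚ.* r)                ≤⟨ ℚ.*-monoʳ-≤-nonNeg (½ ^ j ℚ.* r) {{ℚ.nonNegative (*-nonNeg (ℚ.<⇒≤ (½^-pos j)) (recip≥0 (j !)))}} (ι-mono {N ℕ.^ j} {majorant M ℕ.* j !} (power≤factorial N j)) ⟩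
    ι (majorant M ℕ.* j !) ℚ.* (½ ^ j ℚ.* r)     ≡⟨ cong (ℚ._* (½ ^ j ℚ.* r)) (ι-* (majorant M) (j !)) ⟩
    ι (majorant M) ℚ.* ι (j !) ℚ.* (½ ^ j ℚ.* r) ≡⟨ solve 4 (λ g f h r → g :* f :* (h :* r) := (g :* h) :* (f :* r)) refl (ι (majorant M)) (ι (j !)) (½ ^ j) r ⟩
    ι (majorant M) ℚ.* ½ ^ j ℚ.* (ι (j !) ℚ.* r) ≡⟨ cong (ι (majorant M) ℚ.* ½ ^ j ℚ.*_) (ι*recip (j !)) ⟩
    ι (majorant M) ℚ.* ½ ^ j ℚ.* 1ℚ              ≡⟨ ℚ.*-identityʳ (ι (majorant M) ℚ.* ½ ^ j) ⟩
    ι (majorant M) ℚ.* ½ ^ j                     ∎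
    where
    open ℚ.≤-Reasoning
    instance
      j!≢0 : ℕ.NonZero (j !)
      j!≢0 = j ℕ.!≢0
    N : ℕ
    N = 2 ℕ.* suc M
    r : ℚ
    r = recip (j !)
    halved : ι (suc M) ≡ ι N ℚ.* ½
    halved = trans (solve 1 (λ a → a := con (ι 2) :* a :* con ½) refl (ι (suc M)))
      (cong (ℚ._* ½) (sym (ι-* 2 (suc M))))

  ≤ιsuc : ∀ {M q} → ∣ q ∣ ℚ.≤ ι M → ∣ q ∣ ℚ.≤ ι (suc M)
  ≤ιsuc {M} q≤M = ℚ.≤-trans q≤M (ι-mono {M} {suc M} (ℕ.n≤1+n M))

  ∣q^j∣≤ : ∀ {M} q → ∣ q ∣ ℚ.≤ ι M → ∀ j → ∣ q ^ j ∣ ℚ.≤ ι (suc M) ^ j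
  ∣q^j∣≤ {M} q q≤M j = subst (ℚ._≤ ι (suc M) ^ j) (sym (∣^∣ q j))
    (^-mono (ℚ.0≤∣p∣ q) (≤ιsuc {M} {q} q≤M) j)

  ^-lipschitz : ∀ {M} p q → ∣ p ∣ ℚ.≤ ι M → ∣ q ∣ ℚ.≤ ι M → ∀ j →
                ∣ p ^ j ℚ.- q ^ j ∣ ℚ.≤ ∣ p ℚ.- q ∣ ℚ.* ι (suc M) ^ j
  ^-lipschitz p q p≤M q≤M zero = subst (0ℚ ℚ.≤_) (sym (ℚ.*-identityʳ ∣ p ℚ.- q ∣)) (ℚ.0≤∣p∣ (p ℚ.- q))
  ^-lipschitz {M} p q p≤M q≤M (suc j) = begin
    ∣ p ℚ.* P ℚ.- q ℚ.* Q ∣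
      ≡⟨ cong ∣_∣ (solve 4 (λ p q P Q → p :* P :- q :* Q := p :* (P :- Q) :+ (p :- q) :* Q) refl p q P Q) ⟩
    ∣ p ℚ.* (P ℚ.- Q) ℚ.+ (p ℚ.- q) ℚ.* Q ∣
      ≤⟨ ℚ.∣p+q∣≤∣p∣+∣q∣ (p ℚ.* (P ℚ.- Q)) ((p ℚ.- q) ℚ.* Q) ⟩
    ∣ p ℚ.* (P ℚ.- Q) ∣ ℚ.+ ∣ (p ℚ.- q) ℚ.* Q ∣
      ≡⟨ cong₂ ℚ._+_ (ℚ.∣p*q∣≡∣p∣*∣q∣ p (P ℚ.- Q)) (ℚ.∣p*q∣≡∣p∣*∣q∣ (p ℚ.- q) Q) ⟩
    ∣ p ∣ ℚ.* ∣ P ℚ.- Q ∣ ℚ.+ D ℚ.* ∣ Q ∣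
      ≤⟨ ℚ.+-mono-≤ (*-mono (ℚ.0≤∣p∣ (P ℚ.- Q)) (ι≥0 M) p≤M (^-lipschitz {M} p q p≤M q≤M j))
                    (ℚ.*-monoˡ-≤-nonNeg D {{ℚ.∣-∣-nonNeg (p ℚ.- q)}} (∣q^j∣≤ {M} q q≤M j)) ⟩
    ι M ℚ.* (D ℚ.* B) ℚ.+ D ℚ.* B
      ≡⟨ solve 3 (λ m d b → m :* (d :* b) :+ d :* b := d :* ((con 1ℚ :+ m) :* b)) refl (ι M) D B ⟩
    D ℚ.* ((1ℚ ℚ.+ ι M) ℚ.* B)
      ≡⟨ cong (λ t → D ℚ.* (t ℚ.* B)) (sym (ι-suc M)) ⟩
    D ℚ.* (ι (suc M) ℚ.* B) ∎
    where
    open ℚ.≤-Reasoning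
    P Q D B : ℚ
    P = p ^ j
    Q = q ^ j
    D = ∣ p ℚ.- q ∣
    B = ι (suc M) ^ j

  ∣[-1]^k*q∣ : ∀ k q → ∣ (ℚ.- 1ℚ) ^ k ℚ.* q ∣ ≡ ∣ q ∣
  ∣[-1]^k*q∣ k q = trans (ℚ.∣p*q∣≡∣p∣*∣q∣ ((ℚ.- 1ℚ) ^ k) q)
    (trans (cong (ℚ._* ∣ q ∣) (trans (∣^∣ (ℚ.- 1ℚ) k) (one k))) (ℚ.*-identityˡ ∣ q ∣))
    where
    one : ∀ k → 1ℚ ^ k ≡ 1ℚ
    one zero    = refl
    one (suc k) = trans (ℚ.*-identityˡ (1ℚ ^ k)) (one k)

  ∣a*recip∣ : ∀ a n .{{_ : ℕ.NonZero n}} → ∣ a ℚ.* recip n ∣ ≡ ∣ a ∣ ℚ.* recip n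
  ∣a*recip∣ a n = trans (ℚ.∣p*q∣≡∣p∣*∣q∣ a (recip n)) (cong (∣ a ∣ ℚ.*_) (ℚ.0≤p⇒∣p∣≡p (recip≥0 n)))

  module _ {M p} (p≤M : ∣ p ∣ ℚ.≤ ι M) {k j} (k≤j : k ℕ.≤ j) where

    private
      instance
        j!≢0 : ℕ.NonZero (j !)
        j!≢0 = j ℕ.!≢0
      G r : ℚ
      G = ι (majorant M)
      r = recip (j !)
      weaken : G ℚ.* ½ ^ j ℚ.≤ G ℚ.* ½ ^ k
      weaken = ℚ.*-monoˡ-≤-nonNeg G {{ℚ.nonNegative (ι≥0 (majorant M))}} (½^-anti (ℕ.≤⇒≤′ k≤j))

    term-bound : ∣ term j p k ∣ ℚ.≤ G ℚ.* ½ ^ k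
    term-bound = begin
      ∣ term j p k ∣                    ≡⟨ ∣[-1]^k*q∣ k (p ^ j ℚ.* r) ⟩
      ∣ p ^ j ℚ.* r ∣                   ≡⟨ ∣a*recip∣ (p ^ j) (j !) ⟩
      ∣ p ^ j ∣ ℚ.* r                   ≤⟨ ℚ.*-monoʳ-≤-nonNeg r {{ℚ.nonNegative (recip≥0 (j !))}} (∣q^j∣≤ {M} p p≤M j) ⟩
      ι (suc M) ^ j ℚ.* r               ≤⟨ majorises M j ⟩
      G ℚ.* ½ ^ j                       ≤⟨ weaken ⟩
      G ℚ.* ½ ^ k                       ∎
      where open ℚ.≤-Reasoning

    term-lipschitz : ∀ q → ∣ q ∣ ℚ.≤ ι M →
                     ∣ term j p k ℚ.- term j q k ∣ ℚ.≤ (∣ p ℚ.- q ∣ ℚ.* G) ℚ.* ½ ^ k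
    term-lipschitz q q≤M = begin
      ∣ term j p k ℚ.- term j q k ∣
        ≡⟨ cong ∣_∣ (solve 4 (λ s a b r → s :* (a :* r) :- s :* (b :* r) := s :* ((a :- b) :* r)) refl ((ℚ.- 1ℚ) ^ k) (p ^ j) (q ^ j) r) ⟩
      ∣ (ℚ.- 1ℚ) ^ k ℚ.* ((p ^ j ℚ.- q ^ j) ℚ.* r) ∣
        ≡⟨ ∣[-1]^k*q∣ k ((p ^ j ℚ.- q ^ j) ℚ.* r) ⟩
      ∣ (p ^ j ℚ.- q ^ j) ℚ.* r ∣
        ≡⟨ ∣a*recip∣ (p ^ j ℚ.- q ^ j) (j !) ⟩
      ∣ p ^ j ℚ.- q ^ j ∣ ℚ.* r
        ≤⟨ ℚ.*-monoʳ-≤-nonNeg r {{ℚ.nonNegative (recip≥0 (j !))}} (^-lipschitz {M} p q p≤M q≤M j) ⟩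
      D ℚ.* ι (suc M) ^ j ℚ.* r
        ≡⟨ ℚ.*-assoc D (ι (suc M) ^ j) r ⟩
      D ℚ.* (ι (suc M) ^ j ℚ.* r)
        ≤⟨ ℚ.*-monoˡ-≤-nonNeg D {{ℚ.∣-∣-nonNeg (p ℚ.- q)}} (ℚ.≤-trans (majorises M j) weaken) ⟩
      D ℚ.* (G ℚ.* ½ ^ k)
        ≡⟨ sym (ℚ.*-assoc D G (½ ^ k)) ⟩
      D ℚ.* G ℚ.* ½ ^ k ∎
      where
      open ℚ.≤-Reasoning
      D : ℚ
      D = ∣ p ℚ.- q ∣

open Estimates

-- Real numbers are Cauchy sequences of rationals; _≈_ is equality of limits,
-- and every predicate on them is stated up to _≈_.
Cauchy : (ℕ → ℚ) → Set
Cauchy s = ∀ ε → 0ℚ ℚ.< ε → ∃ λ N → ∀ m n → N ℕ.≤ m → N ℕ.≤ n → ∣ s m ℚ.- s n ∣ ℚ.< ε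

record ℝ : Set where
  constructor mkℝ
  field
    seq    : ℕ → ℚ
    cauchy : Cauchy seq

open ℝ public

infix  4 _≈_ _≉_
infixl 6 _+_ _-_
infixl 7 _*_
infix  8 -_

_≈_ : ℝ → ℝ → Set
x ≈ y = ∀ ε → 0ℚ ℚ.< ε → ∃ λ N → ∀ n → N ℕ.≤ n → ∣ seq x n ℚ.- seq y n ∣ ℚ.< ε

_≉_ : ℝ → ℝ → Set
x ≉ y = ¬ x ≈ y

abstract
  bounded : ∀ x → ∃ λ K → ∀ n → ∣ seq x n ∣ ℚ.≤ ι K
  bounded x with cauchy x 1ℚ (ℚ.positive⁻¹ 1ℚ)
  ... | N , close = proj₁ c , λ n → ℚ.≤-trans (below n) (proj₂ c)
    where
    open ℚ.≤-Reasoning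
    f : ℕ → ℚ
    f k = ∣ seq x k ∣
    sum≥0 : ∀ n → 0ℚ ℚ.≤ sum f n
    sum≥0 zero    = ℚ.≤-refl
    sum≥0 (suc n) = ℚ.+-mono-≤ (sum≥0 n) (ℚ.0≤∣p∣ (seq x n))
    B : ℚ
    B = sum f (suc N) ℚ.+ 1ℚ
    c : ∃ λ n → B ℚ.≤ ι n
    c = ceil B
    term≤sum : ∀ {k n} → k ℕ.<′ n → f k ℚ.≤ sum f n
    term≤sum {k} {suc n} ℕ.<′-base = begin
      f k                 ≡⟨ sym (ℚ.+-identityˡ (f k)) ⟩
      0ℚ ℚ.+ f k          ≤⟨ ℚ.+-monoˡ-≤ (f k) (sum≥0 k) ⟩
      sum f k ℚ.+ f k     ∎
    term≤sum {k} {suc n} (ℕ.≤′-step k<n) = begin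
      f k                 ≤⟨ term≤sum k<n ⟩
      sum f n             ≡⟨ sym (ℚ.+-identityʳ (sum f n)) ⟩
      sum f n ℚ.+ 0ℚ      ≤⟨ ℚ.+-monoʳ-≤ (sum f n) (ℚ.0≤∣p∣ (seq x n)) ⟩
      sum f n ℚ.+ f n     ∎
    below : ∀ n → f n ℚ.≤ B
    below n with ℕ.≤-total n N
    ... | inj₁ n≤N = begin
      f n                        ≤⟨ term≤sum (ℕ.≤⇒≤′ (s≤s n≤N)) ⟩
      sum f (suc N)              ≡⟨ sym (ℚ.+-identityʳ _) ⟩
      sum f (suc N) ℚ.+ 0ℚ       ≤⟨ ℚ.+-monoʳ-≤ (sum f (suc N)) (ℚ.<⇒≤ (ℚ.positive⁻¹ 1ℚ)) ⟩
      B                          ∎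
    ... | inj₂ N≤n = begin
      f n                                      ≡⟨ cong ∣_∣ (solve 2 (λ a b → a := b :+ (a :- b)) refl (seq x n) (seq x N)) ⟩
      ∣ seq x N ℚ.+ (seq x n ℚ.- seq x N) ∣    ≤⟨ ℚ.∣p+q∣≤∣p∣+∣q∣ (seq x N) _ ⟩
      f N ℚ.+ ∣ seq x n ℚ.- seq x N ∣          ≤⟨ ℚ.+-mono-≤ (term≤sum {N} ℕ.<′-base) (ℚ.<⇒≤ (close n N N≤n ℕ.≤-refl)) ⟩
      B                                        ∎
      where open +-*-Solver

abstract
  const-cauchy : ∀ q → Cauchy (λ _ → q)
  const-cauchy q ε 0<ε = 0 , λ _ _ _ _ → subst (ℚ._< ε) (sym (∣a-a∣≡0 q)) 0<ε

fromℚ : ℚ → ℝ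
fromℚ q = mkℝ (λ _ → q) (const-cauchy q)

abstract
  neg-cauchy : ∀ x → Cauchy (λ n → ℚ.- seq x n)
  neg-cauchy x = λ ε 0<ε →
    let N , close = cauchy x ε 0<ε in
    N , λ m n N≤m N≤n → subst (ℚ._< ε) (flip (seq x m) (seq x n)) (close m n N≤m N≤n)
    where
    open +-*-Solver
    flip : ∀ a b → ∣ a ℚ.- b ∣ ≡ ∣ ℚ.- a ℚ.- ℚ.- b ∣
    flip a b = trans (∣a-b∣≡∣b-a∣ a b)
      (cong ∣_∣ (solve 2 (λ a b → b :- a := :- a :- :- b) refl a b))

-_ : ℝ → ℝ
- x = mkℝ (λ n → ℚ.- seq x n) (neg-cauchy x)

abstract
  +-cauchy : ∀ x y → Cauchy (λ n → seq x n ℚ.+ seq y n)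
  +-cauchy x y = λ ε 0<ε →
    let M , closeˣ = cauchy x (ε ℚ.* ½) (half>0 0<ε)
        N , closeʸ = cauchy y (ε ℚ.* ½) (half>0 0<ε)
    in M ℕ.⊔ N , λ m n N≤m N≤n → begin-strict
      ∣ (seq x m ℚ.+ seq y m) ℚ.- (seq x n ℚ.+ seq y n) ∣
        ≡⟨ cong ∣_∣ (solve 4 (λ a b c d → (a :+ b) :- (c :+ d) := (a :- c) :+ (b :- d)) refl (seq x m) (seq y m) (seq x n) (seq y n)) ⟩
      ∣ (seq x m ℚ.- seq x n) ℚ.+ (seq y m ℚ.- seq y n) ∣
        ≤⟨ ℚ.∣p+q∣≤∣p∣+∣q∣ (seq x m ℚ.- seq x n) _ ⟩
      ∣ seq x m ℚ.- seq x n ∣ ℚ.+ ∣ seq y m ℚ.- seq y n ∣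
        <⟨ ℚ.+-mono-< (closeˣ m n (ℕ.m⊔n≤o⇒m≤o M N N≤m) (ℕ.m⊔n≤o⇒m≤o M N N≤n))
                      (closeʸ m n (ℕ.m⊔n≤o⇒n≤o M N N≤m) (ℕ.m⊔n≤o⇒n≤o M N N≤n)) ⟩
      ε ℚ.* ½ ℚ.+ ε ℚ.* ½
        ≡⟨ halves ε ⟩
      ε ∎
    where
    open +-*-Solver
    open ℚ.≤-Reasoning

_+_ : ℝ → ℝ → ℝ
x + y = mkℝ (λ n → seq x n ℚ.+ seq y n) (+-cauchy x y)

_-_ : ℝ → ℝ → ℝ
x - y = x + (- y)

abstract
  *-cauchy : ∀ x y → Cauchy (λ n → seq x n ℚ.* seq y n)
  *-cauchy x y = λ ε 0<ε →
    let K , x≤K = bounded x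
        L , y≤L = bounded y
        δ , 0<δ , Kδ = shrink K (half>0 0<ε)
        γ , 0<γ , Lγ = shrink L (half>0 0<ε)
        M , closeˣ = cauchy x γ 0<γ
        N , closeʸ = cauchy y δ 0<δ
    in M ℕ.⊔ N , λ m n N≤m N≤n → begin-strict
      ∣ seq x m ℚ.* seq y m ℚ.- seq x n ℚ.* seq y n ∣
        ≡⟨ cong ∣_∣ (solve 4 (λ a b c d → a :* b :- c :* d := a :* (b :- d) :+ d :* (a :- c)) refl (seq x m) (seq y m) (seq x n) (seq y n)) ⟩
      ∣ seq x m ℚ.* (seq y m ℚ.- seq y n) ℚ.+ seq y n ℚ.* (seq x m ℚ.- seq x n) ∣
        ≤⟨ ℚ.∣p+q∣≤∣p∣+∣q∣ (seq x m ℚ.* (seq y m ℚ.- seq y n)) _ ⟩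
      ∣ seq x m ℚ.* (seq y m ℚ.- seq y n) ∣ ℚ.+ ∣ seq y n ℚ.* (seq x m ℚ.- seq x n) ∣
        <⟨ ℚ.+-mono-< (small K (seq x m) Kδ (x≤K m) (closeʸ m n (ℕ.m⊔n≤o⇒n≤o M N N≤m) (ℕ.m⊔n≤o⇒n≤o M N N≤n)))
                      (small L (seq y n) Lγ (y≤L n) (closeˣ m n (ℕ.m⊔n≤o⇒m≤o M N N≤m) (ℕ.m⊔n≤o⇒m≤o M N N≤n))) ⟩
      ε ℚ.* ½ ℚ.+ ε ℚ.* ½
        ≡⟨ halves ε ⟩
      ε ∎
    where
    open +-*-Solver
    open ℚ.≤-Reasoning

_*_ : ℝ → ℝ → ℝ
x * y = mkℝ (λ n → seq x n ℚ.* seq y n) (*-cauchy x y)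

abstract
  series-cauchy : ∀ (j : ℕ → ℕ) → (∀ k → k ℕ.≤ j k) → ∀ x →
                  Cauchy (λ n → sum (λ k → term (j k) (seq x n) k) n)
  series-cauchy j k≤j x ε 0<ε =
    let A , tail<  = geometric-small 2G (half>0 (half>0 0<ε))
        δ , 0<δ , eq = shrink 2G (half>0 0<ε)
        N , close  = cauchy x δ 0<δ
    in A ℕ.⊔ N , λ m n ≤m ≤n → begin-strict
      ∣ S m m ℚ.- S n n ∣
        ≤⟨ ∣-∣-triangle (S m m) (S m A) (S n n) ⟩
      ∣ S m m ℚ.- S m A ∣ ℚ.+ ∣ S m A ℚ.- S n n ∣
        ≤⟨ ℚ.+-monoʳ-≤ ∣ S m m ℚ.- S m A ∣ (∣-∣-triangle (S m A) (S n A) (S n n)) ⟩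
      ∣ S m m ℚ.- S m A ∣ ℚ.+ (∣ S m A ℚ.- S n A ∣ ℚ.+ ∣ S n A ℚ.- S n n ∣)
        ≡⟨ cong (λ t → ∣ S m m ℚ.- S m A ∣ ℚ.+ (∣ S m A ℚ.- S n A ∣ ℚ.+ t)) (∣a-b∣≡∣b-a∣ (S n A) (S n n)) ⟩
      ∣ S m m ℚ.- S m A ∣ ℚ.+ (∣ S m A ℚ.- S n A ∣ ℚ.+ ∣ S n n ℚ.- S n A ∣)
        <⟨ ℚ.+-mono-< (tails m A tail< m (ℕ.m⊔n≤o⇒m≤o A N ≤m)) (ℚ.+-mono-<
             (ℚ.≤-<-trans (moves m n A) (small 2G (ι 2G) {seq x m ℚ.- seq x n} eq (ℚ.≤-reflexive ∣2G∣)
               (close m n (ℕ.m⊔n≤o⇒n≤o A N ≤m) (ℕ.m⊔n≤o⇒n≤o A N ≤n))))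
             (tails n A tail< n (ℕ.m⊔n≤o⇒m≤o A N ≤n))) ⟩
      ε ℚ.* ½ ℚ.* ½ ℚ.+ (ε ℚ.* ½ ℚ.+ ε ℚ.* ½ ℚ.* ½)
        ≡⟨ solve 1 (λ e → e :* con ½ :* con ½ :+ (e :* con ½ :+ e :* con ½ :* con ½) := e) refl ε ⟩
      ε ∎
    where
    open +-*-Solver
    open ℚ.≤-Reasoning
    M G 2G : ℕ
    M  = proj₁ (bounded x)
    G  = majorant M
    2G = 2 ℕ.* G
    x≤M : ∀ n → ∣ seq x n ∣ ℚ.≤ ι M
    x≤M = proj₂ (bounded x)
    f : ℕ → ℕ → ℚ
    f n k = term (j k) (seq x n) k
    S : ℕ → ℕ → ℚ
    S n = sum (f n)
    G+G : ι G ℚ.+ ι G ≡ ι 2G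
    G+G = trans (solve 1 (λ g → g :+ g := con (ι 2) :* g) refl (ι G)) (sym (ι-* 2 G))
    ∣2G∣ : ∣ ι 2G ∣ ≡ ι 2G
    ∣2G∣ = ℚ.0≤p⇒∣p∣≡p (ι≥0 2G)
    tails : ∀ n A → ι 2G ℚ.* ½ ^ A ℚ.< ε ℚ.* ½ ℚ.* ½ → ∀ m → A ℕ.≤ m →
            ∣ S n m ℚ.- S n A ∣ ℚ.< ε ℚ.* ½ ℚ.* ½
    tails n A small-A m A≤m = ℚ.≤-<-trans
      (tail (f n) (ι G) (ι≥0 G) (λ k → term-bound {M} {seq x n} (x≤M n) (k≤j k)) A A≤m)
      (subst (λ t → t ℚ.* ½ ^ A ℚ.< ε ℚ.* ½ ℚ.* ½) (sym G+G) small-A)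
    moves : ∀ m n A → ∣ S m A ℚ.- S n A ∣ ℚ.≤ ∣ ι 2G ℚ.* (seq x m ℚ.- seq x n) ∣
    moves m n A = begin
      ∣ S m A ℚ.- S n A ∣
        ≡⟨ cong ∣_∣ (trans (sym (sum-diff (f m) (f n) A)) (sym (ℚ.+-identityʳ (sum g A)))) ⟩
      ∣ sum g A ℚ.- sum g 0 ∣
        ≤⟨ tail g (D ℚ.* ι G) (*-nonNeg (ℚ.0≤∣p∣ (seq x m ℚ.- seq x n)) (ι≥0 G))
             (λ k → term-lipschitz {M} {seq x m} (x≤M m) (k≤j k) (seq x n) (x≤M n)) 0 {A} z≤n ⟩
      (D ℚ.* ι G ℚ.+ D ℚ.* ι G) ℚ.* 1ℚ
        ≡⟨ solve 2 (λ d g → (d :* g :+ d :* g) :* con 1ℚ := (g :+ g) :* d) refl D (ι G) ⟩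
      (ι G ℚ.+ ι G) ℚ.* D
        ≡⟨ cong (ℚ._* D) (trans G+G (sym ∣2G∣)) ⟩
      ∣ ι 2G ∣ ℚ.* D
        ≡⟨ sym (ℚ.∣p*q∣≡∣p∣*∣q∣ (ι 2G) (seq x m ℚ.- seq x n)) ⟩
      ∣ ι 2G ℚ.* (seq x m ℚ.- seq x n) ∣ ∎
      where
      D : ℚ
      D = ∣ seq x m ℚ.- seq x n ∣
      g : ℕ → ℚ
      g k = f m k ℚ.- f n k

-- The n-th approximation is the Taylor polynomial with n terms, evaluated at
-- the n-th approximation of the argument: Σₖ (-1)ᵏ x²ᵏ / (2k)! for the cosine
-- and Σₖ (-1)ᵏ x²ᵏ⁺¹ / (2k+1)! for the sine.
cos : ℝ → ℝ
cos x = mkℝ (λ n → sum (λ k → term (2 ℕ.* k) (seq x n) k) n)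
            (series-cauchy (2 ℕ.*_) (λ k → ℕ.m≤n*m k 2) x)

sin : ℝ → ℝ
sin x = mkℝ (λ n → sum (λ k → term (suc (2 ℕ.* k)) (seq x n) k) n)
            (series-cauchy (λ k → suc (2 ℕ.* k)) (λ k → ℕ.m≤n⇒m≤1+n (ℕ.m≤n*m k 2)) x)

Point : Set
Point = ℝ × ℝ

infix 4 _≋_ _≇_

_≋_ : Point → Point → Set
(x , y) ≋ (x′ , y′) = x ≈ x′ × y ≈ y′

_≇_ : Point → Point → Set
P ≇ Q = ¬ P ≋ Q

distance² : Point → Point → ℝ
distance² (x , y) (x′ , y′) = (x - x′) * (x - x′) + (y - y′) * (y - y′)

-- line A B passes through A and B; circle O A has centre O and passes through A.
data Curve : Set where
  line   : Point → Point → Curve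
  circle : Point → Point → Curve

infix 4 _on_

_on_ : Point → Curve → Set
(x , y) on line (a₁ , a₂) (b₁ , b₂) = (b₁ - a₁) * (y - a₂) ≈ (b₂ - a₂) * (x - a₁)
P       on circle O A               = distance² P O ≈ distance² A O

-- The same point set, possibly drawn from different pairs of points.
SameCurve : Curve → Curve → Set
SameCurve K L = ∀ P → P on K ⇔ P on L

-- C S is the set of points constructible over S.  Points come with the setoid
-- equality _≋_, so the given points are those equal to a member of S.
-- Only curves that differ as point sets are intersected: otherwise every point
-- of a drawn curve would count as an intersection point.
mutual
  data C (S : Pred Point 0ℓ) : Pred Point 0ℓ where
    given     : ∀ {A P} → A ∈ S → P ≋ A → P ∈ C S
    intersect : ∀ {K L P} → Drawable S K → Drawable S L → ¬ SameCurve K L →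
                P on K → P on L → P ∈ C S

  data Drawable (S : Pred Point 0ℓ) : Pred Curve 0ℓ where
    line   : ∀ {A B} → A ∈ C S → B ∈ C S → A ≇ B → Drawable S (line A B)
    circle : ∀ {O A} → O ∈ C S → A ∈ C S → O ≇ A → Drawable S (circle O A)

trisectionData : ℝ → Pred Point 0ℓ
trisectionData α P = P ≋ (fromℚ 0ℚ , fromℚ 0ℚ)
                   ⊎ P ≋ (fromℚ 1ℚ , fromℚ 0ℚ)
                   ⊎ P ≋ (cos α , sin α)

Trisectable : Pred ℝ 0ℓ
Trisectable α = (cos α/3 , sin α/3) ∈ C (trisectionData α)
  where
  α/3 : ℝ
  α/3 = fromℚ (+ 1 ℚ./ 3) * α

Tri : Pred ℝ 0ℓ
Tri x = ∃ λ α → Trisectable α × x ≈ fromℚ (+ 2 ℚ./ 1) * cos α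

{-# OPTIONS --safe #-}
-- Let a = r² ≠ 0 and 2 cos α = a.  By the addition formulas 2 cos (α/3) is a
-- root of X³ - 3X - a, so it suffices that this cubic has no constructible root.
--
-- A root (U + V s)/N over a quadratic extension K(s) with V ≠ 0 comes with its
-- conjugate (U - V s)/N; the roots sum to 0, so -2U/N is a root in K.  Hence a
-- constructible root yields a rational one, x³ - 3x = r².  For x = p/q in lowest
-- terms the coprime (up to 3) factors of p q (p² - 3q²) are squares up to sign,
-- which modulo 3 leaves only u⁴ = 3e⁴ + v² with e ≠ 0, and this equation
-- is refuted by infinite descent.
--
-- Reals are Cauchy sequences, so equality is only ¬¬-stable.  Fields
-- are therefore represented by subrings, whose fractions z are real numbers
-- with n z = u for members n ≠ 0 and u, and case distinctions are made inside
-- the proof of ⊥.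
module Submission where

-- For x = p/q, multiplying x³ - 3x = r² by q⁴ gives p q (p² - 3q²) = (r q²)²: what has to be shown
-- is that the elliptic curve y² = x³ - 3x has no rational point with y ≠ 0. The point (0, 0) does
-- exist, and a ≠ 0 is what excludes it. The quartic u⁴ = 3e⁴ + v² and its companion 12a⁴ + b⁴ = u²
-- are the two equations of a 2-isogeny descent: e is even modulo 8, and passing through the
-- companion returns a solution with e replaced by some c ≤ e/2.
--
-- In the tower, neither "s is already a fraction over K" nor "V = 0" can be decided. The
-- conjugation argument therefore does not suppose s to be new. The cubic at (U + V s)/N, cleared of
-- denominators, is A + B s with A and B in K. If B ≠ 0, then s is a fraction over K and the root
-- itself descends; if B = 0, then A = 0, and U/N or -2U/N is a root according to which factor of B
-- vanishes.

module Descent where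

  open import Data.Nat.Base
  open import Data.Nat.Properties
  open import Data.Nat.Divisibility
  open import Data.Nat.DivMod
  open import Data.Nat.GCD using (gcd; gcd[m,n]∣m; gcd[m,n]∣n; c*gcd[m,n]≡gcd[cm,cn])
  open import Data.Nat.Coprimality as Coprimality using (Coprime; coprime-divisor; coprime-/gcd)
  open import Data.Nat.Primality using (Prime; prime?; euclidsLemma)
  open import Data.Nat.Induction using (<-wellFounded)
  open import Data.Nat.Tactic.RingSolver using (solve-∀)
  open import Data.Empty using (⊥; ⊥-elim)
  open import Data.Product using (∃; ∃₂; _×_; _,_; proj₁; proj₂)
  open import Data.Sum using (_⊎_; inj₁; inj₂)
  open import Induction.WellFounded using (Acc; acc)
  open import Relation.Binary.Definitions using (tri<; tri≈; tri>)
  open import Relation.Binary.PropositionalEquality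
  open import Relation.Nullary using (¬_; yes; no; contradiction)
  open import Relation.Nullary.Decidable using (from-yes; from-no; _→-dec_)

  -- Congruences modulo 3, 4 and 8 from finite tables

  module Residue (n : ℕ) .{{_ : NonZero n}} where

    infix 4 _≡ₙ_
    record _≡ₙ_ (a b : ℕ) : Set where
      constructor [_]ₙ
      field %-≡ : a % n ≡ b % n

    open _≡ₙ_ public

    +-≡ₙ : ∀ {a a′ b b′} → a ≡ₙ a′ → b ≡ₙ b′ → a + b ≡ₙ a′ + b′
    +-≡ₙ {a} {a′} {b} {b′} [ p ]ₙ [ q ]ₙ = [ trans (%-distribˡ-+ a b n)
      (trans (cong₂ (λ x y → (x + y) % n) p q) (sym (%-distribˡ-+ a′ b′ n))) ]ₙ

    *-≡ₙ : ∀ {a a′ b b′} → a ≡ₙ a′ → b ≡ₙ b′ → a * b ≡ₙ a′ * b′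
    *-≡ₙ {a} {a′} {b} {b′} [ p ]ₙ [ q ]ₙ = [ trans (%-distribˡ-* a b n)
      (trans (cong₂ (λ x y → (x * y) % n) p q) (sym (%-distribˡ-* a′ b′ n))) ]ₙ

    square-≡ₙ : ∀ a → a * a ≡ₙ a % n * (a % n)
    square-≡ₙ a = *-≡ₙ reduce reduce
      where
      reduce : a ≡ₙ a % n
      reduce = [ sym (m%n%n≡m%n a n) ]ₙ

    fourth-≡ₙ : ∀ a → a * a * (a * a) ≡ₙ a % n * (a % n) * (a % n * (a % n))
    fourth-≡ₙ a = *-≡ₙ (square-≡ₙ a) (square-≡ₙ a)

  -- Squares are 0 or 1 modulo 3, so the sum vanishes only if both do. This obstruction eliminates
  -- every wrong distribution of the prime 3 among coprime factors.
  sum-of-squares-3∣ : ∀ s t k → s * s + t * t ≡ 3 * k → 3 ∣ s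
  sum-of-squares-3∣ s t k eq = m%n≡0⇒n∣m s 3
    (table (m%n<n s 3) (m%n<n t 3)
      (trans (sym (%-≡ (+-≡ₙ (square-≡ₙ s) (square-≡ₙ t))))
             (n∣m⇒m%n≡0 (s * s + t * t) 3 (subst (3 ∣_) (sym eq) (m∣m*n k)))))
    where
    open Residue 3
    table : ∀ {x} → x < 3 → ∀ {y} → y < 3 → (x * x + y * y) % 3 ≡ 0 → x ≡ 0
    table = from-yes (allUpTo? (λ x → allUpTo? (λ y →
      ((x * x + y * y) % 3 ≟ 0) →-dec (x ≟ 0)) 3) 3)

  -- For odd e the square v² would be 5 or 6 modulo 8, and neither is a square. The modulus 4 would
  -- be too coarse, since 5 becomes the square 1.
  quartic-2∣ : ∀ u e v → u * u * (u * u) ≡ 3 * (e * e * (e * e)) + v * v → 2 ∣ e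
  quartic-2∣ u e v eq = ∣n∣m%n⇒∣m {n = 8} (divides 4 refl) (m%n≡0⇒n∣m (e % 8) 2
    (table (m%n<n u 8) (m%n<n e 8) (m%n<n v 8)
      (trans (sym (%-≡ (fourth-≡ₙ u))) (trans (cong (_% 8) eq)
        (%-≡ (+-≡ₙ (*-≡ₙ {3} {3} [ refl ]ₙ (fourth-≡ₙ e)) (square-≡ₙ v)))))))
    where
    open Residue 8
    table : ∀ {x} → x < 8 → ∀ {y} → y < 8 → ∀ {z} → z < 8 →
            (x * x * (x * x)) % 8 ≡ (3 * (y * y * (y * y)) + z * z) % 8 → y % 2 ≡ 0
    table = from-yes (allUpTo? (λ x → allUpTo? (λ y → allUpTo? (λ z →
      ((x * x * (x * x)) % 8 ≟ (3 * (y * y * (y * y)) + z * z) % 8) →-dec (y % 2 ≟ 0)) 8) 8) 8)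

  -- An odd a would make u² ≡ 3 modulo 4.
  quadratic-2∣ : ∀ u a b → 3 * (a * a * (a * a)) + 4 * b ≡ u * u → 2 ∣ a
  quadratic-2∣ u a b eq = ∣n∣m%n⇒∣m {n = 4} (divides 2 refl) (m%n≡0⇒n∣m (a % 4) 2
    (table (m%n<n u 4) (m%n<n a 4)
      (trans (sym (%-≡ (square-≡ₙ u))) (trans (cong (_% 4) (sym eq))
        (trans (%-remove-+ʳ (3 * (a * a * (a * a))) (m∣m*n b))
               (%-≡ (*-≡ₙ {3} {3} [ refl ]ₙ (fourth-≡ₙ a))))))))
    where
    open Residue 4
    table : ∀ {x} → x < 4 → ∀ {y} → y < 4 →
            (x * x) % 4 ≡ (3 * (y * y * (y * y))) % 4 → y % 2 ≡ 0
    table = from-yes (allUpTo? (λ x → allUpTo? (λ y →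
      ((x * x) % 4 ≟ (3 * (y * y * (y * y))) % 4) →-dec (y % 2 ≟ 0)) 4) 4)

  -- Coprime factors of squares and fourth powers

  prime-2 : Prime 2
  prime-2 = from-yes (prime? 2)

  prime-3 : Prime 3
  prime-3 = from-yes (prime? 3)

  square-injective : ∀ {m n} → m * m ≡ n * n → m ≡ n
  square-injective {m} {n} eq with <-cmp m n
  ... | tri< m<n _ _ = ⊥-elim (<⇒≢ (*-mono-< m<n m<n) eq)
  ... | tri≈ _ m≡n _ = m≡n
  ... | tri> _ _ n<m = ⊥-elim (<⇒≢ (*-mono-< n<m n<m) (sym eq))

  coprime-* : ∀ {a b c} → Coprime a b → Coprime a c → Coprime a (b * c)
  coprime-* {a} {b} ab ac {d} (d∣a , d∣bc) =
    ac (d∣a , coprime-divisor (λ (e∣d , e∣b) → ab (∣-trans e∣d d∣a , e∣b)) d∣bc)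

  coprime-∣ : ∀ {a b c d} → c ∣ a → d ∣ b → Coprime a b → Coprime c d
  coprime-∣ c∣a d∣b ab (e∣c , e∣d) = ab (∣-trans e∣c c∣a , ∣-trans e∣d d∣b)

  coprime-squareˡ : ∀ {a b} → Coprime a b → Coprime (a * a) b
  coprime-squareˡ ab = Coprimality.sym (coprime-* (Coprimality.sym ab) (Coprimality.sym ab))

  -- The root is g = gcd a y. Since g y = gcd (y a) (y y) = gcd (a y) (a b) = a gcd y b, one gets g²
  -- = gcd (g a) (g y) = a gcd g (gcd y b), and the last gcd divides both a and b, hence is 1.
  coprime⇒square : ∀ {a b y} → Coprime a b → a * b ≡ y * y → ∃ λ s → a ≡ s * s
  coprime⇒square {a} {b} {y} ab ab≡y² = g , (begin
    a                                       ≡⟨ sym (*-identityʳ a) ⟩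
    a * 1                                   ≡⟨ cong (a *_) (sym gcd≡1) ⟩
    a * gcd g (gcd y b)                     ≡⟨ c*gcd[m,n]≡gcd[cm,cn] a g (gcd y b) ⟩
    gcd (a * g) (a * gcd y b)               ≡⟨ cong₂ gcd (*-comm a g) agyb ⟩
    gcd (g * a) (g * y)                     ≡⟨ sym (c*gcd[m,n]≡gcd[cm,cn] g a y) ⟩
    g * g                                   ∎)
    where
    open ≡-Reasoning
    g : ℕ
    g = gcd a y
    gcd≡1 : gcd g (gcd y b) ≡ 1
    gcd≡1 = ab (∣-trans (gcd[m,n]∣m g (gcd y b)) (gcd[m,n]∣m a y)
              , ∣-trans (gcd[m,n]∣n g (gcd y b)) (gcd[m,n]∣n y b))
    agyb : a * gcd y b ≡ g * y
    agyb = begin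
      a * gcd y b          ≡⟨ c*gcd[m,n]≡gcd[cm,cn] a y b ⟩
      gcd (a * y) (a * b)  ≡⟨ cong₂ gcd (*-comm a y) ab≡y² ⟩
      gcd (y * a) (y * y)  ≡⟨ sym (c*gcd[m,n]≡gcd[cm,cn] y a y) ⟩
      y * g                ≡⟨ *-comm y g ⟩
      g * y                ∎

  coprime⇒squares : ∀ {a b} y → Coprime a b → a * b ≡ y * y →
                    ∃₂ λ s t → a ≡ s * s × b ≡ t * t × s * t ≡ y
  coprime⇒squares {a} {b} y ab eq
    with s , refl ← coprime⇒square {y = y} ab eq
       | t , refl ← coprime⇒square {y = y} (Coprimality.sym ab) (trans (*-comm b a) eq) =
    s , t , refl , refl , square-injective (trans (lemma s t) eq)
    where
    lemma : ∀ s t → s * t * (s * t) ≡ s * s * (t * t)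
    lemma = solve-∀

  coprime-of-squares : ∀ s t → Coprime (s * s) (t * t) → Coprime s t
  coprime-of-squares s t = coprime-∣ (m∣m*n s) (m∣m*n t)

  coprime⇒fourths : ∀ {a b} y → Coprime a b → a * b ≡ y * y * (y * y) →
                    ∃₂ λ s t → a ≡ s * s * (s * s) × b ≡ t * t * (t * t) × s * t ≡ y
  coprime⇒fourths {a} {b} y ab eq = conclude (coprime⇒squares {a} {b} (y * y) ab eq)
    where
    Fourths : Set
    Fourths = ∃₂ λ s t → a ≡ s * s * (s * s) × b ≡ t * t * (t * t) × s * t ≡ y
    conclude : (∃₂ λ s t → a ≡ s * s × b ≡ t * t × s * t ≡ y * y) → Fourths
    conclude (s , t , a≡ , b≡ , st) =
      roots (coprime⇒squares {s} {t} y (coprime-of-squares s t (subst₂ Coprime a≡ b≡ ab)) st)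
      where
      roots : (∃₂ λ p q → s ≡ p * p × t ≡ q * q × p * q ≡ y) → Fourths
      roots (p , q , s≡ , t≡ , pq) =
        p , q , trans a≡ (cong₂ _*_ s≡ s≡) , trans b≡ (cong₂ _*_ t≡ t≡) , pq

  coprime-of-fourths : ∀ s t → Coprime (s * s * (s * s)) (t * t * (t * t)) → Coprime s t
  coprime-of-fourths s t st = coprime-of-squares s t (coprime-of-squares (s * s) (t * t) st)

  square-divides-3 : ∀ d → d * d ∣ 3 → d ≡ 1
  square-divides-3 0 (divides q eq) = ⊥-elim (1+n≢0 (trans eq (*-zeroʳ q)))
  square-divides-3 1 _ = refl
  square-divides-3 (suc (suc d)) d²∣3 =
    ⊥-elim (<⇒≱ (s≤s (s≤s (s≤s (s≤s z≤n)))) (≤-trans (*-mono-≤ {2} {2 + d} {2} (s≤s (s≤s z≤n)) (s≤s (s≤s z≤n))) (∣⇒≤ d²∣3)))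

  -- A common divisor d of the two factors satisfies d² ∣ 3 m.
  coprime-factors-of-3* : ∀ {a b c m} → a * b ≡ 3 * m → (∀ {d} → d ∣ a → d ∣ b → d ∣ c) →
                          Coprime c m → Coprime a b
  coprime-factors-of-3* {a} {b} {c} {m} ab≡3m common cm {d} (d∣a , d∣b) =
    square-divides-3 d (coprime-divisor (coprime-squareˡ (coprime-∣ (common d∣a d∣b) ∣-refl cm))
      (subst (d * d ∣_) (trans ab≡3m (*-comm 3 m)) (*-pres-∣ d∣a d∣b)))

  ¬2∣coprime : ∀ {a b} → Coprime a b → 2 ∣ a → 2 ∣ b → ⊥
  ¬2∣coprime ab 2∣a 2∣b with () ← ab (2∣a , 2∣b)

  ¬3∣coprime : ∀ {a b} → Coprime a b → 3 ∣ a → 3 ∣ b → ⊥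
  ¬3∣coprime ab 3∣a 3∣b with () ← ab (3∣a , 3∣b)

  -- Infinite descent for u⁴ = 3e⁴ + v²

  even-or-odd : ∀ n → (∃ λ k → n ≡ 2 * k) ⊎ (∃ λ k → n ≡ 1 + 2 * k)
  even-or-odd zero = inj₁ (0 , refl)
  even-or-odd (suc n) with even-or-odd n
  ... | inj₁ (k , refl) = inj₂ (k , refl)
  ... | inj₂ (k , refl) = inj₁ (suc k , lemma k)
    where
    lemma : ∀ k → 2 + 2 * k ≡ 2 * suc k
    lemma = solve-∀

  2∣square⇒2∣ : ∀ a → 2 ∣ a * a → 2 ∣ a
  2∣square⇒2∣ a 2∣a² with euclidsLemma a a prime-2 2∣a²
  ... | inj₁ 2∣a = 2∣a
  ... | inj₂ 2∣a = 2∣a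

  positive-factors : ∀ {m n k} → 0 < k → m * n ≡ k → 0 < m × 0 < n
  positive-factors {zero} {n} 0<k refl = ⊥-elim (n≮0 0<k)
  positive-factors {suc m} {zero} 0<k eq = ⊥-elim (<⇒≢ 0<k (trans (sym (*-zeroʳ m)) eq))
  positive-factors {suc m} {suc n} _ _ = z<s , z<s

  factor≤ : ∀ {m n k} → 0 < k → m * n ≡ k → m ≤ k
  factor≤ {m} {n} 0<k eq =
    subst (m ≤_) eq (m≤m*n m n {{>-nonZero (proj₂ (positive-factors {m} {n} 0<k eq))}})

  -- The factors `p` and `p + y` are (x - y)/2 and (x + y)/2, integral because both numbers are odd;
  -- written this way they involve no subtraction.
  difference-of-odd-squares : ∀ x y k → 2 ∤ x → 2 ∤ y → x * x ≡ y * y + 4 * k →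
                              ∃ λ p → x ≡ y + 2 * p × p * (p + y) ≡ k
  difference-of-odd-squares x y k x-odd y-odd eq with even-or-odd x | even-or-odd y
  ... | inj₁ (i , refl) | _ = contradiction (m∣m*n i) x-odd
  ... | _ | inj₁ (j , refl) = contradiction (m∣m*n j) y-odd
  ... | inj₂ (i , refl) | inj₂ (j , refl) with j ≤? i
  ...   | no j≰i = contradiction
            (≤-<-trans (m≤m+n (y * y) (4 * k)) (subst (_< y * y) eq (*-mono-< x<y x<y)))
            (<-irrefl refl)
    where
    x<y : x < y
    x<y = s≤s (*-monoʳ-< 2 (≰⇒> j≰i))
  ...   | yes j≤i with p , refl ← m≤n⇒∃[o]m+o≡n j≤i =
    p , lemma₁ j p , *-cancelˡ-≡ _ _ 4 (+-cancelˡ-≡ (y * y) _ _ (trans (lemma₂ j p) eq))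
    where
    lemma₁ : ∀ j p → 1 + 2 * (j + p) ≡ 1 + 2 * j + 2 * p
    lemma₁ = solve-∀
    lemma₂ : ∀ j p → (1 + 2 * j) * (1 + 2 * j) + 4 * (p * (p + (1 + 2 * j)))
                   ≡ (1 + 2 * (j + p)) * (1 + 2 * (j + p))
    lemma₂ = solve-∀

  -- `positive` excludes the trivial solution u = v = 1, e = 0. The descent runs on `e`.
  record Quartic (u e v : ℕ) : Set where
    constructor quartic
    field
      coprime  : Coprime u e
      positive : 0 < e
      equation : u * u * (u * u) ≡ 3 * (e * e * (e * e)) + v * v

  -- The bound may be weak because `y` will be half of the old `e`; strictness is gained from that
  -- factor 2.
  SmallerQuartic : ℕ → Set
  SmallerQuartic y = ∃ λ c → c ≤ y × (∃₂ λ d b → Quartic d c b)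

  k*[m*n]≡m*k*n : ∀ k m n → k * (m * n) ≡ m * k * n
  k*[m*n]≡m*k*n = solve-∀

  k*[m*n]≡m*[n*k] : ∀ k m n → k * (m * n) ≡ m * (n * k)
  k*[m*n]≡m*[n*k] = solve-∀

  regroup : ∀ x y → 3 * (4 * x) + y ≡ y + 4 * (3 * x)
  regroup = solve-∀

  12y⁴ : ∀ y → 12 * (y * y * (y * y)) ≡ 3 * (2 * (y * y) * (2 * (y * y)))
  12y⁴ = solve-∀

  -- Second half of the descent, for 12a⁴ + b⁴ = u². With u = b² + 2p the equation becomes p (p +
  -- b²) = 3a⁴ with coprime factors. If the 3 lies in p, then p = 3c⁴ and p + b² = d⁴, which is
  -- again the quartic.
  descend₂ : ∀ {a b u} → 0 < a → 2 ∤ u → 2 ∤ b →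
             Coprime (3 * (4 * (a * a * (a * a)))) (b * b * (b * b)) →
             3 * (4 * (a * a * (a * a))) + b * b * (b * b) ≡ u * u → SmallerQuartic a
  descend₂ {a} {b} {u} 0<a u-odd b-odd cop eq
    with p , refl , pq ← difference-of-odd-squares u (b * b) (3 * (a * a * (a * a))) u-odd
                           (λ 2∣b² → b-odd (2∣square⇒2∣ b 2∣b²))
                           (trans (sym eq) (regroup (a * a * (a * a)) (b * b * (b * b))))
    = split p pq (euclidsLemma p (p + b * b) prime-3 (subst (3 ∣_) (sym pq) (m∣m*n (a * a * (a * a)))))
    where
    cop-b²-a⁴ : Coprime (b * b) (a * a * (a * a))
    cop-b²-a⁴ = coprime-∣ (m∣m*n (b * b)) (∣-trans (n∣m*n 4) (n∣m*n 3)) (Coprimality.sym cop)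
    split : ∀ p → p * (p + b * b) ≡ 3 * (a * a * (a * a)) → 3 ∣ p ⊎ 3 ∣ p + b * b →
            SmallerQuartic a
    split p pq 3∣ = cases 3∣
      where
      cop-pq : Coprime p (p + b * b)
      cop-pq = coprime-factors-of-3* pq (λ d∣p d∣q → ∣m+n∣m⇒∣n d∣q d∣p) cop-b²-a⁴
      cases : 3 ∣ p ⊎ 3 ∣ p + b * b → SmallerQuartic a
      cases (inj₁ (divides p′ p≡)) = conclude (coprime⇒fourths {p′} {p + b * b} a cop-p′q
          (*-cancelˡ-≡ (p′ * (p + b * b)) (a * a * (a * a)) 3 (trans (k*[m*n]≡m*k*n 3 p′ (p + b * b))
            (trans (cong (_* (p + b * b)) (sym p≡)) pq))))
        where
        p≡3p′ : p ≡ 3 * p′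
        p≡3p′ = trans p≡ (*-comm p′ 3)
        cop-p′q : Coprime p′ (p + b * b)
        cop-p′q = coprime-∣ (divides 3 p≡3p′) ∣-refl cop-pq
        conclude : (∃₂ λ c d → p′ ≡ c * c * (c * c) × p + b * b ≡ d * d * (d * d) × c * d ≡ a) →
                   SmallerQuartic a
        conclude (c , d , p′≡ , q≡ , cd) = c , factor≤ {c} {d} 0<a cd , d , b , quartic
            (Coprimality.sym (coprime-of-fourths c d (subst₂ Coprime p′≡ q≡ cop-p′q)))
            (proj₁ (positive-factors {c} {d} 0<a cd))
            (trans (sym q≡) (cong (_+ b * b) (trans p≡3p′ (cong (3 *_) p′≡))))
      cases (inj₂ (divides q′ q≡)) = conclude (coprime⇒fourths {p} {q′} a
          (coprime-∣ ∣-refl (divides 3 q≡3q′) cop-pq)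
          (*-cancelˡ-≡ (p * q′) (a * a * (a * a)) 3 (trans (k*[m*n]≡m*[n*k] 3 p q′)
            (trans (cong (p *_) (sym q≡)) pq))))
        where
        q≡3q′ : p + b * b ≡ 3 * q′
        q≡3q′ = trans q≡ (*-comm q′ 3)
        conclude : (∃₂ λ c d → p ≡ c * c * (c * c) × q′ ≡ d * d * (d * d) × c * d ≡ a) →
                   SmallerQuartic a
        -- Here c⁴ + b² = p + b² is divisible by 3, so 3 divides c² and hence p, while it also
        -- divides p + b².
        conclude (c , d , p≡ , _) = ⊥-elim (¬3∣coprime cop-pq
            (subst (3 ∣_) (sym p≡) (∣m⇒∣m*n (c * c) (sum-of-squares-3∣ (c * c) b q′
              (trans (cong (_+ b * b) (sym p≡)) q≡3q′))))
            (divides q′ q≡))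

  -- First half of the descent. The 3 in 12y⁴ lies in one factor, say A = 3A′; then A′B = (2y²)²
  -- gives A′ = s², B = t² and st = 2y². If the 2 lies in s, the roots are 2a² and b², so that A + B
  -- = u² reads 12a⁴ + b⁴ = u².
  descend₁ : ∀ {A B u y} → 0 < y → 2 ∤ u → Coprime A B → A + B ≡ u * u →
             A * B ≡ 12 * (y * y * (y * y)) → SmallerQuartic y
  descend₁ {A} {B} {u} {y} 0<y u-odd cop A+B AB =
    cases (euclidsLemma A B prime-3 (subst (3 ∣_) (sym AB) (∣m⇒∣m*n (y * y * (y * y)) (divides 4 refl))))
    where
    from-3∣ : ∀ A B → Coprime A B → A + B ≡ u * u → A * B ≡ 12 * (y * y * (y * y)) → 3 ∣ A →
              SmallerQuartic y
    from-3∣ A B cop A+B AB (divides A′ A≡) = conclude (coprime⇒squares {A′} {B} (2 * (y * y)) cop-A′B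
        (*-cancelˡ-≡ (A′ * B) (2 * (y * y) * (2 * (y * y))) 3 (trans (k*[m*n]≡m*k*n 3 A′ B)
          (trans (cong (_* B) (sym A≡)) (trans AB (12y⁴ y))))))
      where
      A≡3A′ : A ≡ 3 * A′
      A≡3A′ = trans A≡ (*-comm A′ 3)
      cop-A′B : Coprime A′ B
      cop-A′B = coprime-∣ (divides 3 A≡3A′) ∣-refl cop
      lemma₁ : ∀ x → 3 * (x * 2 * (x * 2)) ≡ 3 * (4 * (x * x))
      lemma₁ = solve-∀
      lemma₂ : ∀ x y → 3 * (x * x) + y * 2 * (y * 2) ≡ 3 * (x * x) + 4 * (y * y)
      lemma₂ = solve-∀
      conclude : (∃₂ λ s t → A′ ≡ s * s × B ≡ t * t × s * t ≡ 2 * (y * y)) → SmallerQuartic y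
      conclude (s , t , A′≡ , B≡ , st) =
        from-2∣ (euclidsLemma s t prime-2 (subst (2 ∣_) (sym st) (m∣m*n (y * y))))
        where
        cop-st : Coprime s t
        cop-st = coprime-of-squares s t (subst₂ Coprime A′≡ B≡ cop-A′B)
        from-2∣ : 2 ∣ s ⊎ 2 ∣ t → SmallerQuartic y
        from-2∣ (inj₁ (divides s′ s≡)) = descend (coprime⇒squares {s′} {t} y
            (coprime-∣ (divides 2 (trans s≡ (*-comm s′ 2))) ∣-refl cop-st)
            (*-cancelˡ-≡ (s′ * t) (y * y) 2
              (trans (k*[m*n]≡m*k*n 2 s′ t) (trans (cong (_* t) (sym s≡)) st))))
          where
          descend : (∃₂ λ a b → s′ ≡ a * a × t ≡ b * b × a * b ≡ y) → SmallerQuartic y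
          descend (a , b , s′≡ , t≡ , ab) = weaken (descend₂ {a} {b} {u}
              (proj₁ (positive-factors {a} {b} 0<y ab)) u-odd
              (λ 2∣b → ¬2∣coprime cop-st (divides s′ s≡) (subst (2 ∣_) (sym t≡) (∣m⇒∣m*n b 2∣b)))
              (subst₂ Coprime A≡12a⁴ B≡b⁴ cop)
              (trans (cong₂ _+_ (sym A≡12a⁴) (sym B≡b⁴)) A+B))
            where
            s≡2a² : s ≡ a * a * 2
            s≡2a² = trans s≡ (cong (_* 2) s′≡)
            A≡12a⁴ : A ≡ 3 * (4 * (a * a * (a * a)))
            A≡12a⁴ = trans A≡3A′ (trans (cong (3 *_) (trans A′≡ (cong₂ _*_ s≡2a² s≡2a²))) (lemma₁ (a * a)))
            B≡b⁴ : B ≡ b * b * (b * b)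
            B≡b⁴ = trans B≡ (cong₂ _*_ t≡ t≡)
            weaken : SmallerQuartic a → SmallerQuartic y
            weaken (c , c≤a , rest) = c , ≤-trans c≤a (factor≤ {a} {b} 0<y ab) , rest
        from-2∣ (inj₂ (divides t′ t≡)) = refute (coprime⇒squares {s} {t′} y
            (coprime-∣ ∣-refl (divides 2 (trans t≡ (*-comm t′ 2))) cop-st)
            (*-cancelˡ-≡ (s * t′) (y * y) 2
              (trans (k*[m*n]≡m*[n*k] 2 s t′) (trans (cong (s *_) (sym t≡)) st))))
          where
          open ≡-Reasoning
          refute : (∃₂ λ a b → s ≡ a * a × t′ ≡ b * b × a * b ≡ y) → SmallerQuartic y
          -- If the 2 lies in t, then 3a⁴ + 4t′² = u² forces a, and so s, to be even as well.
          refute (a , _ , s≡ , _) = ⊥-elim (¬2∣coprime cop-st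
            (subst (2 ∣_) (sym s≡) (∣m⇒∣m*n a (quadratic-2∣ u a (t′ * t′) (begin
              3 * (a * a * (a * a)) + 4 * (t′ * t′)  ≡⟨ cong (λ z → 3 * (z * z) + 4 * (t′ * t′)) (sym s≡) ⟩
              3 * (s * s) + 4 * (t′ * t′)            ≡⟨ sym (lemma₂ s t′) ⟩
              3 * (s * s) + t′ * 2 * (t′ * 2)        ≡⟨ cong₂ _+_ (sym (trans A≡3A′ (cong (3 *_) A′≡))) (sym (trans B≡ (cong₂ _*_ t≡ t≡))) ⟩
              A + B                                  ≡⟨ A+B ⟩
              u * u                                  ∎))))
            (divides t′ t≡))
    cases : 3 ∣ A ⊎ 3 ∣ B → SmallerQuartic y
    cases (inj₁ 3∣A) = from-3∣ A B cop A+B AB 3∣A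
    cases (inj₂ 3∣B) = from-3∣ B A (Coprimality.sym cop) (trans (+-comm B A) A+B)
                         (trans (*-comm B A) AB) 3∣B

  -- With e = 2y the equation is u⁴ = v² + 48y⁴. The halves A and A + v of u² - v and u² + v have
  -- product 12y⁴ and sum u².
  descend : ∀ {u v} y → Quartic u (y * 2) v → SmallerQuartic y
  descend {u} {v} y (quartic cop 0<e eq) = factorised (difference-of-odd-squares (u * u) v
      (12 * (y * y * (y * y))) (λ 2∣u² → u-odd (2∣square⇒2∣ u 2∣u²)) v-odd
      (trans eq (lemma₁ y (v * v))))
    where
    0<y : 0 < y
    0<y = proj₁ (positive-factors {y} {2} 0<e refl)
    u-odd : 2 ∤ u
    u-odd 2∣u = ¬2∣coprime cop 2∣u (n∣m*n y)
    v-odd : 2 ∤ v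
    v-odd 2∣v = u-odd (2∣square⇒2∣ u (2∣square⇒2∣ (u * u) (subst (2 ∣_) (sym eq)
      (∣m∣n⇒∣m+n (∣n⇒∣m*n 3 (∣m⇒∣m*n (y * 2 * (y * 2)) (∣m⇒∣m*n (y * 2) (n∣m*n y)))) (∣m⇒∣m*n v 2∣v)))))
    lemma₁ : ∀ y v → 3 * (y * 2 * (y * 2) * (y * 2 * (y * 2))) + v ≡ v + 4 * (12 * (y * y * (y * y)))
    lemma₁ = solve-∀
    -- The factor 12y⁴ / 3 is written as a product of divisors of e, which makes its coprimality to
    -- u² visible.
    lemma₂ : ∀ y → 12 * (y * y * (y * y)) ≡ 3 * (y * 2 * (y * 2) * (y * y))
    lemma₂ = solve-∀
    lemma₃ : ∀ a v → a + (a + v) ≡ v + 2 * a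
    lemma₃ = solve-∀
    cop-e : Coprime (u * u) (y * 2 * (y * 2) * (y * y))
    cop-e = coprime-squareˡ (coprime-* (coprime-* cop cop) (coprime-* cop-y cop-y))
      where
      cop-y : Coprime u y
      cop-y = coprime-∣ ∣-refl (m∣m*n 2) cop
    factorised : (∃ λ A → u * u ≡ v + 2 * A × A * (A + v) ≡ 12 * (y * y * (y * y))) → SmallerQuartic y
    factorised (A , u²≡ , AB) = descend₁ {A} {A + v} {u} {y} 0<y u-odd
      (coprime-factors-of-3* (trans AB (lemma₂ y))
        (λ {d} d∣A d∣B → subst (d ∣_) A+B (∣m∣n⇒∣m+n d∣A d∣B)) cop-e)
      A+B AB
      where
      A+B : A + (A + v) ≡ u * u
      A+B = trans (lemma₃ A v) (sym u²≡)

  descent : ∀ {u e v} → Quartic u e v → ∃ λ c → c < e × (∃₂ λ d b → Quartic d c b)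
  descent {u} {e} {v} q = halve (quartic-2∣ u e v (Quartic.equation q))
    where
    halve : 2 ∣ e → ∃ λ c → c < e × (∃₂ λ d b → Quartic d c b)
    halve (divides y refl) = weaken (descend y q)
      where
      0<y : 0 < y
      0<y = proj₁ (positive-factors {y} {2} (Quartic.positive q) refl)
      weaken : SmallerQuartic y → ∃ λ c → c < y * 2 × (∃₂ λ d b → Quartic d c b)
      weaken (c , c≤y , rest) = c , ≤-<-trans c≤y (m<m*n y 2 {{>-nonZero 0<y}} (s≤s (s≤s z≤n))) , rest

  no-quartic : ∀ {u e v} → ¬ Quartic u e v
  no-quartic {e = e} = go (<-wellFounded e)
    where
    go : ∀ {u e v} → Acc _<_ e → ¬ Quartic u e v
    go (acc rec) q = let c , c<e , d , b , q′ = descent q in go (rec c<e) q′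

  -- From a rational root to the quartic

  square-quotient : ∀ x n y → 0 < n → x * (n * n) ≡ y * y → ∃ λ z → x ≡ z * z
  square-quotient x n y 0<n eq = y′ , (begin
    x              ≡⟨ sym (*-identityʳ x) ⟩
    x * (1 * 1)    ≡⟨ cong (λ k → x * (k * k)) (sym n′≡1) ⟩
    x * (n′ * n′)  ≡⟨ eq′ ⟩
    y′ * y′        ∎)
    where
    open ≡-Reasoning
    g : ℕ
    g = gcd n y
    g∣n : g ∣ n
    g∣n = gcd[m,n]∣m n y
    instance
      g≢0 : NonZero g
      g≢0 = ≢-nonZero (λ g≡0 → <⇒≢ 0<n (sym (0∣⇒≡0 (subst (_∣ n) g≡0 g∣n))))
      g²≢0 : NonZero (g * g)
      g²≢0 = m*n≢0 g g
    n′ y′ : ℕ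
    n′ = n / g
    y′ = y / g
    n≡ : g * n′ ≡ n
    n≡ = m*[n/m]≡n g∣n
    y≡ : g * y′ ≡ y
    y≡ = m*[n/m]≡n (gcd[m,n]∣n n y)
    lemma₁ : ∀ g x n → g * g * (x * (n * n)) ≡ x * (g * n * (g * n))
    lemma₁ = solve-∀
    lemma₂ : ∀ g y → g * y * (g * y) ≡ g * g * (y * y)
    lemma₂ = solve-∀
    eq′ : x * (n′ * n′) ≡ y′ * y′
    eq′ = *-cancelˡ-≡ (x * (n′ * n′)) (y′ * y′) (g * g) (begin
      g * g * (x * (n′ * n′))   ≡⟨ lemma₁ g x n′ ⟩
      x * (g * n′ * (g * n′))   ≡⟨ cong (λ k → x * (k * k)) n≡ ⟩
      x * (n * n)               ≡⟨ eq ⟩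
      y * y                     ≡⟨ cong (λ k → k * k) (sym y≡) ⟩
      g * y′ * (g * y′)         ≡⟨ lemma₂ g y′ ⟩
      g * g * (y′ * y′)         ∎)
    coprime : Coprime n′ y′
    coprime = coprime-/gcd n y
    -- A fraction with integral square is integral: the reduced denominator `n′` divides `y′ * y′`,
    -- hence `y′`, hence is 1.
    n′≡1 : n′ ≡ 1
    n′≡1 = coprime (∣-refl , coprime-divisor coprime
      (subst (n′ ∣_) eq′ (∣n⇒∣m*n x (m∣m*n n′))))

  divides-3 : ∀ d → d ∣ 3 → d ≡ 1 ⊎ d ≡ 3
  divides-3 0 0∣3 with () ← 0∣⇒≡0 0∣3
  divides-3 1 _ = inj₁ refl
  divides-3 2 2∣3 = contradiction 2∣3 (from-no (2 ∣? 3))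
  divides-3 3 _ = inj₂ refl
  divides-3 (suc (suc (suc (suc d)))) d∣3 = ⊥-elim (<⇒≱ (s≤s (s≤s (s≤s (s≤s z≤n)))) (∣⇒≤ d∣3))

  -- Here `w` will be |p² - 3q²|; the two sign cases are the two lemmas at the end of the module.
  module _ {p q w z : ℕ} (coprime : Coprime p q) (0<q : 0 < q) (pqw : p * q * w ≡ z * z) where

    private
      q∣p²⇒1 : ∀ {d} → d ∣ q → d ∣ p * p → d ≡ 1
      q∣p²⇒1 d∣q d∣p² = coprime-* (Coprimality.sym coprime) (Coprimality.sym coprime) (d∣q , d∣p²)

      q-and-pw : Coprime q w → ∃₂ λ e s → q ≡ e * e × p * w ≡ s * s × e * s ≡ z
      q-and-pw q⊥w = coprime⇒squares {q} {p * w} z (coprime-* (Coprimality.sym coprime) q⊥w)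
        (trans (lemma p q w) pqw)
        where
        lemma : ∀ p q w → q * (p * w) ≡ p * q * w
        lemma = solve-∀

      -- A common divisor of p and |p² - 3q²| divides 3q², and it is coprime to q, so only 1 and 3
      -- remain.
      p⊥w : 3 ∤ p → (∀ {d} → d ∣ p → d ∣ w → d ∣ q * q * 3) → Coprime p w
      p⊥w 3∤p common {d} (d∣p , d∣w) with divides-3 d (coprime-divisor
        (coprime-∣ d∣p ∣-refl (coprime-* coprime coprime)) (common d∣p d∣w))
      ... | inj₁ d≡1 = d≡1
      ... | inj₂ refl = contradiction d∣p 3∤p

      quotient-square : ∀ {p′ w′ s} → p ≡ 3 * p′ → w ≡ 3 * w′ → p * w ≡ s * s →
                        ∃ λ t → p′ * w′ ≡ t * t
      quotient-square {p′} {w′} {s} refl refl eq =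
        square-quotient (p′ * w′) 3 s z<s (trans (lemma p′ w′) eq)
        where
        lemma : ∀ p w → p * w * (3 * 3) ≡ 3 * p * (3 * w)
        lemma = solve-∀

      3∣w : 3 ∣ p → (3 ∣ p * p → 3 ∣ w) → (∃ λ p′ → p ≡ 3 * p′) × (∃ λ w′ → w ≡ 3 * w′)
      3∣w (divides p′ p≡) f with f (∣m⇒∣m*n p (divides p′ p≡))
      ... | divides w′ w≡ = (p′ , trans p≡ (*-comm p′ 3)) , (w′ , trans w≡ (*-comm w′ 3))

      cancel-3 : ∀ {a b} → 3 * a ≡ 3 * b → a ≡ b
      cancel-3 {a} {b} = *-cancelˡ-≡ a b 3

    -- q is coprime to w, so q = e² and p w is a square. If 3 ∤ p, then p = u² and w = v², and the
    -- hypothesis is the quartic. If p = 3p′ and w = 3w′, then w′ = v² and q² + v² = 3p′², so 3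
    -- divides q too.
    no-square-above : p * p ≡ 3 * (q * q) + w → ⊥
    no-square-above p²≡ = with-q (q-and-pw q⊥w)
      where
      q⊥w : Coprime q w
      q⊥w {d} (d∣q , d∣w) = q∣p²⇒1 d∣q (subst (d ∣_) (sym p²≡)
        (∣m∣n⇒∣m+n (∣n⇒∣m*n 3 (∣m⇒∣m*n q d∣q)) d∣w))
      with-q : (∃₂ λ e s → q ≡ e * e × p * w ≡ s * s × e * s ≡ z) → ⊥
      with-q (e , s , q≡ , pw≡ , _) with 3 ∣? p
      ... | no 3∤p = conclude (coprime⇒squares {p} {w} s (p⊥w 3∤p common) pw≡)
        where
        common : ∀ {d} → d ∣ p → d ∣ w → d ∣ q * q * 3
        common {d} d∣p d∣w = subst (d ∣_) (*-comm 3 (q * q)) (∣m+n∣m⇒∣n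
          (subst (d ∣_) (trans p²≡ (+-comm (3 * (q * q)) w)) (∣m⇒∣m*n p d∣p)) d∣w)
        conclude : (∃₂ λ u v → p ≡ u * u × w ≡ v * v × u * v ≡ s) → ⊥
        conclude (u , v , p≡ , w≡ , _) = no-quartic {u} {e} {v} (quartic
          (coprime-of-squares u e (subst₂ Coprime p≡ q≡ coprime))
          (proj₁ (positive-factors {e} {e} 0<q (sym q≡)))
          (trans (sym (cong₂ _*_ p≡ p≡)) (trans p²≡
            (cong₂ _+_ (cong (3 *_) (cong₂ _*_ q≡ q≡)) w≡))))
      ... | yes 3∣p = conclude (3∣w 3∣p (λ 3∣p² → ∣m+n∣m⇒∣n (subst (3 ∣_) p²≡ 3∣p²) (m∣m*n (q * q))))
        where
        conclude : (∃ λ p′ → p ≡ 3 * p′) × (∃ λ w′ → w ≡ 3 * w′) → ⊥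
        conclude ((p′ , p≡) , (w′ , w≡)) = refute (quotient-square {p′} {w′} {s} p≡ w≡ pw≡)
          where
          lemma : ∀ p → 3 * (3 * (p * p)) ≡ 3 * p * (3 * p)
          lemma = solve-∀
          3p′²≡ : q * q + w′ ≡ 3 * (p′ * p′)
          3p′²≡ = cancel-3 (trans (*-distribˡ-+ 3 (q * q) w′) (trans (cong (λ k → 3 * (q * q) + k) (sym w≡))
            (trans (sym p²≡) (trans (cong₂ _*_ p≡ p≡) (sym (lemma p′))))))
          p′⊥w′ : Coprime p′ w′
          p′⊥w′ {d} (d∣p′ , d∣w′) = coprime-* coprime coprime
            ( subst (d ∣_) (sym p≡) (∣n⇒∣m*n 3 d∣p′)
            , ∣m+n∣m⇒∣n (subst (d ∣_) (trans (sym 3p′²≡) (+-comm (q * q) w′))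
                (∣n⇒∣m*n 3 (∣m⇒∣m*n p′ d∣p′))) d∣w′ )
          refute : (∃ λ t → p′ * w′ ≡ t * t) → ⊥
          refute (t , eq) = finish (coprime⇒squares {p′} {w′} t p′⊥w′ eq)
            where
            finish : (∃₂ λ u v → p′ ≡ u * u × w′ ≡ v * v × u * v ≡ t) → ⊥
            finish (u , v , _ , w′≡ , _) = ¬3∣coprime coprime 3∣p
              (sum-of-squares-3∣ q v (p′ * p′) (trans (cong (λ k → q * q + k) (sym w′≡)) 3p′²≡))

    -- The roles of the cases are exchanged. If 3 ∤ p, then p² + v² = 3q² is impossible modulo 3. If
    -- p = 3p′ and w = 3w′, then q² = 3p′² + w′ with q = e², p′ = u², w′ = v² is the quartic for (e,
    -- u, v), and 0 < p supplies its positivity.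
    no-square-below : 0 < p → p * p + w ≡ 3 * (q * q) → ⊥
    no-square-below 0<p p²≡ = with-q (q-and-pw q⊥w)
      where
      q⊥w : Coprime q w
      q⊥w {d} (d∣q , d∣w) = q∣p²⇒1 d∣q (∣m+n∣m⇒∣n (subst (d ∣_)
        (trans (sym p²≡) (+-comm (p * p) w)) (∣n⇒∣m*n 3 (∣m⇒∣m*n q d∣q))) d∣w)
      with-q : (∃₂ λ e s → q ≡ e * e × p * w ≡ s * s × e * s ≡ z) → ⊥
      with-q (e , s , q≡ , pw≡ , _) with 3 ∣? p
      ... | no 3∤p = conclude (coprime⇒squares {p} {w} s (p⊥w 3∤p common) pw≡)
        where
        common : ∀ {d} → d ∣ p → d ∣ w → d ∣ q * q * 3
        common {d} d∣p d∣w = subst (d ∣_) (trans p²≡ (*-comm 3 (q * q)))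
          (∣m∣n⇒∣m+n (∣m⇒∣m*n p d∣p) d∣w)
        conclude : (∃₂ λ u v → p ≡ u * u × w ≡ v * v × u * v ≡ s) → ⊥
        conclude (u , v , p≡ , w≡ , _) = 3∤p (sum-of-squares-3∣ p v (q * q)
          (trans (cong (λ k → p * p + k) (sym w≡)) p²≡))
      ... | yes 3∣p = conclude (3∣w 3∣p (λ 3∣p² →
                        ∣m+n∣m⇒∣n (subst (3 ∣_) (sym p²≡) (m∣m*n (q * q))) 3∣p²))
        where
        conclude : (∃ λ p′ → p ≡ 3 * p′) × (∃ λ w′ → w ≡ 3 * w′) → ⊥
        conclude ((p′ , p≡) , (w′ , w≡)) = refute (quotient-square {p′} {w′} {s} p≡ w≡ pw≡)
          where
          lemma : ∀ p w → 3 * (3 * (p * p) + w) ≡ 3 * p * (3 * p) + 3 * w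
          lemma = solve-∀
          q²≡ : q * q ≡ 3 * (p′ * p′) + w′
          q²≡ = cancel-3 (trans (sym p²≡) (trans (cong₂ _+_ (cong₂ _*_ p≡ p≡) w≡) (sym (lemma p′ w′))))
          p′⊥q : Coprime p′ q
          p′⊥q = coprime-∣ (divides 3 p≡) ∣-refl coprime
          p′⊥w′ : Coprime p′ w′
          p′⊥w′ {d} (d∣p′ , d∣w′) = coprime-* p′⊥q p′⊥q (d∣p′ , subst (d ∣_) (sym q²≡)
            (∣m∣n⇒∣m+n (∣n⇒∣m*n 3 (∣m⇒∣m*n p′ d∣p′)) d∣w′))
          refute : (∃ λ t → p′ * w′ ≡ t * t) → ⊥
          refute (t , eq) = finish (coprime⇒squares {p′} {w′} t p′⊥w′ eq)
            where
            finish : (∃₂ λ u v → p′ ≡ u * u × w′ ≡ v * v × u * v ≡ t) → ⊥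
            finish (u , v , p′≡ , w′≡ , _) = no-quartic {e} {u} {v} (quartic
              (coprime-of-squares e u (subst₂ Coprime q≡ p′≡ (Coprimality.sym p′⊥q)))
              (proj₁ (positive-factors {u} {u} (proj₂ (positive-factors {3} {p′} 0<p (sym p≡))) (sym p′≡)))
              (trans (sym (cong₂ _*_ q≡ q≡)) (trans q²≡
                (cong₂ _+_ (cong (3 *_) (cong₂ _*_ p′≡ p′≡)) w′≡))))

  module _ {p q m n : ℕ} (coprime : Coprime p q) (0<q : 0 < q) (0<m : 0 < m) (0<n : 0 < n) where

    private
      0<x : 0 < m * (q * q) * (m * (q * q))
      0<x = *-mono-< 0<mq² 0<mq²
        where
        0<mq² : 0 < m * (q * q)
        0<mq² = *-mono-< 0<m (*-mono-< 0<q 0<q)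

    -- The equation is x³ = r² + 3x at x = p/q and r = m/n, multiplied by n²q⁴. It says p q (p² -
    -- 3q²) n² = (m q²)², and `square-quotient` removes the n².
    no-point-above : p * p * p * (n * n * q) ≡ m * (q * q) * (m * (q * q)) + 3 * (q * q) * (p * (n * n * q)) → ⊥
    no-point-above eq with 3 * (q * q) ≤? p * p
    -- The left side is then at most the linear term, while the right side exceeds it by (m q²)² >
    -- 0. This covers p = 0.
    ... | no p²<3q² = <⇒≱ (+-monoˡ-≤ (3 * (q * q) * (p * (n * n * q))) 0<x) (subst (_≤ 3 * (q * q) * (p * (n * n * q))) eq
            (subst (_≤ 3 * (q * q) * (p * (n * n * q))) (sym (*-assoc (p * p) p (n * n * q)))
              (*-monoˡ-≤ (p * (n * n * q)) (<⇒≤ (≰⇒> p²<3q²)))))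
    ... | yes 3q²≤p² = conclude (m≤n⇒∃[o]m+o≡n 3q²≤p²)
      where
      conclude : (∃ λ w → 3 * (q * q) + w ≡ p * p) → ⊥
      conclude (w , p²≡) = no-square-above {z = proj₁ square} coprime 0<q (proj₂ square) (sym p²≡)
        where
        lemma : ∀ p q w n t → p * q * w * (n * n) + t * (p * (n * n * q)) ≡ (t + w) * p * (n * n * q)
        lemma = solve-∀
        square : ∃ λ z → p * q * w ≡ z * z
        square = square-quotient (p * q * w) n (m * (q * q)) 0<n
          (+-cancelʳ-≡ (3 * (q * q) * (p * (n * n * q))) _ _
            (trans (lemma p q w n (3 * (q * q))) (trans (cong (λ t → t * p * (n * n * q)) p²≡) eq)))

    -- The same equation at x = -p/q, with the negative terms moved across.
    no-point-below : 0 < p → p * p * p * (n * n * q) + m * (q * q) * (m * (q * q)) ≡ 3 * (q * q) * (p * (n * n * q)) → ⊥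
    no-point-below 0<p eq with p * p ≤? 3 * (q * q)
    ... | no 3q²<p² = <⇒≱ (+-mono-≤-< (subst (3 * (q * q) * (p * (n * n * q)) ≤_) (sym (*-assoc (p * p) p (n * n * q)))
              (*-monoˡ-≤ (p * (n * n * q)) (<⇒≤ (≰⇒> 3q²<p²)))) 0<x)
            (≤-reflexive (trans eq (sym (+-identityʳ _))))
    ... | yes p²≤3q² = conclude (m≤n⇒∃[o]m+o≡n p²≤3q²)
      where
      conclude : (∃ λ w → p * p + w ≡ 3 * (q * q)) → ⊥
      conclude (w , 3q²≡) = no-square-below {z = proj₁ square} coprime 0<q (proj₂ square) 0<p 3q²≡
        where
        lemma : ∀ p q w n t → t * p * (n * n * q) + p * q * w * (n * n) ≡ (t + w) * (p * (n * n * q))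
        lemma = solve-∀
        square : ∃ λ z → p * q * w ≡ z * z
        square = square-quotient (p * q * w) n (m * (q * q)) 0<n
          (+-cancelˡ-≡ (p * p * p * (n * n * q)) _ _
            (trans (lemma p q w n (p * p)) (trans (cong (_* (p * (n * n * q))) 3q²≡) (sym eq))))

-- The equation x³ = r² + 3x over the rationals

module RationalPoints where

  open Descent using (no-point-above; no-point-below)
  open import Data.Empty using (⊥)
  open import Data.Nat.Base as ℕ using (ℕ; suc; z<s)
  import Data.Nat.Properties as ℕ
  open import Data.Nat.Coprimality as Coprimality using (Coprime)
  open import Data.Integer.Base as ℤ using (ℤ; +_; -[1+_])
  import Data.Integer.Properties as ℤ
  import Data.Integer.Solver as ℤ
  open import Data.Rational.Base as ℚ using (ℚ; 0ℚ; mkℚ)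
  import Data.Rational.Properties as ℚ
  import Data.Rational.Unnormalised.Base as ℚᵘ
  import Data.Rational.Unnormalised.Properties as ℚᵘ
  open import Relation.Binary.PropositionalEquality

  pos-square : ∀ i → i ℤ.* i ≡ + (ℤ.∣ i ∣ ℕ.* ℤ.∣ i ∣)
  pos-square (+ n) = sym (ℤ.pos-* n n)
  pos-square -[1+ n ] = refl

  -- In unnormalised fractions the equation is literally a cross-multiplication. The products there
  -- carry the denominator 1 of the coefficient 3, which is why `*-identityˡ` appears.
  cleared : ∀ (x r : ℚ) → x ℚ.* x ℚ.* x ≡ r ℚ.* r ℚ.+ (+ 3 ℚ./ 1) ℚ.* x →
            let P = ℚ.↥ x ; Q = ℚ.↧ x ; M = ℚ.↥ r ; N = ℚ.↧ r in
            P ℤ.* P ℤ.* P ℤ.* (N ℤ.* N ℤ.* Q) ≡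
            M ℤ.* M ℤ.* (Q ℤ.* Q ℤ.* (Q ℤ.* Q)) ℤ.+ + 3 ℤ.* (Q ℤ.* Q) ℤ.* (P ℤ.* (N ℤ.* N ℤ.* Q))
  cleared x@(mkℚ P q _) r@(mkℚ M n _) eq = trans
    (cong (λ t → P ℤ.* P ℤ.* P ℤ.* t) (trans (cong (ℤ._* Q) (sym (ℤ.pos-* (suc n) (suc n))))
      (trans (sym (ℤ.pos-* (suc n ℕ.* suc n) (suc q))) (cong (λ k → + (suc n ℕ.* suc n ℕ.* k)) (sym (ℕ.*-identityˡ (suc q)))))))
    (trans (ℚᵘ.drop-*≡* eqᵘ) (trans
      (cong₂ ℤ._*_ (cong₂ ℤ._+_ (cong (λ k → M ℤ.* M ℤ.* + k) (ℕ.*-identityˡ (suc q)))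
                                (cong (λ t → + 3 ℤ.* P ℤ.* t) (ℤ.pos-* (suc n) (suc n))))
                   (trans (ℤ.pos-* (suc q ℕ.* suc q) (suc q)) (cong (ℤ._* Q) (ℤ.pos-* (suc q) (suc q)))))
      (solve 4 (λ P Q M N → (M :* M :* Q :+ con (+ 3) :* P :* (N :* N)) :* (Q :* Q :* Q)
          := M :* M :* (Q :* Q :* (Q :* Q)) :+ con (+ 3) :* (Q :* Q) :* (P :* (N :* N :* Q)))
        refl P Q M N)))
    where
    open ℤ.+-*-Solver
    Q N : ℤ
    Q = + suc q
    N = + suc n
    open ℚᵘ.≃-Reasoning
    u v : ℚᵘ.ℚᵘ
    u = ℚ.toℚᵘ x
    v = ℚ.toℚᵘ r
    eqᵘ : u ℚᵘ.* u ℚᵘ.* u ℚᵘ.≃ v ℚᵘ.* v ℚᵘ.+ ℚᵘ.mkℚᵘ (+ 3) 0 ℚᵘ.* u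
    eqᵘ = begin
      u ℚᵘ.* u ℚᵘ.* u ≈⟨ ℚᵘ.*-congʳ (ℚᵘ.≃-sym (ℚ.toℚᵘ-homo-* x x)) ⟩
      ℚ.toℚᵘ (x ℚ.* x) ℚᵘ.* u ≈⟨ ℚᵘ.≃-sym (ℚ.toℚᵘ-homo-* (x ℚ.* x) x) ⟩
      ℚ.toℚᵘ (x ℚ.* x ℚ.* x) ≡⟨ cong ℚ.toℚᵘ eq ⟩
      ℚ.toℚᵘ (r ℚ.* r ℚ.+ (+ 3 ℚ./ 1) ℚ.* x) ≈⟨ ℚ.toℚᵘ-homo-+ (r ℚ.* r) ((+ 3 ℚ./ 1) ℚ.* x) ⟩
      ℚ.toℚᵘ (r ℚ.* r) ℚᵘ.+ ℚ.toℚᵘ ((+ 3 ℚ./ 1) ℚ.* x) ≈⟨ ℚᵘ.+-cong (ℚ.toℚᵘ-homo-* r r) (ℚ.toℚᵘ-homo-* (+ 3 ℚ./ 1) x) ⟩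
      v ℚᵘ.* v ℚᵘ.+ ℚᵘ.mkℚᵘ (+ 3) 0 ℚᵘ.* u ∎

  pos-*³ : ∀ a b c → + a ℤ.* + b ℤ.* + c ≡ + (a ℕ.* b ℕ.* c)
  pos-*³ a b c = trans (cong (ℤ._* + c) (sym (ℤ.pos-* a b))) (sym (ℤ.pos-* (a ℕ.* b) c))

  no-rational-point : ∀ (x r : ℚ) → r ≢ 0ℚ → x ℚ.* x ℚ.* x ≢ r ℚ.* r ℚ.+ (+ 3 ℚ./ 1) ℚ.* x
  no-rational-point x@(mkℚ P q′ cop) r@(mkℚ M n′ _) r≢0 eq = by-sign P cop (trans (cleared x r eq)
      (cong (ℤ._+ + 3 ℤ.* (+ q ℤ.* + q) ℤ.* (P ℤ.* (+ n ℤ.* + n ℤ.* + q))) (solve 2 (λ M Q →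
        M :* M :* (Q :* Q :* (Q :* Q)) := M :* (Q :* Q) :* (M :* (Q :* Q))) refl M (+ q))))
    where
    open ℤ.+-*-Solver
    q n m : ℕ
    q = suc q′
    n = suc n′
    m = ℤ.∣ M ∣
    0<m : 0 ℕ.< m
    0<m = ℕ.n≢0⇒n>0 (λ m≡0 → r≢0 (ℚ.↥p≡0⇒p≡0 r (ℤ.∣i∣≡0⇒i≡0 m≡0)))
    square : M ℤ.* (+ q ℤ.* + q) ℤ.* (M ℤ.* (+ q ℤ.* + q)) ≡ + (m ℕ.* (q ℕ.* q) ℕ.* (m ℕ.* (q ℕ.* q)))
    square = trans (pos-square (M ℤ.* (+ q ℤ.* + q)))
      (cong (λ k → + (k ℕ.* k)) (trans (ℤ.abs-* M (+ q ℤ.* + q)) (cong (m ℕ.*_) (ℤ.abs-* (+ q) (+ q)))))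
    Cleared : ℤ → Set
    Cleared P = P ℤ.* P ℤ.* P ℤ.* (+ n ℤ.* + n ℤ.* + q) ≡
      M ℤ.* (+ q ℤ.* + q) ℤ.* (M ℤ.* (+ q ℤ.* + q)) ℤ.+ + 3 ℤ.* (+ q ℤ.* + q) ℤ.* (P ℤ.* (+ n ℤ.* + n ℤ.* + q))
    cube : ∀ p → + p ℤ.* + p ℤ.* + p ℤ.* (+ n ℤ.* + n ℤ.* + q) ≡ + (p ℕ.* p ℕ.* p ℕ.* (n ℕ.* n ℕ.* q))
    cube p = trans (cong₂ ℤ._*_ (pos-*³ p p p) (pos-*³ n n q)) (sym (ℤ.pos-* (p ℕ.* p ℕ.* p) (n ℕ.* n ℕ.* q)))
    linear : ∀ p → + 3 ℤ.* (+ q ℤ.* + q) ℤ.* (+ p ℤ.* (+ n ℤ.* + n ℤ.* + q)) ≡ + (3 ℕ.* (q ℕ.* q) ℕ.* (p ℕ.* (n ℕ.* n ℕ.* q)))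
    linear p = trans (cong₂ ℤ._*_
        (trans (cong (+ 3 ℤ.*_) (sym (ℤ.pos-* q q))) (sym (ℤ.pos-* 3 (q ℕ.* q))))
        (trans (cong (+ p ℤ.*_) (pos-*³ n n q)) (sym (ℤ.pos-* p (n ℕ.* n ℕ.* q)))))
      (sym (ℤ.pos-* (3 ℕ.* (q ℕ.* q)) (p ℕ.* (n ℕ.* n ℕ.* q))))
    -- The sign of the numerator selects the natural-number form of the equation. Coprimality is an
    -- irrelevant field of `mkℚ`, so it is passed irrelevantly and recomputed.
    by-sign : ∀ P → .(Coprime ℤ.∣ P ∣ q) → Cleared P → ⊥
    by-sign (+ p) cop eq = no-point-above {p} {q} {m} {n} (Coprimality.recompute cop) z<s 0<m z<s
      (ℤ.+-injective (trans (sym (cube p)) (trans eq (cong₂ ℤ._+_ square (linear p)))))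
    by-sign -[1+ k ] cop eq = no-point-below {p} {q} {m} {n} (Coprimality.recompute cop) z<s 0<m z<s z<s
      (ℤ.+-injective (trans (sym (cong₂ ℤ._+_ (cube p) square)) (trans flipped (linear p))))
      where
      p : ℕ
      p = suc k
      flip : ∀ A T S Y → ℤ.- A ℤ.* (ℤ.- A) ℤ.* (ℤ.- A) ℤ.* T ≡ S ℤ.+ Y ℤ.* (ℤ.- A ℤ.* T) →
             A ℤ.* A ℤ.* A ℤ.* T ℤ.+ S ≡ Y ℤ.* (A ℤ.* T)
      flip A T S Y eq = trans
        (solve 4 (λ A T S Y → A :* A :* A :* T :+ S :=
          (S :+ Y :* (:- A :* T)) :+ Y :* (A :* T) :- :- A :* (:- A) :* (:- A) :* T) refl A T S Y)
        (trans (cong (λ t → t ℤ.+ Y ℤ.* (A ℤ.* T) ℤ.- ℤ.- A ℤ.* (ℤ.- A) ℤ.* (ℤ.- A) ℤ.* T) (sym eq))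
          (solve 3 (λ A T Y → :- A :* (:- A) :* (:- A) :* T :+ Y :* (A :* T) :- :- A :* (:- A) :* (:- A) :* T
            := Y :* (A :* T)) refl A T Y))
      flipped : + p ℤ.* + p ℤ.* + p ℤ.* (+ n ℤ.* + n ℤ.* + q) ℤ.+ M ℤ.* (+ q ℤ.* + q) ℤ.* (M ℤ.* (+ q ℤ.* + q))
              ≡ + 3 ℤ.* (+ q ℤ.* + q) ℤ.* (+ p ℤ.* (+ n ℤ.* + n ℤ.* + q))
      flipped = flip (+ p) (+ n ℤ.* + n ℤ.* + q) (M ℤ.* (+ q ℤ.* + q) ℤ.* (M ℤ.* (+ q ℤ.* + q))) (+ 3 ℤ.* (+ q ℤ.* + q)) eq

-- Ring structure of the reals, apartness and stability

module Reals where

  open import Defs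
  open Defs.Estimates using (small; shrink; half>0; halves; *-pos; *-nonNeg; ∣a-b∣≡∣b-a∣; ∣a-a∣≡0; ∣-∣-triangle)
  open import Algebra.Bundles using (CommutativeRing)
  open import Algebra.Structures using (IsCommutativeRing)
  import Algebra.Solver.Ring as RingSolver
  import Algebra.Solver.Ring.AlmostCommutativeRing as ACR
  open import Data.Empty using (⊥-elim)
  open import Data.Maybe.Base using (Maybe; just; nothing)
  open import Data.Nat.Base as ℕ using (ℕ)
  import Data.Nat.Properties as ℕ
  open import Data.Product using (∃; _×_; _,_; proj₁; proj₂)
  open import Data.Rational.Base as ℚ using (ℚ; 0ℚ; 1ℚ; ½; ∣_∣)
  import Data.Rational.Properties as ℚ
  open import Data.Rational.Solver using (module +-*-Solver)
  open import Data.Sum using (_⊎_; inj₁; inj₂)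
  open import Level using (0ℓ)
  open import Relation.Binary using (IsEquivalence)
  open import Relation.Binary.PropositionalEquality
  open import Relation.Nullary using (¬_; Dec; yes; no)

  -- Wrapping _≈_ in a record lets the endpoints be inferred from a proof.
  infix 4 _≃_ _≄_
  record _≃_ (x y : ℝ) : Set where
    constructor ⟪_⟫
    field limits-equal : x ≈ y

  open _≃_

  _≄_ : ℝ → ℝ → Set
  x ≄ y = ¬ x ≃ y

  pointwise : ∀ {x y} → (∀ n → seq x n ≡ seq y n) → x ≃ y
  pointwise {x} {y} eq = ⟪ (λ ε 0<ε → 0 , λ n _ → subst (ℚ._< ε)
    (sym (trans (cong (λ t → ∣ t ℚ.- seq y n ∣) (eq n)) (∣a-a∣≡0 (seq y n)))) 0<ε) ⟫

  ≃-refl : ∀ {x} → x ≃ x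
  ≃-refl = pointwise (λ _ → refl)

  ≃-sym : ∀ {x y} → x ≃ y → y ≃ x
  ≃-sym {x} {y} ⟪ x≈y ⟫ = ⟪ (λ ε 0<ε → let N , close = x≈y ε 0<ε in
    N , λ n N≤n → subst (ℚ._< ε) (∣a-b∣≡∣b-a∣ (seq x n) (seq y n)) (close n N≤n)) ⟫

  ≃-trans : ∀ {x y z} → x ≃ y → y ≃ z → x ≃ z
  ≃-trans {x} {y} {z} ⟪ x≈y ⟫ ⟪ y≈z ⟫ = ⟪ (λ ε 0<ε →
    let M , close₁ = x≈y (ε ℚ.* ½) (half>0 0<ε)
        N , close₂ = y≈z (ε ℚ.* ½) (half>0 0<ε)
    in M ℕ.⊔ N , λ n ≤n → ℚ.≤-<-trans (∣-∣-triangle (seq x n) (seq y n) (seq z n))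
         (subst (_ ℚ.<_) (halves ε) (ℚ.+-mono-< (close₁ n (ℕ.m⊔n≤o⇒m≤o M N ≤n))
                                                (close₂ n (ℕ.m⊔n≤o⇒n≤o M N ≤n))))) ⟫

  ≃-isEquivalence : IsEquivalence _≃_
  ≃-isEquivalence = record { refl = ≃-refl ; sym = ≃-sym ; trans = ≃-trans }

  +-cong : ∀ {x x′ y y′} → x ≃ x′ → y ≃ y′ → x + y ≃ x′ + y′
  +-cong {x} {x′} {y} {y′} ⟪ x≈x′ ⟫ ⟪ y≈y′ ⟫ = ⟪ (λ ε 0<ε →
    let M , closeˣ = x≈x′ (ε ℚ.* ½) (half>0 0<ε)
        N , closeʸ = y≈y′ (ε ℚ.* ½) (half>0 0<ε)
    in M ℕ.⊔ N , λ n ≤n → begin-strict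
        ∣ (seq x n ℚ.+ seq y n) ℚ.- (seq x′ n ℚ.+ seq y′ n) ∣
          ≡⟨ cong ∣_∣ (solve 4 (λ a b c d → (a :+ b) :- (c :+ d) := (a :- c) :+ (b :- d)) refl (seq x n) (seq y n) (seq x′ n) (seq y′ n)) ⟩
        ∣ (seq x n ℚ.- seq x′ n) ℚ.+ (seq y n ℚ.- seq y′ n) ∣
          ≤⟨ ℚ.∣p+q∣≤∣p∣+∣q∣ (seq x n ℚ.- seq x′ n) (seq y n ℚ.- seq y′ n) ⟩
        ∣ seq x n ℚ.- seq x′ n ∣ ℚ.+ ∣ seq y n ℚ.- seq y′ n ∣
          <⟨ ℚ.+-mono-< (closeˣ n (ℕ.m⊔n≤o⇒m≤o M N ≤n)) (closeʸ n (ℕ.m⊔n≤o⇒n≤o M N ≤n)) ⟩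
        ε ℚ.* ½ ℚ.+ ε ℚ.* ½
          ≡⟨ halves ε ⟩
        ε ∎) ⟫
    where
    open +-*-Solver
    open ℚ.≤-Reasoning

  -‿cong : ∀ {x y} → x ≃ y → - x ≃ - y
  -‿cong {x} {y} ⟪ x≈y ⟫ = ⟪ (λ ε 0<ε → let N , close = x≈y ε 0<ε in
    N , λ n N≤n → subst (ℚ._< ε) (trans (∣a-b∣≡∣b-a∣ (seq x n) (seq y n))
      (cong ∣_∣ (solve 2 (λ a b → b :- a := :- a :- :- b) refl (seq x n) (seq y n)))) (close n N≤n)) ⟫
    where open +-*-Solver

  *-cong : ∀ {x x′ y y′} → x ≃ x′ → y ≃ y′ → x * y ≃ x′ * y′
  *-cong {x} {x′} {y} {y′} ⟪ x≈x′ ⟫ ⟪ y≈y′ ⟫ = ⟪ (λ ε 0<ε →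
    let K , x≤K = bounded x
        L , y≤L = bounded y′
        δ , 0<δ , Kδ = shrink K (half>0 0<ε)
        γ , 0<γ , Lγ = shrink L (half>0 0<ε)
        M , closeˣ = x≈x′ γ 0<γ
        N , closeʸ = y≈y′ δ 0<δ
    in M ℕ.⊔ N , λ n ≤n → begin-strict
        ∣ seq x n ℚ.* seq y n ℚ.- seq x′ n ℚ.* seq y′ n ∣
          ≡⟨ cong ∣_∣ (solve 4 (λ a b c d → a :* b :- c :* d := a :* (b :- d) :+ d :* (a :- c)) refl (seq x n) (seq y n) (seq x′ n) (seq y′ n)) ⟩
        ∣ seq x n ℚ.* (seq y n ℚ.- seq y′ n) ℚ.+ seq y′ n ℚ.* (seq x n ℚ.- seq x′ n) ∣
          ≤⟨ ℚ.∣p+q∣≤∣p∣+∣q∣ (seq x n ℚ.* (seq y n ℚ.- seq y′ n)) (seq y′ n ℚ.* (seq x n ℚ.- seq x′ n)) ⟩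
        ∣ seq x n ℚ.* (seq y n ℚ.- seq y′ n) ∣ ℚ.+ ∣ seq y′ n ℚ.* (seq x n ℚ.- seq x′ n) ∣
          <⟨ ℚ.+-mono-< (small K (seq x n) Kδ (x≤K n) (closeʸ n (ℕ.m⊔n≤o⇒n≤o M N ≤n)))
                        (small L (seq y′ n) Lγ (y≤L n) (closeˣ n (ℕ.m⊔n≤o⇒m≤o M N ≤n))) ⟩
        ε ℚ.* ½ ℚ.+ ε ℚ.* ½
          ≡⟨ halves ε ⟩
        ε ∎) ⟫
    where
    open +-*-Solver
    open ℚ.≤-Reasoning

  0ℝ 1ℝ : ℝ
  0ℝ = fromℚ 0ℚ
  1ℝ = fromℚ 1ℚ

  isCommutativeRing : IsCommutativeRing _≃_ _+_ _*_ -_ 0ℝ 1ℝ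
  isCommutativeRing = record
    { isRing = record
      { +-isAbelianGroup = record
        { isGroup = record
          { isMonoid = record
            { isSemigroup = record
              { isMagma = record { isEquivalence = ≃-isEquivalence ; ∙-cong = +-cong }
              ; assoc = λ x y z → pointwise (λ n → ℚ.+-assoc (seq x n) (seq y n) (seq z n))
              }
            ; identity = (λ x → pointwise (λ n → ℚ.+-identityˡ (seq x n)))
                       , (λ x → pointwise (λ n → ℚ.+-identityʳ (seq x n)))
            }
          ; inverse = (λ x → pointwise (λ n → ℚ.+-inverseˡ (seq x n)))
                    , (λ x → pointwise (λ n → ℚ.+-inverseʳ (seq x n)))
          ; ⁻¹-cong = -‿cong
          }
        ; comm = λ x y → pointwise (λ n → ℚ.+-comm (seq x n) (seq y n))
        }
      ; *-cong = *-cong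
      ; *-assoc = λ x y z → pointwise (λ n → ℚ.*-assoc (seq x n) (seq y n) (seq z n))
      ; *-identity = (λ x → pointwise (λ n → ℚ.*-identityˡ (seq x n)))
                   , (λ x → pointwise (λ n → ℚ.*-identityʳ (seq x n)))
      ; distrib = (λ x y z → pointwise (λ n → ℚ.*-distribˡ-+ (seq x n) (seq y n) (seq z n)))
                , (λ x y z → pointwise (λ n → ℚ.*-distribʳ-+ (seq x n) (seq y n) (seq z n)))
      }
    ; *-comm = λ x y → pointwise (λ n → ℚ.*-comm (seq x n) (seq y n))
    }

  commutativeRing : CommutativeRing 0ℓ 0ℓ
  commutativeRing = record { isCommutativeRing = isCommutativeRing }

  -- The ring solver must compare coefficients. Equality of rationals is decidable and equality of
  -- reals is not, so the coefficients are rational.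
  fromℚ-decide : ∀ p q → Maybe (fromℚ p ≃ fromℚ q)
  fromℚ-decide p q with p ℚ.≟ q
  ... | yes refl = just ≃-refl
  ... | no  _    = nothing

  fromℚ-morphism : ℚ.+-*-rawRing ACR.-Raw-AlmostCommutative⟶ ACR.fromCommutativeRing commutativeRing
  fromℚ-morphism = record
    { ⟦_⟧    = fromℚ
    ; +-homo = λ _ _ → pointwise (λ _ → refl)
    ; *-homo = λ _ _ → pointwise (λ _ → refl)
    ; -‿homo = λ _ → pointwise (λ _ → refl)
    ; 0-homo = ≃-refl
    ; 1-homo = ≃-refl
    }

  module ℝ-Solver =
    RingSolver ℚ.+-*-rawRing (ACR.fromCommutativeRing commutativeRing) fromℚ-morphism fromℚ-decide

  -- An equation follows from hypotheses l ≃ r once the difference of its sides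
  -- is a combination Σ k (l - r).

  infixr 6 _⊕_
  infix  7 _·_

  _·_ : ∀ {l r} k → l ≃ r → k * (l - r) ≃ 0ℝ
  _·_ {l} {r} k l≃r = ≃-trans (*-cong (≃-refl {k}) (+-cong l≃r (≃-refl { - r})))
    (solve 2 (λ k r → k :* (r :- r) := con 0ℚ) ≃-refl k r)
    where open ℝ-Solver

  _⊕_ : ∀ {x y} → x ≃ 0ℝ → y ≃ 0ℝ → x + y ≃ 0ℝ
  x≃0 ⊕ y≃0 = ≃-trans (+-cong x≃0 y≃0) (pointwise (λ _ → refl))

  combine : ∀ {x y c} → x - y ≃ c → c ≃ 0ℝ → x ≃ y
  combine {x} {y} {c} x-y≃c c≃0 =
    ≃-trans (solve 2 (λ x y → x := (x :- y) :+ y) ≃-refl x y)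
      (≃-trans (+-cong (≃-trans x-y≃c c≃0) (≃-refl {y}))
        (solve 1 (λ y → con 0ℚ :+ y := y) ≃-refl y))
    where open ℝ-Solver

  -- A positive witness for x ≠ 0, strong enough to divide estimates by; `x ≄ 0ℝ` yields it only
  -- under double negation.
  Apart : ℝ → Set
  Apart x = ∃ λ δ → 0ℚ ℚ.< δ × (∃ λ N → ∀ n → N ℕ.≤ n → δ ℚ.≤ ∣ seq x n ∣)

  abstract
    -- Beyond N the sequence moves by less than ε/4, so one rational comparison of |x_N| with ε/2
    -- decides: all later terms stay below 3ε/4, or all stay above ε/4.
    small-or-apart : ∀ x ε → 0ℚ ℚ.< ε → (∃ λ N → ∀ n → N ℕ.≤ n → ∣ seq x n ∣ ℚ.< ε) ⊎ Apart x
    small-or-apart x ε 0<ε = cases (∣ seq x N ∣ ℚ.<? ε ℚ.* ½)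
      where
      open ℚ.≤-Reasoning
      open +-*-Solver
      δ : ℚ
      δ = ε ℚ.* ½ ℚ.* ½
      0<δ : 0ℚ ℚ.< δ
      0<δ = half>0 (half>0 0<ε)
      N : ℕ
      N = proj₁ (cauchy x δ 0<δ)
      close : ∀ n → N ℕ.≤ n → ∣ seq x n ℚ.- seq x N ∣ ℚ.< δ
      close n N≤n = proj₂ (cauchy x δ 0<δ) n N N≤n ℕ.≤-refl
      cases : Dec (∣ seq x N ∣ ℚ.< ε ℚ.* ½) → (∃ λ N → ∀ n → N ℕ.≤ n → ∣ seq x n ∣ ℚ.< ε) ⊎ Apart x
      cases (yes xN<) = inj₁ (N , λ n N≤n → begin-strict
        ∣ seq x n ∣                                ≡⟨ cong ∣_∣ (solve 2 (λ a b → a := (a :- b) :+ b) refl (seq x n) (seq x N)) ⟩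
        ∣ (seq x n ℚ.- seq x N) ℚ.+ seq x N ∣      ≤⟨ ℚ.∣p+q∣≤∣p∣+∣q∣ (seq x n ℚ.- seq x N) (seq x N) ⟩
        ∣ seq x n ℚ.- seq x N ∣ ℚ.+ ∣ seq x N ∣    <⟨ ℚ.+-mono-< (close n N≤n) xN< ⟩
        δ ℚ.+ ε ℚ.* ½                              ≡⟨ sym (ℚ.+-identityʳ _) ⟩
        δ ℚ.+ ε ℚ.* ½ ℚ.+ 0ℚ                       ≤⟨ ℚ.+-monoʳ-≤ (δ ℚ.+ ε ℚ.* ½) (ℚ.<⇒≤ 0<δ) ⟩
        δ ℚ.+ ε ℚ.* ½ ℚ.+ δ                        ≡⟨ solve 1 (λ e → e :* con ½ :* con ½ :+ e :* con ½ :+ e :* con ½ :* con ½ := e) refl ε ⟩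
        ε                                          ∎)
      cases (no xN≮) = inj₂ (δ , 0<δ , N , λ n N≤n → begin
        δ                                          ≡⟨ solve 1 (λ e → e :* con ½ :* con ½ := e :* con ½ :- e :* con ½ :* con ½) refl ε ⟩
        ε ℚ.* ½ ℚ.- δ                              ≤⟨ ℚ.+-mono-≤ (ℚ.≮⇒≥ xN≮) (ℚ.neg-antimono-≤ (ℚ.<⇒≤ (close n N≤n))) ⟩
        ∣ seq x N ∣ ℚ.- ∣ seq x n ℚ.- seq x N ∣    ≤⟨ ℚ.+-monoˡ-≤ (ℚ.- ∣ seq x n ℚ.- seq x N ∣) (begin
          ∣ seq x N ∣                                  ≡⟨ cong ∣_∣ (solve 2 (λ a b → b := a :+ (b :- a)) refl (seq x n) (seq x N)) ⟩
          ∣ seq x n ℚ.+ (seq x N ℚ.- seq x n) ∣        ≤⟨ ℚ.∣p+q∣≤∣p∣+∣q∣ (seq x n) (seq x N ℚ.- seq x n) ⟩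
          ∣ seq x n ∣ ℚ.+ ∣ seq x N ℚ.- seq x n ∣      ≡⟨ cong (∣ seq x n ∣ ℚ.+_) (∣a-b∣≡∣b-a∣ (seq x N) (seq x n)) ⟩
          ∣ seq x n ∣ ℚ.+ ∣ seq x n ℚ.- seq x N ∣      ∎) ⟩
        ∣ seq x n ∣ ℚ.+ ∣ seq x n ℚ.- seq x N ∣ ℚ.- ∣ seq x n ℚ.- seq x N ∣ ≡⟨ solve 2 (λ a b → a :+ b :- b := a) refl ∣ seq x n ∣ ∣ seq x n ℚ.- seq x N ∣ ⟩
        ∣ seq x n ∣                                ∎)

    ≃0⇒small : ∀ {x} → x ≃ 0ℝ → ∀ ε → 0ℚ ℚ.< ε → ∃ λ N → ∀ n → N ℕ.≤ n → ∣ seq x n ∣ ℚ.< ε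
    ≃0⇒small {x} ⟪ x≈0 ⟫ ε 0<ε = let N , close = x≈0 ε 0<ε in
      N , λ n N≤n → subst (λ t → ∣ t ∣ ℚ.< ε) (ℚ.+-identityʳ (seq x n)) (close n N≤n)

    small⇒≃0 : ∀ {x} → (∀ ε → 0ℚ ℚ.< ε → ∃ λ N → ∀ n → N ℕ.≤ n → ∣ seq x n ∣ ℚ.< ε) → x ≃ 0ℝ
    small⇒≃0 {x} close = ⟪ (λ ε 0<ε → let N , below = close ε 0<ε in
      N , λ n N≤n → subst (λ t → ∣ t ∣ ℚ.< ε) (sym (ℚ.+-identityʳ (seq x n))) (below n N≤n)) ⟫

    apart⇒≄0 : ∀ {x} → Apart x → x ≄ 0ℝ
    apart⇒≄0 (δ , 0<δ , M , above) x≃0 = let N , below = ≃0⇒small x≃0 δ 0<δ in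
      ℚ.<-irrefl refl (ℚ.≤-<-trans (above (M ℕ.⊔ N) (ℕ.m≤m⊔n M N)) (below (M ℕ.⊔ N) (ℕ.m≤n⊔m M N)))

    -- For each ε the alternative `Apart x` of `small-or-apart` is refuted, so the terms are small.
    -- This stability lets an equation be proved by supposing its negation.
    ≃0-stable : ∀ {x} → ¬ x ≄ 0ℝ → x ≃ 0ℝ
    ≃0-stable {x} ¬x≄0 = small⇒≃0 (λ ε 0<ε → cases ε (small-or-apart x ε 0<ε))
      where
      cases : ∀ ε → (∃ λ N → ∀ n → N ℕ.≤ n → ∣ seq x n ∣ ℚ.< ε) ⊎ Apart x →
              ∃ λ N → ∀ n → N ℕ.≤ n → ∣ seq x n ∣ ℚ.< ε
      cases ε (inj₁ small) = small
      cases ε (inj₂ apart) = ⊥-elim (¬x≄0 (apart⇒≄0 apart))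

    ≄0⇒¬¬apart : ∀ {x} → x ≄ 0ℝ → ¬ ¬ Apart x
    ≄0⇒¬¬apart {x} x≄0 ¬apart = x≄0 (small⇒≃0 (λ ε 0<ε → cases ε (small-or-apart x ε 0<ε)))
      where
      cases : ∀ ε → (∃ λ N → ∀ n → N ℕ.≤ n → ∣ seq x n ∣ ℚ.< ε) ⊎ Apart x →
              ∃ λ N → ∀ n → N ℕ.≤ n → ∣ seq x n ∣ ℚ.< ε
      cases ε (inj₁ small) = small
      cases ε (inj₂ apart) = ⊥-elim (¬apart apart)

    apart-cancel : ∀ {x y} → Apart x → x * y ≃ 0ℝ → y ≃ 0ℝ
    apart-cancel {x} {y} (δ , 0<δ , M , above) xy≃0 = small⇒≃0 (λ ε 0<ε →
      let N , below = ≃0⇒small xy≃0 (δ ℚ.* ε) (*-pos 0<δ 0<ε) in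
      M ℕ.⊔ N , λ n ≤n → ℚ.*-cancelˡ-<-nonNeg δ {{ℚ.nonNegative (ℚ.<⇒≤ 0<δ)}} (begin-strict
        δ ℚ.* ∣ seq y n ∣            ≤⟨ ℚ.*-monoʳ-≤-nonNeg ∣ seq y n ∣ {{ℚ.∣-∣-nonNeg (seq y n)}} (above n (ℕ.m⊔n≤o⇒m≤o M N ≤n)) ⟩
        ∣ seq x n ∣ ℚ.* ∣ seq y n ∣  ≡⟨ sym (ℚ.∣p*q∣≡∣p∣*∣q∣ (seq x n) (seq y n)) ⟩
        ∣ seq x n ℚ.* seq y n ∣      <⟨ below n (ℕ.m⊔n≤o⇒n≤o M N ≤n) ⟩
        δ ℚ.* ε                      ∎))
      where open ℚ.≤-Reasoning

    -- The goal is stable, so the double negation around `Apart x` can be opened and the estimate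
    -- `apart-cancel` applied.
    *-cancel-≄0 : ∀ {x y} → x ≄ 0ℝ → x * y ≃ 0ℝ → y ≃ 0ℝ
    *-cancel-≄0 x≄0 xy≃0 = ≃0-stable (λ y≄0 → ≄0⇒¬¬apart x≄0 (λ apart → y≄0 (apart-cancel apart xy≃0)))

  *-≄0 : ∀ {x y} → x ≄ 0ℝ → y ≄ 0ℝ → x * y ≄ 0ℝ
  *-≄0 x≄0 y≄0 xy≃0 = y≄0 (*-cancel-≄0 x≄0 xy≃0)

  square≃0⇒≃0 : ∀ {x} → x * x ≃ 0ℝ → x ≃ 0ℝ
  square≃0⇒≃0 x²≃0 = ≃0-stable (λ x≄0 → *-≄0 x≄0 x≄0 x²≃0)

  abstract
    -- Termwise a² ≤ a² + b². The order of the reals enters here; it keeps the leading coefficient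
    -- p² + q² nonzero when a line is intersected with a circle.
    sum-of-squares≃0⇒≃0 : ∀ {x y} → x * x + y * y ≃ 0ℝ → x ≃ 0ℝ
    sum-of-squares≃0⇒≃0 {x} {y} eq = square≃0⇒≃0 (small⇒≃0 (λ ε 0<ε →
      let N , below = ≃0⇒small eq ε 0<ε in
      N , λ n N≤n → ℚ.≤-<-trans (bound (seq x n) (seq y n)) (below n N≤n)))
      where
      open ℚ.≤-Reasoning
      0≤square : ∀ a → 0ℚ ℚ.≤ a ℚ.* a
      0≤square a with ℚ.≤-total 0ℚ a
      ... | inj₁ 0≤a = *-nonNeg 0≤a 0≤a
      ... | inj₂ a≤0 = subst (0ℚ ℚ.≤_) (solve 1 (λ a → :- a :* :- a := a :* a) refl a)
                         (*-nonNeg (ℚ.neg-antimono-≤ a≤0) (ℚ.neg-antimono-≤ a≤0))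
        where open +-*-Solver
      bound : ∀ a b → ∣ a ℚ.* a ∣ ℚ.≤ ∣ a ℚ.* a ℚ.+ b ℚ.* b ∣
      bound a b = begin
        ∣ a ℚ.* a ∣                ≡⟨ ℚ.0≤p⇒∣p∣≡p (0≤square a) ⟩
        a ℚ.* a                    ≡⟨ sym (ℚ.+-identityʳ (a ℚ.* a)) ⟩
        a ℚ.* a ℚ.+ 0ℚ             ≤⟨ ℚ.+-monoʳ-≤ (a ℚ.* a) (0≤square b) ⟩
        a ℚ.* a ℚ.+ b ℚ.* b        ≡⟨ sym (ℚ.0≤p⇒∣p∣≡p (ℚ.+-mono-≤ (0≤square a) (0≤square b))) ⟩
        ∣ a ℚ.* a ℚ.+ b ℚ.* b ∣    ∎

    fromℚ-injective : ∀ {p q} → fromℚ p ≃ fromℚ q → p ≡ q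
    fromℚ-injective {p} {q} ⟪ p≈q ⟫ with ∣ p ℚ.- q ∣ ℚ.≤? 0ℚ
    ... | yes ≤0 = trans (solve 2 (λ a b → a := (a :- b) :+ b) refl p q)
            (trans (cong (ℚ._+ q) (ℚ.∣p∣≡0⇒p≡0 (p ℚ.- q) (ℚ.≤-antisym ≤0 (ℚ.0≤∣p∣ (p ℚ.- q)))))
                   (ℚ.+-identityˡ q))
      where open +-*-Solver
    ... | no ≰0 with p≈q ∣ p ℚ.- q ∣ (ℚ.≰⇒> ≰0)
    ...   | N , close = ⊥-elim (ℚ.<-irrefl refl (close N ℕ.≤-refl))

-- Addition formulas for the Taylor series of cosine and sine

module AdditionFormulas where

  open import Defs
  open Defs.Estimates
  open Reals
  import Algebra.Definitions.RawSemiring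
  open import Data.Nat.Base as ℕ using (ℕ; zero; suc; _!)
  import Data.Nat.Properties as ℕ
  open import Data.Product using (_,_; proj₁; proj₂)
  open import Data.Rational.Base as ℚ using (ℚ; 0ℚ; 1ℚ; ½; ∣_∣)
  import Data.Rational.Properties as ℚ
  open import Data.Rational.Solver using (module +-*-Solver)
  open import Relation.Binary.PropositionalEquality
  open Algebra.Definitions.RawSemiring ℚ.+-*-rawSemiring using (_^_)
  open +-*-Solver

  infixl 7 _⋆_
  -- The Cauchy product of power series. The recursion splits off `a 0` and shifts `a`, so that
  -- inductions leave `b` fixed.
  _⋆_ : (ℕ → ℚ) → (ℕ → ℚ) → ℕ → ℚ
  (a ⋆ b) zero    = a 0 ℚ.* b 0
  (a ⋆ b) (suc m) = a 0 ℚ.* b (suc m) ℚ.+ ((λ k → a (suc k)) ⋆ b) m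

  ⋆-cong : ∀ {a a′ b b′} → (∀ k → a k ≡ a′ k) → (∀ k → b k ≡ b′ k) → ∀ m → (a ⋆ b) m ≡ (a′ ⋆ b′) m
  ⋆-cong p q zero    = cong₂ ℚ._*_ (p 0) (q 0)
  ⋆-cong p q (suc m) = cong₂ ℚ._+_ (cong₂ ℚ._*_ (p 0) (q (suc m))) (⋆-cong (λ k → p (suc k)) q m)

  ⋆-distribʳ-+ : ∀ a a′ b m → ((λ k → a k ℚ.+ a′ k) ⋆ b) m ≡ (a ⋆ b) m ℚ.+ (a′ ⋆ b) m
  ⋆-distribʳ-+ a a′ b zero    = ℚ.*-distribʳ-+ (b 0) (a 0) (a′ 0)
  ⋆-distribʳ-+ a a′ b (suc m) = trans
    (cong ((a 0 ℚ.+ a′ 0) ℚ.* b (suc m) ℚ.+_) (⋆-distribʳ-+ (λ k → a (suc k)) (λ k → a′ (suc k)) b m))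
    (solve 5 (λ a a′ b c c′ → (a :+ a′) :* b :+ (c :+ c′) := (a :* b :+ c) :+ (a′ :* b :+ c′)) refl
      (a 0) (a′ 0) (b (suc m)) (((λ k → a (suc k)) ⋆ b) m) (((λ k → a′ (suc k)) ⋆ b) m))

  ⋆-scaleˡ : ∀ x a b m → ((λ k → x ℚ.* a k) ⋆ b) m ≡ x ℚ.* (a ⋆ b) m
  ⋆-scaleˡ x a b zero    = ℚ.*-assoc x (a 0) (b 0)
  ⋆-scaleˡ x a b (suc m) = trans
    (cong (x ℚ.* a 0 ℚ.* b (suc m) ℚ.+_) (⋆-scaleˡ x (λ k → a (suc k)) b m))
    (solve 4 (λ x a b c → x :* a :* b :+ x :* c := x :* (a :* b :+ c)) refl
      x (a 0) (b (suc m)) (((λ k → a (suc k)) ⋆ b) m))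

  ⋆-scaleʳ : ∀ x a b m → (a ⋆ (λ k → x ℚ.* b k)) m ≡ x ℚ.* (a ⋆ b) m
  ⋆-scaleʳ x a b zero    = solve 3 (λ x a b → a :* (x :* b) := x :* (a :* b)) refl x (a 0) (b 0)
  ⋆-scaleʳ x a b (suc m) = trans
    (cong (a 0 ℚ.* (x ℚ.* b (suc m)) ℚ.+_) (⋆-scaleʳ x (λ k → a (suc k)) b m))
    (solve 4 (λ x a b c → a :* (x :* b) :+ x :* c := x :* (a :* b :+ c)) refl
      x (a 0) (b (suc m)) (((λ k → a (suc k)) ⋆ b) m))

  -- The coefficients of the formal derivative of the power series with coefficients `a`.
  derivative : (ℕ → ℚ) → ℕ → ℚ
  derivative a k = ι (suc k) ℚ.* a (suc k)

  product-rule : ∀ a b m → derivative (a ⋆ b) m ≡ (derivative a ⋆ b) m ℚ.+ (a ⋆ derivative b) m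
  product-rule a b zero = solve 4 (λ a a′ b b′ →
      con 1ℚ :* (a :* b′ :+ a′ :* b) := con 1ℚ :* a′ :* b :+ a :* (con 1ℚ :* b′)) refl
    (a 0) (a 1) (b 0) (b 1)
  product-rule a b (suc m) = begin
    ι (2 ℕ.+ m) ℚ.* (a 0 ℚ.* b (2 ℕ.+ m) ℚ.+ (a′ ⋆ b) (suc m))
      ≡⟨ cong (λ t → t ℚ.* (a 0 ℚ.* b (2 ℕ.+ m) ℚ.+ (a′ ⋆ b) (suc m))) (ι-suc (suc m)) ⟩
    (1ℚ ℚ.+ i) ℚ.* (a 0 ℚ.* b (2 ℕ.+ m) ℚ.+ (a′ ⋆ b) (suc m))
      ≡⟨ solve 4 (λ i a b c → (con 1ℚ :+ i) :* (a :* b :+ c) := (con 1ℚ :+ i) :* (a :* b) :+ c :+ i :* c) refl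
           i (a 0) (b (2 ℕ.+ m)) ((a′ ⋆ b) (suc m)) ⟩
    (1ℚ ℚ.+ i) ℚ.* (a 0 ℚ.* b (2 ℕ.+ m)) ℚ.+ (a′ ⋆ b) (suc m) ℚ.+ derivative (a′ ⋆ b) m
      ≡⟨ cong (λ t → (1ℚ ℚ.+ i) ℚ.* (a 0 ℚ.* b (2 ℕ.+ m)) ℚ.+ (a′ ⋆ b) (suc m) ℚ.+ t) (product-rule a′ b m) ⟩
    (1ℚ ℚ.+ i) ℚ.* (a 0 ℚ.* b (2 ℕ.+ m)) ℚ.+ (a′ 0 ℚ.* b (suc m) ℚ.+ (a″ ⋆ b) m)
      ℚ.+ ((derivative a′ ⋆ b) m ℚ.+ (a′ ⋆ derivative b) m)
      ≡⟨ solve 8 (λ i a b₂ a₁ b₁ x y z →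
           (con 1ℚ :+ i) :* (a :* b₂) :+ (a₁ :* b₁ :+ x) :+ (y :+ z)
             := (con 1ℚ :* a₁ :* b₁ :+ (x :+ y)) :+ (a :* ((con 1ℚ :+ i) :* b₂) :+ z)) refl
           i (a 0) (b (2 ℕ.+ m)) (a 1) (b (suc m)) ((a″ ⋆ b) m) ((derivative a′ ⋆ b) m) ((a′ ⋆ derivative b) m) ⟩
    (1ℚ ℚ.* a 1 ℚ.* b (suc m) ℚ.+ ((a″ ⋆ b) m ℚ.+ (derivative a′ ⋆ b) m))
      ℚ.+ (a 0 ℚ.* ((1ℚ ℚ.+ i) ℚ.* b (2 ℕ.+ m)) ℚ.+ (a′ ⋆ derivative b) m)
      ≡⟨ cong₂ (λ s t → (1ℚ ℚ.* a 1 ℚ.* b (suc m) ℚ.+ s) ℚ.+ (a 0 ℚ.* (t ℚ.* b (2 ℕ.+ m)) ℚ.+ (a′ ⋆ derivative b) m))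
           (sym (trans (⋆-cong shifted (λ _ → refl) m) (⋆-distribʳ-+ a″ (derivative a′) b m))) (sym (ι-suc (suc m))) ⟩
    (derivative a ⋆ b) (suc m) ℚ.+ (a ⋆ derivative b) (suc m) ∎
    where
    open ≡-Reasoning
    i : ℚ
    i = ι (suc m)
    a′ a″ : ℕ → ℚ
    a′ k = a (suc k)
    a″ k = a (suc (suc k))
    shifted : ∀ k → derivative a (suc k) ≡ a″ k ℚ.+ derivative a′ k
    shifted k = trans (cong (ℚ._* a″ k) (ι-suc (suc k)))
      (solve 2 (λ j x → (con 1ℚ :+ j) :* x := x :+ j :* x) refl (ι (suc k)) (a″ k))

  sum-shift : ∀ f n → sum f (suc n) ≡ f 0 ℚ.+ sum (λ k → f (suc k)) n
  sum-shift f zero    = ℚ.+-comm 0ℚ (f 0)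
  sum-shift f (suc n) = trans (cong (ℚ._+ f (suc n)) (sum-shift f n))
    (ℚ.+-assoc (f 0) (sum (λ k → f (suc k)) n) (f (suc n)))

  sum-cong : ∀ {f g} → (∀ k → f k ≡ g k) → ∀ n → sum f n ≡ sum g n
  sum-cong p zero    = refl
  sum-cong p (suc n) = cong₂ ℚ._+_ (sum-cong p n) (p n)

  sum-+ : ∀ f g n → sum (λ k → f k ℚ.+ g k) n ≡ sum f n ℚ.+ sum g n
  sum-+ f g zero    = refl
  sum-+ f g (suc n) = trans (cong (ℚ._+ (f n ℚ.+ g n)) (sum-+ f g n))
    (solve 4 (λ a b c d → (a :+ b) :+ (c :+ d) := (a :+ c) :+ (b :+ d)) refl (sum f n) (sum g n) (f n) (g n))

  sum-⋆ : ∀ a b n → sum (a ⋆ b) (suc n) ≡ a 0 ℚ.* sum b (suc n) ℚ.+ sum ((λ k → a (suc k)) ⋆ b) n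
  sum-⋆ a b zero    = solve 2 (λ a b → con 0ℚ :+ a :* b := a :* (con 0ℚ :+ b) :+ con 0ℚ) refl (a 0) (b 0)
  sum-⋆ a b (suc n) = trans (cong (ℚ._+ (a ⋆ b) (suc n)) (sum-⋆ a b n))
    (solve 5 (λ a s b t c → (a :* s :+ t) :+ (a :* b :+ c) := a :* (s :+ b) :+ (t :+ c)) refl
      (a 0) (sum b (suc n)) (b (suc n)) (sum ((λ k → a (suc k)) ⋆ b) n) (((λ k → a (suc k)) ⋆ b) n))

  Geometric : ℚ → (ℕ → ℚ) → Set
  Geometric α a = ∀ k → ∣ a k ∣ ℚ.≤ α ℚ.* ½ ^ k

  abstract
    sum-bound : ∀ {α a} → 0ℚ ℚ.≤ α → Geometric α a → ∀ n → ∣ sum a n ∣ ℚ.≤ α ℚ.+ α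
    sum-bound {α} {a} 0≤α a≤ n = begin
      ∣ sum a n ∣             ≡⟨ cong ∣_∣ (sym (ℚ.+-identityʳ (sum a n))) ⟩
      ∣ sum a n ℚ.- 0ℚ ∣      ≤⟨ tail a α 0≤α a≤ 0 {n} ℕ.z≤n ⟩
      (α ℚ.+ α) ℚ.* 1ℚ        ≡⟨ ℚ.*-identityʳ (α ℚ.+ α) ⟩
      α ℚ.+ α                 ∎
      where open ℚ.≤-Reasoning

    -- The induction shifts `a`, which halves its constant α. The new contribution is at most αβ½ⁿ,
    -- and the halved bound for n is nαβ½ⁿ; together they make the bound for `suc n`.
    product-error : ∀ {α β} a b → 0ℚ ℚ.≤ α → 0ℚ ℚ.≤ β → Geometric α a → Geometric β b → ∀ n →
      ∣ sum a n ℚ.* sum b n ℚ.- sum (a ⋆ b) n ∣ ℚ.≤ ι n ℚ.* (α ℚ.* β) ℚ.* (½ ^ n ℚ.+ ½ ^ n)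
    product-error {α} {β} a b 0≤α 0≤β a≤ b≤ zero = ℚ.≤-reflexive
      (solve 2 (λ α β → con 0ℚ := con 0ℚ :* (α :* β) :* (con 1ℚ :+ con 1ℚ)) refl α β)
    product-error {α} {β} a b 0≤α 0≤β a≤ b≤ (suc n) = begin
      ∣ sum a (suc n) ℚ.* sum b (suc n) ℚ.- sum (a ⋆ b) (suc n) ∣
        ≡⟨ cong₂ (λ s t → ∣ s ℚ.* sum b (suc n) ℚ.- t ∣) (sum-shift a n) (sum-⋆ a b n) ⟩
      ∣ (a 0 ℚ.+ sum a′ n) ℚ.* (sum b n ℚ.+ b n) ℚ.- (a 0 ℚ.* (sum b n ℚ.+ b n) ℚ.+ sum (a′ ⋆ b) n) ∣
        -- Both expressions contain `a 0` times the same partial sum of `b`, so these terms cancel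
        -- exactly.
        ≡⟨ cong ∣_∣ (solve 5 (λ a s t b c → (a :+ s) :* (t :+ b) :- (a :* (t :+ b) :+ c) := s :* b :+ (s :* t :- c)) refl
             (a 0) (sum a′ n) (sum b n) (b n) (sum (a′ ⋆ b) n)) ⟩
      ∣ sum a′ n ℚ.* b n ℚ.+ (sum a′ n ℚ.* sum b n ℚ.- sum (a′ ⋆ b) n) ∣
        ≤⟨ ℚ.∣p+q∣≤∣p∣+∣q∣ (sum a′ n ℚ.* b n) (sum a′ n ℚ.* sum b n ℚ.- sum (a′ ⋆ b) n) ⟩
      ∣ sum a′ n ℚ.* b n ∣ ℚ.+ ∣ sum a′ n ℚ.* sum b n ℚ.- sum (a′ ⋆ b) n ∣
        ≡⟨ cong (ℚ._+ ∣ sum a′ n ℚ.* sum b n ℚ.- sum (a′ ⋆ b) n ∣) (ℚ.∣p*q∣≡∣p∣*∣q∣ (sum a′ n) (b n)) ⟩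
      ∣ sum a′ n ∣ ℚ.* ∣ b n ∣ ℚ.+ ∣ sum a′ n ℚ.* sum b n ℚ.- sum (a′ ⋆ b) n ∣
        ≤⟨ ℚ.+-mono-≤ (*-mono (ℚ.0≤∣p∣ (b n)) (ℚ.+-mono-≤ 0≤α½ 0≤α½) (sum-bound 0≤α½ a′≤ n) (b≤ n))
                      (product-error a′ b 0≤α½ 0≤β a′≤ b≤ n) ⟩
      (α ℚ.* ½ ℚ.+ α ℚ.* ½) ℚ.* (β ℚ.* ½ ^ n) ℚ.+ ι n ℚ.* (α ℚ.* ½ ℚ.* β) ℚ.* (½ ^ n ℚ.+ ½ ^ n)
        ≡⟨ solve 4 (λ α β h i → (α :* con ½ :+ α :* con ½) :* (β :* h) :+ i :* (α :* con ½ :* β) :* (h :+ h)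
             := (con 1ℚ :+ i) :* (α :* β) :* (con ½ :* h :+ con ½ :* h)) refl α β (½ ^ n) (ι n) ⟩
      (1ℚ ℚ.+ ι n) ℚ.* (α ℚ.* β) ℚ.* (½ ^ suc n ℚ.+ ½ ^ suc n)
        ≡⟨ cong (λ t → t ℚ.* (α ℚ.* β) ℚ.* (½ ^ suc n ℚ.+ ½ ^ suc n)) (sym (ι-suc n)) ⟩
      ι (suc n) ℚ.* (α ℚ.* β) ℚ.* (½ ^ suc n ℚ.+ ½ ^ suc n) ∎
      where
      open ℚ.≤-Reasoning
      a′ : ℕ → ℚ
      a′ k = a (suc k)
      0≤α½ : 0ℚ ℚ.≤ α ℚ.* ½
      0≤α½ = *-nonNeg 0≤α ½≥0
      a′≤ : Geometric (α ℚ.* ½) a′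
      a′≤ k = ℚ.≤-trans (a≤ (suc k)) (ℚ.≤-reflexive (sym (ℚ.*-assoc α ½ (½ ^ k))))

  -- The coefficients of cos(qX) and sin(qX) as series in X, read off from C′ = -q S, S′ = q C, C(0)
  -- = 1, S(0) = 0. Keeping the zero coefficients gives both series the same index.
  cosᶜ sinᶜ : ℚ → ℕ → ℚ
  cosᶜ q zero    = 1ℚ
  cosᶜ q (suc k) = recip (suc k) ℚ.* (ℚ.- q ℚ.* sinᶜ q k)
  sinᶜ q zero    = 0ℚ
  sinᶜ q (suc k) = recip (suc k) ℚ.* (q ℚ.* cosᶜ q k)

  ι*[recip*] : ∀ k x → ι (suc k) ℚ.* (recip (suc k) ℚ.* x) ≡ x
  ι*[recip*] k x = trans (sym (ℚ.*-assoc (ι (suc k)) (recip (suc k)) x))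
    (trans (cong (ℚ._* x) (ι*recip (suc k))) (ℚ.*-identityˡ x))

  recip*[ι*] : ∀ k x → recip (suc k) ℚ.* (ι (suc k) ℚ.* x) ≡ x
  recip*[ι*] k x = trans (solve 3 (λ r i x → r :* (i :* x) := i :* (r :* x)) refl (recip (suc k)) (ι (suc k)) x)
    (ι*[recip*] k x)

  module _ (p q : ℚ) where

    private
      cc ss sc cs : ℕ → ℚ
      cc = cosᶜ p ⋆ cosᶜ q
      ss = sinᶜ p ⋆ sinᶜ q
      sc = sinᶜ p ⋆ cosᶜ q
      cs = cosᶜ p ⋆ sinᶜ q

      derivative-⋆ : ∀ {a b a′ b′} x y → (∀ k → derivative a k ≡ x ℚ.* a′ k) → (∀ k → derivative b k ≡ y ℚ.* b′ k) →
                     ∀ m → derivative (a ⋆ b) m ≡ x ℚ.* (a′ ⋆ b) m ℚ.+ y ℚ.* (a ⋆ b′) m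
      derivative-⋆ {a} {b} {a′} {b′} x y da db m = trans (product-rule a b m) (cong₂ ℚ._+_
        (trans (⋆-cong da (λ _ → refl) m) (⋆-scaleˡ x a′ b m))
        (trans (⋆-cong (λ _ → refl) db m) (⋆-scaleʳ y a b′ m)))

      derivative-cosᶜ : ∀ q k → derivative (cosᶜ q) k ≡ ℚ.- q ℚ.* sinᶜ q k
      derivative-cosᶜ q k = ι*[recip*] k (ℚ.- q ℚ.* sinᶜ q k)

      derivative-sinᶜ : ∀ q k → derivative (sinᶜ q) k ≡ q ℚ.* cosᶜ q k
      derivative-sinᶜ q k = ι*[recip*] k (q ℚ.* cosᶜ q k)

    -- Uniqueness of formal solutions: by the product rule, cc - ss and sc + cs satisfy the
    -- differential system with p + q in place of q and have the same constant terms, and the system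
    -- determines each coefficient from the preceding ones.
    cosᶜ-+ : ∀ m → cosᶜ (p ℚ.+ q) m ≡ cc m ℚ.- ss m
    sinᶜ-+ : ∀ m → sinᶜ (p ℚ.+ q) m ≡ sc m ℚ.+ cs m
    cosᶜ-+ zero    = refl
    cosᶜ-+ (suc m) = begin
      r ℚ.* (ℚ.- (p ℚ.+ q) ℚ.* sinᶜ (p ℚ.+ q) m)
        ≡⟨ cong (λ t → r ℚ.* (ℚ.- (p ℚ.+ q) ℚ.* t)) (sinᶜ-+ m) ⟩
      r ℚ.* (ℚ.- (p ℚ.+ q) ℚ.* (sc m ℚ.+ cs m))
        ≡⟨ cong (r ℚ.*_) (solve 4 (λ p q s c → :- (p :+ q) :* (s :+ c) :=
             (:- p :* s :+ :- q :* c) :- (p :* c :+ q :* s)) refl p q (sc m) (cs m)) ⟩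
      r ℚ.* ((ℚ.- p ℚ.* sc m ℚ.+ ℚ.- q ℚ.* cs m) ℚ.- (p ℚ.* cs m ℚ.+ q ℚ.* sc m))
        ≡⟨ cong (r ℚ.*_) (cong₂ ℚ._-_
             (sym (derivative-⋆ (ℚ.- p) (ℚ.- q) (derivative-cosᶜ p) (derivative-cosᶜ q) m))
             (sym (derivative-⋆ p q (derivative-sinᶜ p) (derivative-sinᶜ q) m))) ⟩
      r ℚ.* (derivative cc m ℚ.- derivative ss m)
        ≡⟨ cong (r ℚ.*_) (solve 3 (λ i x y → i :* x :- i :* y := i :* (x :- y)) refl (ι (suc m)) (cc (suc m)) (ss (suc m))) ⟩
      r ℚ.* (ι (suc m) ℚ.* (cc (suc m) ℚ.- ss (suc m)))
        ≡⟨ recip*[ι*] m (cc (suc m) ℚ.- ss (suc m)) ⟩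
      cc (suc m) ℚ.- ss (suc m) ∎
      where
      open ≡-Reasoning
      r : ℚ
      r = recip (suc m)
    sinᶜ-+ zero    = refl
    sinᶜ-+ (suc m) = begin
      r ℚ.* ((p ℚ.+ q) ℚ.* cosᶜ (p ℚ.+ q) m)
        ≡⟨ cong (λ t → r ℚ.* ((p ℚ.+ q) ℚ.* t)) (cosᶜ-+ m) ⟩
      r ℚ.* ((p ℚ.+ q) ℚ.* (cc m ℚ.- ss m))
        ≡⟨ cong (r ℚ.*_) (solve 4 (λ p q c s → (p :+ q) :* (c :- s) :=
             (p :* c :+ :- q :* s) :+ (:- p :* s :+ q :* c)) refl p q (cc m) (ss m)) ⟩
      r ℚ.* ((p ℚ.* cc m ℚ.+ ℚ.- q ℚ.* ss m) ℚ.+ (ℚ.- p ℚ.* ss m ℚ.+ q ℚ.* cc m))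
        ≡⟨ cong (r ℚ.*_) (cong₂ ℚ._+_
             (sym (derivative-⋆ p (ℚ.- q) (derivative-sinᶜ p) (derivative-cosᶜ q) m))
             (sym (derivative-⋆ (ℚ.- p) q (derivative-cosᶜ p) (derivative-sinᶜ q) m))) ⟩
      r ℚ.* (derivative sc m ℚ.+ derivative cs m)
        ≡⟨ cong (r ℚ.*_) (sym (ℚ.*-distribˡ-+ (ι (suc m)) (sc (suc m)) (cs (suc m)))) ⟩
      r ℚ.* (ι (suc m) ℚ.* (sc (suc m) ℚ.+ cs (suc m)))
        ≡⟨ recip*[ι*] m (sc (suc m) ℚ.+ cs (suc m)) ⟩
      sc (suc m) ℚ.+ cs (suc m) ∎
      where
      open ≡-Reasoning
      r : ℚ
      r = recip (suc m)

  recip-* : ∀ m n .{{_ : ℕ.NonZero m}} .{{_ : ℕ.NonZero n}} .{{_ : ℕ.NonZero (m ℕ.* n)}} →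
            recip (m ℕ.* n) ≡ recip m ℚ.* recip n
  recip-* m n = begin
    recip (m ℕ.* n)
      ≡⟨ solve 1 (λ a → a := a :* con 1ℚ :* con 1ℚ) refl (recip (m ℕ.* n)) ⟩
    recip (m ℕ.* n) ℚ.* 1ℚ ℚ.* 1ℚ
      ≡⟨ cong₂ (λ s t → recip (m ℕ.* n) ℚ.* s ℚ.* t) (sym (ι*recip m)) (sym (ι*recip n)) ⟩
    recip (m ℕ.* n) ℚ.* (ι m ℚ.* recip m) ℚ.* (ι n ℚ.* recip n)
      ≡⟨ solve 5 (λ a x y u v → a :* (x :* u) :* (y :* v) := (x :* y) :* a :* (u :* v)) refl
           (recip (m ℕ.* n)) (ι m) (ι n) (recip m) (recip n) ⟩
    ι m ℚ.* ι n ℚ.* recip (m ℕ.* n) ℚ.* (recip m ℚ.* recip n)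
      ≡⟨ cong (λ t → t ℚ.* recip (m ℕ.* n) ℚ.* (recip m ℚ.* recip n)) (sym (ι-* m n)) ⟩
    ι (m ℕ.* n) ℚ.* recip (m ℕ.* n) ℚ.* (recip m ℚ.* recip n)
      ≡⟨ cong (ℚ._* (recip m ℚ.* recip n)) (ι*recip (m ℕ.* n)) ⟩
    1ℚ ℚ.* (recip m ℚ.* recip n)
      ≡⟨ ℚ.*-identityˡ (recip m ℚ.* recip n) ⟩
    recip m ℚ.* recip n ∎
    where open ≡-Reasoning

  recip! : ℕ → ℚ
  recip! k = recip (k !) {{k ℕ.!≢0}}

  recip!-suc : ∀ k → recip! (suc k) ≡ recip (suc k) ℚ.* recip! k
  recip!-suc k = recip-* (suc k) (k !) {{_}} {{k ℕ.!≢0}} {{suc k ℕ.!≢0}}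

  term-suc : ∀ j q k → recip (suc j) ℚ.* (q ℚ.* term j q k) ≡ term (suc j) q k
  term-suc j q k = trans
    (solve 5 (λ r q s p t → r :* (q :* (s :* (p :* t))) := s :* (q :* p :* (r :* t))) refl
      (recip (suc j)) q ((ℚ.- 1ℚ) ^ k) (q ^ j) (recip! j))
    (cong (λ t → (ℚ.- 1ℚ) ^ k ℚ.* (q ^ suc j ℚ.* t)) (sym (recip!-suc j)))

  term-flip : ∀ j q k → ℚ.- term j q k ≡ term j q (suc k)
  term-flip j q k = solve 2 (λ s t → :- (s :* t) := :- con 1ℚ :* s :* t) refl ((ℚ.- 1ℚ) ^ k) (q ^ j ℚ.* recip! j)

  double-suc : ∀ k → 2 ℕ.* suc k ≡ suc (suc (2 ℕ.* k))
  double-suc k = ℕ.*-suc 2 k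

  module _ (q : ℚ) where

    cosᶜ-even : ∀ k → cosᶜ q (2 ℕ.* k) ≡ term (2 ℕ.* k) q k
    sinᶜ-even : ∀ k → sinᶜ q (2 ℕ.* k) ≡ 0ℚ
    sinᶜ-odd : ∀ k → sinᶜ q (suc (2 ℕ.* k)) ≡ term (suc (2 ℕ.* k)) q k
    cosᶜ-odd : ∀ k → cosᶜ q (suc (2 ℕ.* k)) ≡ 0ℚ
    cosᶜ-even zero    = refl
    cosᶜ-even (suc k) = begin
      cosᶜ q (2 ℕ.* suc k)                                 ≡⟨ cong (cosᶜ q) (double-suc k) ⟩
      recip (2 ℕ.+ 2 ℕ.* k) ℚ.* (ℚ.- q ℚ.* sinᶜ q (suc (2 ℕ.* k)))  ≡⟨ cong (λ t → recip (2 ℕ.+ 2 ℕ.* k) ℚ.* (ℚ.- q ℚ.* t)) (sinᶜ-odd k) ⟩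
      recip (2 ℕ.+ 2 ℕ.* k) ℚ.* (ℚ.- q ℚ.* T)              ≡⟨ solve 3 (λ r q t → r :* (:- q :* t) := :- (r :* (q :* t))) refl (recip (2 ℕ.+ 2 ℕ.* k)) q T ⟩
      ℚ.- (recip (2 ℕ.+ 2 ℕ.* k) ℚ.* (q ℚ.* T))            ≡⟨ cong ℚ.-_ (term-suc (suc (2 ℕ.* k)) q k) ⟩
      ℚ.- term (2 ℕ.+ 2 ℕ.* k) q k                         ≡⟨ term-flip (2 ℕ.+ 2 ℕ.* k) q k ⟩
      term (2 ℕ.+ 2 ℕ.* k) q (suc k)                       ≡⟨ cong (λ j → term j q (suc k)) (sym (double-suc k)) ⟩
      term (2 ℕ.* suc k) q (suc k)                         ∎
      where
      open ≡-Reasoning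
      T : ℚ
      T = term (suc (2 ℕ.* k)) q k
    sinᶜ-even zero    = refl
    sinᶜ-even (suc k) = trans (cong (sinᶜ q) (double-suc k))
      (trans (cong (λ t → recip (2 ℕ.+ 2 ℕ.* k) ℚ.* (q ℚ.* t)) (cosᶜ-odd k))
        (solve 2 (λ r q → r :* (q :* con 0ℚ) := con 0ℚ) refl (recip (2 ℕ.+ 2 ℕ.* k)) q))
    sinᶜ-odd k = trans (cong (λ t → recip (suc (2 ℕ.* k)) ℚ.* (q ℚ.* t)) (cosᶜ-even k)) (term-suc (2 ℕ.* k) q k)
    cosᶜ-odd k = trans (cong (λ t → recip (suc (2 ℕ.* k)) ℚ.* (ℚ.- q ℚ.* t)) (sinᶜ-even k))
      (solve 2 (λ r q → r :* (:- q :* con 0ℚ) := con 0ℚ) refl (recip (suc (2 ℕ.* k))) q)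

    -- The n-th approximation has n nonzero-parity terms, hence reaches 2n coefficients of the full
    -- series; the odd ones vanish.
    cos-partial-sum : ∀ n → sum (λ k → term (2 ℕ.* k) q k) n ≡ sum (cosᶜ q) (2 ℕ.* n)
    cos-partial-sum zero    = refl
    cos-partial-sum (suc n) = begin
      sum (λ k → term (2 ℕ.* k) q k) n ℚ.+ term (2 ℕ.* n) q n        ≡⟨ cong₂ ℚ._+_ (cos-partial-sum n) (sym (cosᶜ-even n)) ⟩
      sum (cosᶜ q) (2 ℕ.* n) ℚ.+ cosᶜ q (2 ℕ.* n)                    ≡⟨ sym (ℚ.+-identityʳ (sum (cosᶜ q) (suc (2 ℕ.* n)))) ⟩
      sum (cosᶜ q) (suc (2 ℕ.* n)) ℚ.+ 0ℚ                            ≡⟨ cong (sum (cosᶜ q) (suc (2 ℕ.* n)) ℚ.+_) (sym (cosᶜ-odd n)) ⟩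
      sum (cosᶜ q) (2 ℕ.+ 2 ℕ.* n)                                   ≡⟨ cong (sum (cosᶜ q)) (sym (double-suc n)) ⟩
      sum (cosᶜ q) (2 ℕ.* suc n)                                     ∎
      where open ≡-Reasoning

    sin-partial-sum : ∀ n → sum (λ k → term (suc (2 ℕ.* k)) q k) n ≡ sum (sinᶜ q) (2 ℕ.* n)
    sin-partial-sum zero    = refl
    sin-partial-sum (suc n) = begin
      sum (λ k → term (suc (2 ℕ.* k)) q k) n ℚ.+ term (suc (2 ℕ.* n)) q n  ≡⟨ cong₂ ℚ._+_ (sin-partial-sum n) (sym (sinᶜ-odd n)) ⟩
      sum (sinᶜ q) (2 ℕ.* n) ℚ.+ sinᶜ q (suc (2 ℕ.* n))              ≡⟨ cong (ℚ._+ sinᶜ q (suc (2 ℕ.* n))) (sym (ℚ.+-identityʳ (sum (sinᶜ q) (2 ℕ.* n)))) ⟩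
      sum (sinᶜ q) (2 ℕ.* n) ℚ.+ 0ℚ ℚ.+ sinᶜ q (suc (2 ℕ.* n))       ≡⟨ cong (λ t → sum (sinᶜ q) (2 ℕ.* n) ℚ.+ t ℚ.+ sinᶜ q (suc (2 ℕ.* n))) (sym (sinᶜ-even n)) ⟩
      sum (sinᶜ q) (2 ℕ.+ 2 ℕ.* n)                                   ≡⟨ cong (sum (sinᶜ q)) (sym (double-suc n)) ⟩
      sum (sinᶜ q) (2 ℕ.* suc n)                                     ∎
      where open ≡-Reasoning

    cosᶜ-neg : ∀ k → cosᶜ (ℚ.- q) k ≡ cosᶜ q k
    sinᶜ-neg : ∀ k → sinᶜ (ℚ.- q) k ≡ ℚ.- sinᶜ q k
    cosᶜ-neg zero    = refl
    cosᶜ-neg (suc k) = trans (cong (λ t → recip (suc k) ℚ.* (ℚ.- (ℚ.- q) ℚ.* t)) (sinᶜ-neg k))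
      (solve 3 (λ r q s → r :* (:- :- q :* :- s) := r :* (:- q :* s)) refl (recip (suc k)) q (sinᶜ q k))
    sinᶜ-neg zero    = refl
    sinᶜ-neg (suc k) = trans (cong (λ t → recip (suc k) ℚ.* (ℚ.- q ℚ.* t)) (cosᶜ-neg k))
      (solve 3 (λ r q c → r :* (:- q :* c) := :- (r :* (q :* c))) refl (recip (suc k)) q (cosᶜ q k))

  module _ {M q} (q≤M : ∣ q ∣ ℚ.≤ ι M) where

    private
      ∣-q∣≤M : ∣ ℚ.- q ∣ ℚ.≤ ι M
      ∣-q∣≤M = subst (ℚ._≤ ι M) (sym (ℚ.∣-p∣≡∣p∣ q)) q≤M

      step : ∀ k x y → ∣ x ∣ ℚ.≤ ι M → ∣ y ∣ ℚ.≤ ι (suc M) ^ k ℚ.* recip! k →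
             ∣ recip (suc k) ℚ.* (x ℚ.* y) ∣ ℚ.≤ ι (suc M) ^ suc k ℚ.* recip! (suc k)
      step k x y x≤ y≤ = begin
        ∣ r ℚ.* (x ℚ.* y) ∣
          ≡⟨ trans (cong ∣_∣ (ℚ.*-comm r (x ℚ.* y))) (∣a*recip∣ (x ℚ.* y) (suc k)) ⟩
        ∣ x ℚ.* y ∣ ℚ.* r
          ≡⟨ cong (ℚ._* r) (ℚ.∣p*q∣≡∣p∣*∣q∣ x y) ⟩
        ∣ x ∣ ℚ.* ∣ y ∣ ℚ.* r
          ≤⟨ ℚ.*-monoʳ-≤-nonNeg r {{ℚ.nonNegative (recip≥0 (suc k))}}
               (*-mono (ℚ.0≤∣p∣ y) (ι≥0 (suc M)) (≤ιsuc {M} {x} x≤) y≤) ⟩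
        ι (suc M) ℚ.* (ι (suc M) ^ k ℚ.* recip! k) ℚ.* r
          ≡⟨ solve 4 (λ m p t r → m :* (p :* t) :* r := m :* p :* (r :* t)) refl (ι (suc M)) (ι (suc M) ^ k) (recip! k) r ⟩
        ι (suc M) ^ suc k ℚ.* (r ℚ.* recip! k)
          ≡⟨ cong (ι (suc M) ^ suc k ℚ.*_) (sym (recip!-suc k)) ⟩
        ι (suc M) ^ suc k ℚ.* recip! (suc k) ∎
        where
        open ℚ.≤-Reasoning
        r : ℚ
        r = recip (suc k)

      cosᶜ≤ : ∀ k → ∣ cosᶜ q k ∣ ℚ.≤ ι (suc M) ^ k ℚ.* recip! k
      sinᶜ≤ : ∀ k → ∣ sinᶜ q k ∣ ℚ.≤ ι (suc M) ^ k ℚ.* recip! k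
      cosᶜ≤ zero    = ℚ.≤-refl
      cosᶜ≤ (suc k) = step k (ℚ.- q) (sinᶜ q k) ∣-q∣≤M (sinᶜ≤ k)
      sinᶜ≤ zero    = ℚ.<⇒≤ (ℚ.positive⁻¹ 1ℚ)
      sinᶜ≤ (suc k) = step k q (cosᶜ q k) q≤M (cosᶜ≤ k)

    cosᶜ-geometric : Geometric (ι (majorant M)) (cosᶜ q)
    cosᶜ-geometric k = ℚ.≤-trans (cosᶜ≤ k) (majorises M k)

    sinᶜ-geometric : Geometric (ι (majorant M)) (sinᶜ q)
    sinᶜ-geometric k = ℚ.≤-trans (sinᶜ≤ k) (majorises M k)

  ½^-+ : ∀ m n → ½ ^ (m ℕ.+ n) ≡ ½ ^ m ℚ.* ½ ^ n
  ½^-+ zero    n = sym (ℚ.*-identityˡ (½ ^ n))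
  ½^-+ (suc m) n = trans (cong (½ ℚ.*_) (½^-+ m n)) (sym (ℚ.*-assoc ½ (½ ^ m) (½ ^ n)))

  abstract
    -- The factor n in product-error is absorbed by half of the 2n powers of ½.
    product-error-double : ∀ G a b → Geometric (ι G) a → Geometric (ι G) b → ∀ n →
      ∣ sum a (2 ℕ.* n) ℚ.* sum b (2 ℕ.* n) ℚ.- sum (a ⋆ b) (2 ℕ.* n) ∣ ℚ.≤ ι (4 ℕ.* (G ℕ.* G)) ℚ.* ½ ^ n
    product-error-double G a b a≤ b≤ n = begin
      ∣ sum a (2 ℕ.* n) ℚ.* sum b (2 ℕ.* n) ℚ.- sum (a ⋆ b) (2 ℕ.* n) ∣
        ≤⟨ product-error a b (ι≥0 G) (ι≥0 G) a≤ b≤ (2 ℕ.* n) ⟩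
      ι (2 ℕ.* n) ℚ.* (ι G ℚ.* ι G) ℚ.* (½ ^ (2 ℕ.* n) ℚ.+ ½ ^ (2 ℕ.* n))
        ≡⟨ cong₂ (λ s t → s ℚ.* (ι G ℚ.* ι G) ℚ.* (t ℚ.+ t)) (ι-* 2 n)
             (trans (cong (λ k → ½ ^ (n ℕ.+ k)) (ℕ.+-identityʳ n)) (½^-+ n n)) ⟩
      ι 2 ℚ.* ι n ℚ.* (ι G ℚ.* ι G) ℚ.* (h ℚ.* h ℚ.+ h ℚ.* h)
        ≡⟨ solve 3 (λ i g h → con (ι 2) :* i :* (g :* g) :* (h :* h :+ h :* h)
             := con (ι 4) :* (g :* g) :* h :* (h :* i)) refl (ι n) (ι G) h ⟩
      ι 4 ℚ.* (ι G ℚ.* ι G) ℚ.* h ℚ.* (h ℚ.* ι n)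
        ≤⟨ ℚ.*-monoˡ-≤-nonNeg (ι 4 ℚ.* (ι G ℚ.* ι G) ℚ.* h)
             {{ℚ.nonNegative (*-nonNeg (*-nonNeg (ι≥0 4) (*-nonNeg (ι≥0 G) (ι≥0 G))) 0≤h)}}
             (ℚ.≤-trans (ℚ.*-monoˡ-≤-nonNeg h {{ℚ.nonNegative 0≤h}} (ι-mono {n} {suc n} (ℕ.n≤1+n n))) (½^n*[1+n]≤1 n)) ⟩
      ι 4 ℚ.* (ι G ℚ.* ι G) ℚ.* h ℚ.* 1ℚ
        ≡⟨ ℚ.*-identityʳ _ ⟩
      ι 4 ℚ.* (ι G ℚ.* ι G) ℚ.* h
        ≡⟨ cong (ℚ._* h) (trans (cong (ι 4 ℚ.*_) (sym (ι-* G G))) (sym (ι-* 4 (G ℕ.* G)))) ⟩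
      ι (4 ℕ.* (G ℕ.* G)) ℚ.* h ∎
      where
      open ℚ.≤-Reasoning
      h : ℚ
      h = ½ ^ n
      0≤h : 0ℚ ℚ.≤ h
      0≤h = ℚ.<⇒≤ (½^-pos n)

    geometric⇒≃ : ∀ {x y} K → (∀ n → ∣ seq x n ℚ.- seq y n ∣ ℚ.≤ ι K ℚ.* ½ ^ n) → x ≃ y
    geometric⇒≃ K close = ⟪ (λ ε 0<ε → let N , small = geometric-small K 0<ε in
      N , λ n N≤n → ℚ.≤-<-trans (close n) (ℚ.≤-<-trans
        (ℚ.*-monoˡ-≤-nonNeg (ι K) {{ℚ.nonNegative (ι≥0 K)}} (½^-anti (ℕ.≤⇒≤′ N≤n))) small)) ⟫

  module _ (x y : ℝ) where

    private
      M G : ℕ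
      M = proj₁ (bounded x) ℕ.⊔ proj₁ (bounded y)
      G = majorant M
      x≤ : ∀ n → ∣ seq x n ∣ ℚ.≤ ι M
      x≤ n = ℚ.≤-trans (proj₂ (bounded x) n) (ι-mono (ℕ.m≤m⊔n (proj₁ (bounded x)) (proj₁ (bounded y))))
      y≤ : ∀ n → ∣ seq y n ∣ ℚ.≤ ι M
      y≤ n = ℚ.≤-trans (proj₂ (bounded y) n) (ι-mono (ℕ.m≤n⊔m (proj₁ (bounded x)) (proj₁ (bounded y))))
      K : ℕ
      K = 4 ℕ.* (G ℕ.* G)

      double : ∀ n → ι K ℚ.* ½ ^ n ℚ.+ ι K ℚ.* ½ ^ n ≡ ι (2 ℕ.* K) ℚ.* ½ ^ n
      double n = trans (solve 2 (λ k h → k :* h :+ k :* h := con (ι 2) :* k :* h) refl (ι K) (½ ^ n))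
        (cong (ℚ._* ½ ^ n) (sym (ι-* 2 K)))

      module _ (n : ℕ) where
        p q : ℚ
        p = seq x n
        q = seq y n
        N : ℕ
        N = 2 ℕ.* n
        Sum : (ℕ → ℚ) → ℚ
        Sum f = sum f N
        cosᵖ≤ : Geometric (ι G) (cosᶜ p)
        cosᵖ≤ = cosᶜ-geometric {M} {p} (x≤ n)
        sinᵖ≤ : Geometric (ι G) (sinᶜ p)
        sinᵖ≤ = sinᶜ-geometric {M} {p} (x≤ n)
        cosᵠ≤ : Geometric (ι G) (cosᶜ q)
        cosᵠ≤ = cosᶜ-geometric {M} {q} (y≤ n)
        sinᵠ≤ : Geometric (ι G) (sinᶜ q)
        sinᵠ≤ = sinᶜ-geometric {M} {q} (y≤ n)

    cos-+ : cos (x + y) ≃ cos x * cos y - sin x * sin y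
    cos-+ = geometric⇒≃ (2 ℕ.* K) (λ n → close n (cosᵖ≤ n) (sinᵖ≤ n) (cosᵠ≤ n) (sinᵠ≤ n))
      where
      open ℚ.≤-Reasoning
      close : ∀ n → Geometric (ι G) (cosᶜ (p n)) → Geometric (ι G) (sinᶜ (p n)) →
        Geometric (ι G) (cosᶜ (q n)) → Geometric (ι G) (sinᶜ (q n)) →
        ∣ seq (cos (x + y)) n ℚ.- seq (cos x * cos y - sin x * sin y) n ∣ ℚ.≤ ι (2 ℕ.* K) ℚ.* ½ ^ n
      close n cp sp cq sq = begin
        ∣ seq (cos (x + y)) n ℚ.- (seq (cos x) n ℚ.* seq (cos y) n ℚ.- seq (sin x) n ℚ.* seq (sin y) n) ∣
          ≡⟨ cong ∣_∣ (cong₂ ℚ._-_ (trans (cos-partial-sum (p n ℚ.+ q n) n) (trans (sum-cong (cosᶜ-+ (p n) (q n)) (N n))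
               (sum-diff (cosᶜ (p n) ⋆ cosᶜ (q n)) (sinᶜ (p n) ⋆ sinᶜ (q n)) (N n))))
               (cong₂ ℚ._-_ (cong₂ ℚ._*_ (cos-partial-sum (p n) n) (cos-partial-sum (q n) n))
                            (cong₂ ℚ._*_ (sin-partial-sum (p n) n) (sin-partial-sum (q n) n)))) ⟩
        ∣ (cc ℚ.- ss) ℚ.- (c ℚ.* c′ ℚ.- s ℚ.* s′) ∣
          ≡⟨ cong ∣_∣ (solve 4 (λ a b u v → (a :- b) :- (u :- v) := :- (u :- a) :+ (v :- b)) refl cc ss (c ℚ.* c′) (s ℚ.* s′)) ⟩
        ∣ ℚ.- (c ℚ.* c′ ℚ.- cc) ℚ.+ (s ℚ.* s′ ℚ.- ss) ∣
          ≤⟨ ℚ.∣p+q∣≤∣p∣+∣q∣ (ℚ.- (c ℚ.* c′ ℚ.- cc)) (s ℚ.* s′ ℚ.- ss) ⟩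
        ∣ ℚ.- (c ℚ.* c′ ℚ.- cc) ∣ ℚ.+ ∣ s ℚ.* s′ ℚ.- ss ∣
          ≡⟨ cong (ℚ._+ ∣ s ℚ.* s′ ℚ.- ss ∣) (ℚ.∣-p∣≡∣p∣ (c ℚ.* c′ ℚ.- cc)) ⟩
        ∣ c ℚ.* c′ ℚ.- cc ∣ ℚ.+ ∣ s ℚ.* s′ ℚ.- ss ∣
          ≤⟨ ℚ.+-mono-≤ (product-error-double G _ _ cp cq n) (product-error-double G _ _ sp sq n) ⟩
        ι K ℚ.* ½ ^ n ℚ.+ ι K ℚ.* ½ ^ n
          ≡⟨ double n ⟩
        ι (2 ℕ.* K) ℚ.* ½ ^ n ∎
        where
        c c′ s s′ cc ss : ℚ
        c  = Sum n (cosᶜ (p n))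
        c′ = Sum n (cosᶜ (q n))
        s  = Sum n (sinᶜ (p n))
        s′ = Sum n (sinᶜ (q n))
        cc = Sum n (cosᶜ (p n) ⋆ cosᶜ (q n))
        ss = Sum n (sinᶜ (p n) ⋆ sinᶜ (q n))

    sin-+ : sin (x + y) ≃ sin x * cos y + cos x * sin y
    sin-+ = geometric⇒≃ (2 ℕ.* K) (λ n → close n (cosᵖ≤ n) (sinᵖ≤ n) (cosᵠ≤ n) (sinᵠ≤ n))
      where
      open ℚ.≤-Reasoning
      close : ∀ n → Geometric (ι G) (cosᶜ (p n)) → Geometric (ι G) (sinᶜ (p n)) →
        Geometric (ι G) (cosᶜ (q n)) → Geometric (ι G) (sinᶜ (q n)) →
        ∣ seq (sin (x + y)) n ℚ.- seq (sin x * cos y + cos x * sin y) n ∣ ℚ.≤ ι (2 ℕ.* K) ℚ.* ½ ^ n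
      close n cp sp cq sq = begin
        ∣ seq (sin (x + y)) n ℚ.- (seq (sin x) n ℚ.* seq (cos y) n ℚ.+ seq (cos x) n ℚ.* seq (sin y) n) ∣
          ≡⟨ cong ∣_∣ (cong₂ ℚ._-_ (trans (sin-partial-sum (p n ℚ.+ q n) n) (trans (sum-cong (sinᶜ-+ (p n) (q n)) (N n))
               (sum-+ (sinᶜ (p n) ⋆ cosᶜ (q n)) (cosᶜ (p n) ⋆ sinᶜ (q n)) (N n))))
               (cong₂ ℚ._+_ (cong₂ ℚ._*_ (sin-partial-sum (p n) n) (cos-partial-sum (q n) n))
                            (cong₂ ℚ._*_ (cos-partial-sum (p n) n) (sin-partial-sum (q n) n)))) ⟩
        ∣ (sc ℚ.+ cs) ℚ.- (s ℚ.* c′ ℚ.+ c ℚ.* s′) ∣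
          ≡⟨ cong ∣_∣ (solve 4 (λ a b u v → (a :+ b) :- (u :+ v) := :- ((u :- a) :+ (v :- b))) refl sc cs (s ℚ.* c′) (c ℚ.* s′)) ⟩
        ∣ ℚ.- ((s ℚ.* c′ ℚ.- sc) ℚ.+ (c ℚ.* s′ ℚ.- cs)) ∣
          ≡⟨ ℚ.∣-p∣≡∣p∣ ((s ℚ.* c′ ℚ.- sc) ℚ.+ (c ℚ.* s′ ℚ.- cs)) ⟩
        ∣ (s ℚ.* c′ ℚ.- sc) ℚ.+ (c ℚ.* s′ ℚ.- cs) ∣
          ≤⟨ ℚ.∣p+q∣≤∣p∣+∣q∣ (s ℚ.* c′ ℚ.- sc) (c ℚ.* s′ ℚ.- cs) ⟩
        ∣ s ℚ.* c′ ℚ.- sc ∣ ℚ.+ ∣ c ℚ.* s′ ℚ.- cs ∣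
          ≤⟨ ℚ.+-mono-≤ (product-error-double G _ _ sp cq n) (product-error-double G _ _ cp sq n) ⟩
        ι K ℚ.* ½ ^ n ℚ.+ ι K ℚ.* ½ ^ n
          ≡⟨ double n ⟩
        ι (2 ℕ.* K) ℚ.* ½ ^ n ∎
        where
        c c′ s s′ sc cs : ℚ
        c  = Sum n (cosᶜ (p n))
        c′ = Sum n (cosᶜ (q n))
        s  = Sum n (sinᶜ (p n))
        s′ = Sum n (sinᶜ (q n))
        sc = Sum n (sinᶜ (p n) ⋆ cosᶜ (q n))
        cs = Sum n (cosᶜ (p n) ⋆ sinᶜ (q n))

  -- Termwise equality is what occurs in its two uses: x - x is termwise 0, and three copies of α/3
  -- add up termwise to α.
  cos-pointwise : ∀ {x y} → (∀ n → seq x n ≡ seq y n) → cos x ≃ cos y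
  cos-pointwise eq = pointwise (λ n → cong (λ q → sum (λ k → term (2 ℕ.* k) q k) n) (eq n))

  cos-neg : ∀ x → cos (- x) ≃ cos x
  cos-neg x = pointwise (λ n → trans (cos-partial-sum (ℚ.- seq x n) n)
    (trans (sum-cong (cosᶜ-neg (seq x n)) (2 ℕ.* n)) (sym (cos-partial-sum (seq x n) n))))

  sum-neg : ∀ f n → sum (λ k → ℚ.- f k) n ≡ ℚ.- sum f n
  sum-neg f zero    = refl
  sum-neg f (suc n) = trans (cong (ℚ._- f n) (sum-neg f n)) (sym (ℚ.neg-distrib-+ (sum f n) (f n)))

  sin-neg : ∀ x → sin (- x) ≃ - sin x
  sin-neg x = pointwise (λ n → trans (sin-partial-sum (ℚ.- seq x n) n)
    (trans (sum-cong (sinᶜ-neg (seq x n)) (2 ℕ.* n))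
      (trans (sum-neg (sinᶜ (seq x n)) (2 ℕ.* n)) (cong ℚ.-_ (sym (sin-partial-sum (seq x n) n))))))

  cos-0 : cos 0ℝ ≃ 1ℝ
  -- Approximation 0 is the empty sum, so the agreement with 1 starts at index 1.
  cos-0 = ⟪ (λ ε 0<ε → 1 , λ { (suc n) _ → subst (ℚ._< ε)
      (sym (trans (cong (λ t → ∣ t ℚ.- 1ℚ ∣) (total n)) (∣a-a∣≡0 1ℚ))) 0<ε }) ⟫
    where
    vanishes : ∀ k → cosᶜ 0ℚ (suc k) ≡ 0ℚ
    vanishes k = trans (cong (recip (suc k) ℚ.*_) (ℚ.*-zeroˡ (sinᶜ 0ℚ k))) (ℚ.*-zeroʳ (recip (suc k)))
    partial : ∀ n → sum (cosᶜ 0ℚ) (suc n) ≡ 1ℚ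
    partial zero    = refl
    partial (suc n) = trans (cong₂ ℚ._+_ (partial n) (vanishes n)) (ℚ.+-identityʳ 1ℚ)
    total : ∀ n → seq (cos 0ℝ) (suc n) ≡ 1ℚ
    total n = trans (cos-partial-sum 0ℚ (suc n)) (trans (cong (sum (cosᶜ 0ℚ)) (double-suc n)) (partial (suc (2 ℕ.* n))))

-- The Pythagorean identity and the triple angle

module MultipleAngles where

  open import Defs
  open Reals
  open AdditionFormulas
  open import Data.Rational.Base as ℚ using (1ℚ)
  import Data.Rational.Properties as ℚ

  module _ (x : ℝ) where

    open ℝ-Solver

    -- The addition formula for x and -x, with parity and cos 0 = 1.
    cos²+sin² : cos x * cos x + sin x * sin x ≃ 1ℝ
    cos²+sin² = combine
      (solve 6 (λ c s c⁻ s⁻ d e → (c :* c :+ s :* s) :- e :=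
          (:- c) :* (c⁻ :- c) :+ (s :* (s⁻ :- (:- s)) :+ (con (ℚ.- 1ℚ) :* (d :- (c :* c⁻ :- s :* s⁻)) :+ con 1ℚ :* (d :- e))))
        ≃-refl (cos x) (sin x) (cos (- x)) (sin (- x)) (cos (x - x)) 1ℝ)
      ((- cos x) · cos-neg x ⊕ sin x · sin-neg x ⊕ fromℚ (ℚ.- 1ℚ) · cos-+ x (- x)
        ⊕ fromℚ 1ℚ · ≃-trans (cos-pointwise (λ n → ℚ.+-inverseʳ (seq x n))) cos-0)

    cos-triple : cos (x + x + x) ≃ fromℚ (ι 4) * (cos x * cos x * cos x) - fromℚ (ι 3) * cos x
    cos-triple = combine
      (solve 5 (λ c s c₃ c₂ s₂ → c₃ :- (con (ι 4) :* (c :* c :* c) :- con (ι 3) :* c) :=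
          con 1ℚ :* (c₃ :- (c₂ :* c :- s₂ :* s)) :+ (c :* (c₂ :- (c :* c :- s :* s)) :+ ((:- s) :* (s₂ :- (s :* c :+ c :* s))
            :+ (con (ℚ.- ι 3) :* c) :* ((c :* c :+ s :* s) :- con 1ℚ))))
        ≃-refl (cos x) (sin x) (cos (x + x + x)) (cos (x + x)) (sin (x + x)))
      (fromℚ 1ℚ · cos-+ (x + x) x ⊕ cos x · cos-+ x x ⊕ (- sin x) · sin-+ x x
        ⊕ (fromℚ (ℚ.- ι 3) * cos x) · cos²+sin²)

-- Quadratic extensions without a root of the cubic

module QuadraticTowers where

  open import Defs
  open Reals
  open import Data.Product using (∃₂; _×_; _,_)
  open import Data.Rational.Base as ℚ using (ℚ; 0ℚ; 1ℚ)
  open import Relation.Nullary using (¬_)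
  open ℝ-Solver

  record Subring : Set₁ where
    field
      Member   : ℝ → Set
      respects : ∀ {x y} → x ≃ y → Member x → Member y
      rational : ∀ q → Member (fromℚ q)
      +-closed : ∀ {x y} → Member x → Member y → Member (x + y)
      *-closed : ∀ {x y} → Member x → Member y → Member (x * y)

    neg-closed : ∀ {x} → Member x → Member (- x)
    neg-closed {x} x∈ = respects (solve 1 (λ x → con (ℚ.- 1ℚ) :* x := :- x) ≃-refl x)
      (*-closed (rational (ℚ.- 1ℚ)) x∈)

    minus-closed : ∀ {x y} → Member x → Member y → Member (x - y)
    minus-closed x∈ y∈ = +-closed x∈ (neg-closed y∈)

  -- z is the quotient of two members; no inverse of the denominator is needed.
  record Frac (R : Subring) (z : ℝ) : Set where
    constructor frac
    open Subring R
    field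
      {den num}   : ℝ
      den∈        : Member den
      num∈        : Member num
      den≄0       : den ≄ 0ℝ
      den*z≃num   : den * z ≃ num

  1≄0 : 1ℝ ≄ 0ℝ
  1≄0 1≃0 with () ← fromℚ-injective 1≃0

  2≄0 : fromℚ (ι 2) ≄ 0ℝ
  2≄0 2≃0 with () ← fromℚ-injective 2≃0

  ≄0-respects : ∀ {x y} → x ≃ y → x ≄ 0ℝ → y ≄ 0ℝ
  ≄0-respects x≃y x≄0 y≃0 = x≄0 (≃-trans x≃y y≃0)

  module _ (R : Subring) where

    open Subring R

    member⇒frac : ∀ {x} → Member x → Frac R x
    member⇒frac {x} x∈ = frac (rational 1ℚ) x∈ 1≄0 (solve 1 (λ x → con 1ℚ :* x := x) ≃-refl x)

    frac-rational : ∀ q → Frac R (fromℚ q)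
    frac-rational q = member⇒frac (rational q)

    frac-respects : ∀ {x y} → x ≃ y → Frac R x → Frac R y
    frac-respects x≃y (frac n∈ u∈ n≄0 nx≃u) =
      frac n∈ u∈ n≄0 (≃-trans (*-cong ≃-refl (≃-sym x≃y)) nx≃u)

    frac-+ : ∀ {x y} → Frac R x → Frac R y → Frac R (x + y)
    frac-+ {x} {y} (frac {n} {u} n∈ u∈ n≄0 nx≃u) (frac {m} {v} m∈ v∈ m≄0 my≃v) =
      frac (*-closed n∈ m∈) (+-closed (*-closed m∈ u∈) (*-closed n∈ v∈)) (*-≄0 n≄0 m≄0)
        (combine (solve 6 (λ x y n u m v → n :* m :* (x :+ y) :- (m :* u :+ n :* v) :=
            m :* (n :* x :- u) :+ n :* (m :* y :- v)) ≃-refl x y n u m v)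
          (m · nx≃u ⊕ n · my≃v))

    frac-* : ∀ {x y} → Frac R x → Frac R y → Frac R (x * y)
    frac-* {x} {y} (frac {n} {u} n∈ u∈ n≄0 nx≃u) (frac {m} {v} m∈ v∈ m≄0 my≃v) =
      frac (*-closed n∈ m∈) (*-closed u∈ v∈) (*-≄0 n≄0 m≄0)
        (combine (solve 6 (λ x y n u m v → n :* m :* (x :* y) :- u :* v :=
            (m :* y) :* (n :* x :- u) :+ u :* (m :* y :- v)) ≃-refl x y n u m v)
          ((m * y) · nx≃u ⊕ u · my≃v))

    frac-neg : ∀ {x} → Frac R x → Frac R (- x)
    frac-neg {x} x∈ = frac-respects (solve 1 (λ x → con (ℚ.- 1ℚ) :* x := :- x) ≃-refl x)
      (frac-* (frac-rational (ℚ.- 1ℚ)) x∈)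

    frac-minus : ∀ {x y} → Frac R x → Frac R y → Frac R (x - y)
    frac-minus x∈ y∈ = frac-+ x∈ (frac-neg y∈)

    -- m u z = m n x z = m n y = n v, and m u is nonzero because u = n x.
    frac-÷ : ∀ {x y z} → Frac R x → Frac R y → x ≄ 0ℝ → x * z ≃ y → Frac R z
    frac-÷ {x} {y} {z} (frac {n} {u} n∈ u∈ n≄0 nx≃u) (frac {m} {v} m∈ v∈ m≄0 my≃v) x≄0 xz≃y =
      frac (*-closed m∈ u∈) (*-closed n∈ v∈) (*-≄0 m≄0 (≄0-respects nx≃u (*-≄0 n≄0 x≄0)))
        (combine (solve 7 (λ x y z n u m v → m :* u :* z :- n :* v :=
            (:- (m :* z)) :* (n :* x :- u) :+ ((n :* m) :* (x :* z :- y) :+ n :* (m :* y :- v)))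
            ≃-refl x y z n u m v)
          ((- (m * z)) · nx≃u ⊕ (n * m) · xz≃y ⊕ n · my≃v))

  module Tower (a : ℚ) where

    -- u / n is a root of X³ - 3X - a.
    Root : ℝ → ℝ → Set
    Root n u = u * u * u ≃ fromℚ (ι 3) * (n * n * u) + fromℚ a * (n * n * n)

    root-respects : ∀ {n n′ u u′} → n ≃ n′ → u ≃ u′ → Root n u → Root n′ u′
    root-respects n≃ u≃ root = ≃-trans (*-cong (*-cong u≃′ u≃′) u≃′) (≃-trans root
      (+-cong (*-cong ≃-refl (*-cong (*-cong n≃ n≃) u≃)) (*-cong ≃-refl (*-cong (*-cong n≃ n≃) n≃))))
      where
      u≃′ = ≃-sym u≃

    root-scale : ∀ {n u} k → Root n u → Root (k * n) (k * u)
    root-scale {n} {u} k root = combine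
      (solve 4 (λ k n u a → (k :* u) :* (k :* u) :* (k :* u)
          :- (con (ι 3) :* ((k :* n) :* (k :* n) :* (k :* u)) :+ a :* ((k :* n) :* (k :* n) :* (k :* n)))
        := (k :* k :* k) :* (u :* u :* u :- (con (ι 3) :* (n :* n :* u) :+ a :* (n :* n :* n))))
        ≃-refl k n u (fromℚ a))
      ((k * k * k) · root)

    -- The invariant of the tower. `noRoot` speaks of fractions of members, so it is a statement
    -- about the fraction field.
    record RootFree : Set₁ where
      field
        ring   : Subring
      open Subring ring public
      field
        noRoot : ∀ {n u} → Member n → Member u → n ≄ 0ℝ → ¬ Root n u

    open RootFree using (ring)

    Contains : RootFree → ℝ → Set
    Contains = RootFree.Member

    infix 4 _⊆_
    _⊆_ : RootFree → RootFree → Set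
    R ⊆ R′ = ∀ {x} → Contains R x → Contains R′ x

    InFrac : RootFree → ℝ → Set
    InFrac R = Frac (ring R)

    frac-mono : ∀ {R R′ x} → R ⊆ R′ → InFrac R x → InFrac R′ x
    frac-mono R⊆R′ (frac n∈ u∈ n≄0 eq) = frac (R⊆R′ n∈) (R⊆R′ u∈) n≄0 eq

    -- s may already be a fraction over R. The representation u + v s is then not unique, and the
    -- arguments work with whichever one is given.
    module Adjoin (R : RootFree) {s d : ℝ} (d∈ : Contains R d) (s²≃d : s * s ≃ d) where

      open RootFree R hiding (ring)

      Adjoined : ℝ → Set
      Adjoined z = ∃₂ λ u v → Member u × Member v × z ≃ u + v * s

      adjoined : Subring
      adjoined = record
        { Member   = Adjoined
        ; respects = λ { x≃y (u , v , u∈ , v∈ , eq) → u , v , u∈ , v∈ , ≃-trans (≃-sym x≃y) eq }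
        ; rational = λ q → fromℚ q , 0ℝ , rational q , rational 0ℚ
                     , solve 2 (λ q s → q := q :+ con 0ℚ :* s) ≃-refl (fromℚ q) s
        ; +-closed = λ { {x} {y} (u , v , u∈ , v∈ , eq) (u′ , v′ , u′∈ , v′∈ , eq′) →
            u + u′ , v + v′ , +-closed u∈ u′∈ , +-closed v∈ v′∈ ,
            ≃-trans (+-cong eq eq′) (solve 5 (λ u v u′ v′ s → (u :+ v :* s) :+ (u′ :+ v′ :* s)
              := (u :+ u′) :+ (v :+ v′) :* s) ≃-refl u v u′ v′ s) }
        ; *-closed = λ { {x} {y} (u , v , u∈ , v∈ , eq) (u′ , v′ , u′∈ , v′∈ , eq′) →
            u * u′ + v * v′ * d , u * v′ + v * u′
            , +-closed (*-closed u∈ u′∈) (*-closed (*-closed v∈ v′∈) d∈)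
            , +-closed (*-closed u∈ v′∈) (*-closed v∈ u′∈)
            , ≃-trans (*-cong eq eq′) (combine
                (solve 6 (λ u v u′ v′ s d → (u :+ v :* s) :* (u′ :+ v′ :* s)
                  :- ((u :* u′ :+ v :* v′ :* d) :+ (u :* v′ :+ v :* u′) :* s)
                  := (v :* v′) :* (s :* s :- d)) ≃-refl u v u′ v′ s d)
                ((v * v′) · s²≃d)) }
        }

      embed : ∀ {x} → Member x → Adjoined x
      embed {x} x∈ = x , 0ℝ , x∈ , rational 0ℚ , solve 2 (λ x s → x := x :+ con 0ℚ :* s) ≃-refl x s

      generator : Adjoined s
      generator = 0ℝ , 1ℝ , rational 0ℚ , rational 1ℚ , solve 1 (λ s → s := con 0ℚ :+ con 1ℚ :* s) ≃-refl s

      -- If s is a fraction t s = w, then multiplying by t moves a root down to R.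
      no-root-if-fraction : ∀ {t w n u} → Member t → Member w → t ≄ 0ℝ → t * s ≃ w →
                            Adjoined n → Adjoined u → n ≄ 0ℝ → ¬ Root n u
      no-root-if-fraction {t} {w} {n} {u} t∈ w∈ t≄0 ts≃w (n₁ , n₂ , n₁∈ , n₂∈ , n≃) (u₁ , u₂ , u₁∈ , u₂∈ , u≃) n≄0 root =
        noRoot (clear n₁∈ n₂∈) (clear u₁∈ u₂∈) (≄0-respects (cleared n≃) (*-≄0 t≄0 n≄0))
          (root-respects (cleared n≃) (cleared u≃) (root-scale t root))
        where
        clear : ∀ {x₁ x₂} → Member x₁ → Member x₂ → Member (t * x₁ + x₂ * w)
        clear x₁∈ x₂∈ = +-closed (*-closed t∈ x₁∈) (*-closed x₂∈ w∈)
        cleared : ∀ {x x₁ x₂} → x ≃ x₁ + x₂ * s → t * x ≃ t * x₁ + x₂ * w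
        cleared {x} {x₁} {x₂} x≃ = combine
          (solve 6 (λ t w s x x₁ x₂ → t :* x :- (t :* x₁ :+ x₂ :* w)
            := t :* (x :- (x₁ :+ x₂ :* s)) :+ x₂ :* (t :* s :- w)) ≃-refl t w s x x₁ x₂)
          (t · x≃ ⊕ x₂ · ts≃w)

      -- With N in R, a root (U + V s) / N has the conjugate root (U - V s) / N,
      -- and the three roots sum to 0, so that -2U / N is a root over R.
      no-root-over-base : ∀ {N U V} → Member N → Member U → Member V → N ≄ 0ℝ → ¬ Root N (U + V * s)
      no-root-over-base {N} {U} {V} N∈ U∈ V∈ N≄0 root = B≃0⇒⊥ (≃0-stable B≄0⇒⊥)
        where
        N² c A B : ℝ
        -- `A + B * s` is the cubic at (U + V s)/N times N³, with s² replaced by d; `N²` includes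
        -- the coefficient 3.
        N² = fromℚ (ι 3) * (N * N)
        c = fromℚ (ι 3) * (U * U) + V * V * d - N²
        B = V * c
        A = U * U * U + fromℚ (ι 3) * (U * (V * V * d)) - N² * U - fromℚ a * (N * N * N)
        N²∈ : Member N²
        N²∈ = *-closed (rational (ι 3)) (*-closed N∈ N∈)
        V²d∈ : Member (V * V * d)
        V²d∈ = *-closed (*-closed V∈ V∈) d∈
        B∈ : Member B
        B∈ = *-closed V∈ (minus-closed (+-closed (*-closed (rational (ι 3)) (*-closed U∈ U∈)) V²d∈) N²∈)
        A∈ : Member A
        A∈ = minus-closed (minus-closed (+-closed (*-closed (*-closed U∈ U∈) U∈)
               (*-closed (rational (ι 3)) (*-closed U∈ V²d∈))) (*-closed N²∈ U∈))
               (*-closed (rational a) (*-closed (*-closed N∈ N∈) N∈))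
        Bs≃-A : B * s ≃ - A
        Bs≃-A = combine
          (solve 6 (λ N U V s d a →
            let n = con (ι 3) :* (N :* N) ; x = U :+ V :* s in
            V :* (con (ι 3) :* (U :* U) :+ V :* V :* d :- n) :* s
              :- :- (U :* U :* U :+ con (ι 3) :* (U :* (V :* V :* d)) :- n :* U :- a :* (N :* N :* N))
            := con 1ℚ :* (x :* x :* x :- (con (ι 3) :* (N :* N :* x) :+ a :* (N :* N :* N)))
               :+ (:- (con (ι 3) :* (U :* V :* V) :+ V :* V :* V :* s)) :* (s :* s :- d))
            ≃-refl N U V s d (fromℚ a))
          (1ℝ · root ⊕ (- (fromℚ (ι 3) * (U * V * V) + V * V * V * s)) · s²≃d)
        B≄0⇒⊥ : ¬ B ≄ 0ℝ
        B≄0⇒⊥ B≄0 = no-root-if-fraction B∈ (neg-closed A∈) B≄0 Bs≃-A (embed N∈)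
          (U , V , U∈ , V∈ , ≃-refl) N≄0 root
        B≃0⇒⊥ : B ≄ 0ℝ
        B≃0⇒⊥ B≃0 = V≄0⇒⊥ V≄0
          where
          A≃0 : A ≃ 0ℝ
          A≃0 = combine
            (solve 3 (λ A B s → A :- con 0ℚ := con 1ℚ :* (B :* s :- :- A) :+ (:- s) :* (B :- con 0ℚ)) ≃-refl A B s)
            (1ℝ · Bs≃-A ⊕ (- s) · B≃0)
          V≄0 : V ≄ 0ℝ
          -- With V = 0 the equation A = 0 says that U/N is a root.
          V≄0 V≃0 = noRoot N∈ U∈ N≄0 (combine
            (solve 5 (λ N U V d a →
              let n = con (ι 3) :* (N :* N) in
              U :* U :* U :- (con (ι 3) :* (N :* N :* U) :+ a :* (N :* N :* N))
              := con 1ℚ :* ((U :* U :* U :+ con (ι 3) :* (U :* (V :* V :* d)) :- n :* U :- a :* (N :* N :* N)) :- con 0ℚ)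
                 :+ (:- (con (ι 3) :* (U :* V :* d))) :* (V :- con 0ℚ))
              ≃-refl N U V d (fromℚ a))
            (1ℝ · A≃0 ⊕ (- (fromℚ (ι 3) * (U * V * d))) · V≃0))
          V≄0⇒⊥ : ¬ V ≄ 0ℝ
          -- Now B = V c = 0 gives c = 0, and the cubic at -2U/N, cleared of denominators, is A - 3
          -- U c.
          V≄0⇒⊥ V≄0 = noRoot N∈ (*-closed (rational (ℚ.- ι 2)) U∈) N≄0 (combine
            (solve 5 (λ N U V d a →
              let n = con (ι 3) :* (N :* N) ; w = con (ℚ.- ι 2) :* U in
              w :* w :* w :- (con (ι 3) :* (N :* N :* w) :+ a :* (N :* N :* N))
              := con 1ℚ :* ((U :* U :* U :+ con (ι 3) :* (U :* (V :* V :* d)) :- n :* U :- a :* (N :* N :* N)) :- con 0ℚ)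
                 :+ (con (ℚ.- ι 3) :* U) :* ((con (ι 3) :* (U :* U) :+ V :* V :* d :- n) :- con 0ℚ))
              ≃-refl N U V d (fromℚ a))
            (1ℝ · A≃0 ⊕ (fromℚ (ℚ.- ι 3) * U) · *-cancel-≄0 V≄0 B≃0))

      -- A denominator n₁ + n₂ s is made rational over R by its conjugate n₁ - n₂ s.
      no-root : ∀ {n u} → Adjoined n → Adjoined u → n ≄ 0ℝ → ¬ Root n u
      no-root {n} {u} n∈@(n₁ , n₂ , n₁∈ , n₂∈ , n≃) u∈@(u₁ , u₂ , u₁∈ , u₂∈ , u≃) n≄0 root =
        conj≄0⇒⊥ conj≄0
        where
        conj : ℝ
        conj = n₁ - n₂ * s
        conj≄0 : conj ≄ 0ℝ
        -- A vanishing conjugate makes s the fraction n₁/n₂; here n₂ ≠ 0, since n = 2 n₂ s.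
        conj≄0 conj≃0 = no-root-if-fraction n₂∈ n₁∈ n₂≄0 n₂s≃n₁ n∈ u∈ n≄0 root
          where
          n₂s≃n₁ : n₂ * s ≃ n₁
          n₂s≃n₁ = combine (solve 3 (λ n₁ n₂ s → n₂ :* s :- n₁ := con (ℚ.- 1ℚ) :* ((n₁ :- n₂ :* s) :- con 0ℚ))
            ≃-refl n₁ n₂ s) (fromℚ (ℚ.- 1ℚ) · conj≃0)
          n₂≄0 : n₂ ≄ 0ℝ
          n₂≄0 n₂≃0 = n≄0 (combine
            (solve 4 (λ n n₁ n₂ s → n :- con 0ℚ := con 1ℚ :* (n :- (n₁ :+ n₂ :* s))
              :+ (con (ℚ.- 1ℚ) :* (n₂ :* s :- n₁) :+ (con (ι 2) :* s) :* (n₂ :- con 0ℚ))) ≃-refl n n₁ n₂ s)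
            (1ℝ · n≃ ⊕ fromℚ (ℚ.- 1ℚ) · n₂s≃n₁ ⊕ (fromℚ (ι 2) * s) · n₂≃0))
        product : ∀ {x x₁ x₂} → x ≃ x₁ + x₂ * s → conj * x ≃ (n₁ * x₁ - n₂ * x₂ * d) + (n₁ * x₂ - n₂ * x₁) * s
        product {x} {x₁} {x₂} x≃ = combine
          (solve 7 (λ n₁ n₂ s d x x₁ x₂ → (n₁ :- n₂ :* s) :* x
              :- ((n₁ :* x₁ :- n₂ :* x₂ :* d) :+ (n₁ :* x₂ :- n₂ :* x₁) :* s)
            := (n₁ :- n₂ :* s) :* (x :- (x₁ :+ x₂ :* s)) :+ (:- (n₂ :* x₂)) :* (s :* s :- d)) ≃-refl n₁ n₂ s d x x₁ x₂)
          (conj · x≃ ⊕ (- (n₂ * x₂)) · s²≃d)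
        norm : conj * n ≃ n₁ * n₁ - n₂ * n₂ * d
        norm = ≃-trans (product n≃)
          (solve 4 (λ n₁ n₂ s d → (n₁ :* n₁ :- n₂ :* n₂ :* d) :+ (n₁ :* n₂ :- n₂ :* n₁) :* s
            := n₁ :* n₁ :- n₂ :* n₂ :* d) ≃-refl n₁ n₂ s d)
        conj≄0⇒⊥ : ¬ conj ≄ 0ℝ
        conj≄0⇒⊥ conj≄0 = no-root-over-base
          (minus-closed (*-closed n₁∈ n₁∈) (*-closed (*-closed n₂∈ n₂∈) d∈))
          (minus-closed (*-closed n₁∈ u₁∈) (*-closed (*-closed n₂∈ u₂∈) d∈))
          (minus-closed (*-closed n₁∈ u₂∈) (*-closed n₂∈ u₁∈))
          (≄0-respects norm (*-≄0 conj≄0 n≄0))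
          (root-respects norm (product u≃) (root-scale conj root))

      rootFree : RootFree
      rootFree = record { ring = adjoined ; noRoot = no-root }

-- Straightedge-and-compass steps as quadratic extensions

module Constructibility where

  open import Defs
  open RationalPoints using (no-rational-point)
  open Reals
  open AdditionFormulas using (cos-pointwise)
  open MultipleAngles
  open QuadraticTowers
  import Data.Integer.Base as ℤ
  open import Data.Product using (∃; _×_; _,_)
  open import Data.Rational.Base as ℚ using (ℚ; 0ℚ; 1ℚ)
  import Data.Rational.Properties as ℚ
  open import Data.Rational.Solver using (module +-*-Solver)
  open import Data.Sum using (inj₁; inj₂)
  open import Function.Bundles using (mk⇔)
  open import Level using (0ℓ)
  open import Relation.Binary.PropositionalEquality using (_≡_; _≢_; refl; cong; module ≡-Reasoning)
  open import Relation.Nullary using (¬_)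
  open import Relation.Unary using (Pred; _∈_)
  open ℝ-Solver
  open _≃_

  module Construction (a : ℚ) where

    open Tower a
    open RootFree using (ring)

    infix 4 _∈²_
    _∈²_ : Point → RootFree → Set
    (x , y) ∈² R = InFrac R x × InFrac R y

    record Extension (R : RootFree) (P : RootFree → Set) : Set₁ where
      constructor extension
      field
        {extended} : RootFree
        contains   : R ⊆ extended
        holds      : P extended

    -- Completing the square: (2αx + β)² is the discriminant D. The generator is the given real 2αx
    -- + β up to a factor, so the extension contains this particular root x.
    adjoin-root : ∀ {R α β γ x} → InFrac R α → InFrac R β → InFrac R γ → α ≄ 0ℝ →
                  α * (x * x) + β * x + γ ≃ 0ℝ → Extension R (λ R′ → InFrac R′ x)
    adjoin-root {R} {α} {β} {γ} {x} α∈ β∈ γ∈ α≄0 eq = adjoin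
      (frac-minus (ring R) (frac-* (ring R) β∈ β∈)
        (frac-* (ring R) (frac-rational (ring R) (ι 4)) (frac-* (ring R) α∈ γ∈)))
      where
      two : ℝ
      two = fromℚ (ι 2)
      D : ℝ
      D = β * β - fromℚ (ι 4) * (α * γ)
      adjoin : InFrac R D → Extension R (λ R′ → InFrac R′ x)
      adjoin (frac {m} {w} m∈ w∈ m≄0 mD≃w) = extension {extended = R′} embed
        (frac-÷ (ring R′) (frac-* (ring R′) (frac-rational (ring R′) (ι 2)) (frac-mono {R} {R′} embed α∈))
          (frac-minus (ring R′)
            (frac {z = two * α * x + β} (embed m∈) generator m≄0 ≃-refl)
            (frac-mono {R} {R′} embed β∈))
          (*-≄0 2≄0 α≄0)
          (solve 3 (λ α β x → con (ι 2) :* α :* x := (con (ι 2) :* α :* x :+ β) :- β) ≃-refl α β x))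
        where
        -- D is only a fraction w/m; scaling the generator by m turns its square into the member m
        -- w.
        s²≃mw : (m * (two * α * x + β)) * (m * (two * α * x + β)) ≃ m * w
        s²≃mw = combine (solve 6 (λ m w α β γ x →
            let s = m :* (con (ι 2) :* α :* x :+ β) in
            s :* s :- m :* w := m :* (m :* (β :* β :- con (ι 4) :* (α :* γ)) :- w)
              :+ (con (ι 4) :* (m :* m) :* α) :* ((α :* (x :* x) :+ β :* x :+ γ) :- con 0ℚ)) ≃-refl m w α β γ x)
          (m · mD≃w ⊕ (fromℚ (ι 4) * (m * m) * α) · eq)
        open Adjoin R (RootFree.*-closed R m∈ w∈) s²≃mw
        R′ : RootFree
        R′ = rootFree

    -- `on⇒` and `⇒on` concern all real points of the curve, so that a comparison of coefficients
    -- can prove `SameCurve`.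
    record Linear (R : RootFree) (K : Curve) : Set where
      field
        {p q r} : ℝ
        p∈ : InFrac R p
        q∈ : InFrac R q
        r∈ : InFrac R r
        nondegenerate : ¬ (p ≃ 0ℝ × q ≃ 0ℝ)
        on⇒ : ∀ {x y} → (x , y) on K → p * x + q * y ≃ r
        ⇒on : ∀ {x y} → p * x + q * y ≃ r → (x , y) on K

    record Circular (R : RootFree) (K : Curve) : Set where
      field
        {p q r} : ℝ
        p∈ : InFrac R p
        q∈ : InFrac R q
        r∈ : InFrac R r
        on⇒ : ∀ {x y} → (x , y) on K → x * x + y * y + (p * x + q * y) ≃ r
        ⇒on : ∀ {x y} → x * x + y * y + (p * x + q * y) ≃ r → (x , y) on K

    data Equation (R : RootFree) (K : Curve) : Set where
      linear   : Linear R K → Equation R K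
      circular : Circular R K → Equation R K

    equation-mono : ∀ {R R′ K} → R ⊆ R′ → Equation R K → Equation R′ K
    equation-mono {R} {R′} R⊆ (linear l) = linear record
      { p∈ = frac-mono {R} {R′} R⊆ p∈ ; q∈ = frac-mono {R} {R′} R⊆ q∈ ; r∈ = frac-mono {R} {R′} R⊆ r∈
      ; nondegenerate = nondegenerate ; on⇒ = on⇒ ; ⇒on = ⇒on }
      where open Linear l
    equation-mono {R} {R′} R⊆ (circular c) = circular record
      { p∈ = frac-mono {R} {R′} R⊆ p∈ ; q∈ = frac-mono {R} {R′} R⊆ q∈ ; r∈ = frac-mono {R} {R′} R⊆ r∈
      ; on⇒ = on⇒ ; ⇒on = ⇒on }
      where open Circular c

    minus≃0⇒≃ : ∀ {x y} → x - y ≃ 0ℝ → x ≃ y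
    minus≃0⇒≃ {x} {y} eq = combine (solve 2 (λ x y → x :- y := con 1ℚ :* ((x :- y) :- con 0ℚ)) ≃-refl x y) (1ℝ · eq)

    line-equation : ∀ {R A B} → A ∈² R → B ∈² R → A ≇ B → Equation R (line A B)
    line-equation {R} {a₁ , a₂} {b₁ , b₂} (a₁∈ , a₂∈) (b₁∈ , b₂∈) A≇B = linear record
      { p∈ = p∈
      ; q∈ = q∈
      ; r∈ = frac-+ (ring R) (frac-* (ring R) p∈ a₁∈) (frac-* (ring R) q∈ a₂∈)
      ; nondegenerate = λ (p≃0 , q≃0) → A≇B
          ( limits-equal (≃-sym (minus≃0⇒≃ q≃0)) , limits-equal (minus≃0⇒≃ p≃0) )
      ; on⇒ = λ {x} {y} eq → combine (solve 6 (λ a₁ a₂ b₁ b₂ x y →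
            ((a₂ :- b₂) :* x :+ (b₁ :- a₁) :* y) :- ((a₂ :- b₂) :* a₁ :+ (b₁ :- a₁) :* a₂)
            := con 1ℚ :* ((b₁ :- a₁) :* (y :- a₂) :- (b₂ :- a₂) :* (x :- a₁))) ≃-refl a₁ a₂ b₁ b₂ x y)
          (1ℝ · ⟪ eq ⟫)
      ; ⇒on = λ {x} {y} eq → limits-equal (combine (solve 6 (λ a₁ a₂ b₁ b₂ x y →
            (b₁ :- a₁) :* (y :- a₂) :- (b₂ :- a₂) :* (x :- a₁)
            := con 1ℚ :* (((a₂ :- b₂) :* x :+ (b₁ :- a₁) :* y) :- ((a₂ :- b₂) :* a₁ :+ (b₁ :- a₁) :* a₂)))
            ≃-refl a₁ a₂ b₁ b₂ x y)
          (1ℝ · eq))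
      }
      where
      p∈ : InFrac R (a₂ - b₂)
      p∈ = frac-minus (ring R) a₂∈ b₂∈
      q∈ : InFrac R (b₁ - a₁)
      q∈ = frac-minus (ring R) b₁∈ a₁∈

    circle-equation : ∀ {R O A} → O ∈² R → A ∈² R → Equation R (circle O A)
    circle-equation {R} {o₁ , o₂} {a₁ , a₂} (o₁∈ , o₂∈) (a₁∈ , a₂∈) = circular record
      { p∈ = frac-* (ring R) (frac-rational (ring R) (ℚ.- ι 2)) o₁∈
      ; q∈ = frac-* (ring R) (frac-rational (ring R) (ℚ.- ι 2)) o₂∈
      ; r∈ = frac-minus (ring R) (frac-+ (ring R) (square (frac-minus (ring R) a₁∈ o₁∈)) (square (frac-minus (ring R) a₂∈ o₂∈)))
               (frac-+ (ring R) (square o₁∈) (square o₂∈))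
      ; on⇒ = λ {x} {y} eq → combine (solve 6 (λ o₁ o₂ a₁ a₂ x y →
            let R² = (a₁ :- o₁) :* (a₁ :- o₁) :+ (a₂ :- o₂) :* (a₂ :- o₂) in
            (x :* x :+ y :* y :+ (con (ℚ.- ι 2) :* o₁ :* x :+ con (ℚ.- ι 2) :* o₂ :* y)) :- (R² :- (o₁ :* o₁ :+ o₂ :* o₂))
            := con 1ℚ :* (((x :- o₁) :* (x :- o₁) :+ (y :- o₂) :* (y :- o₂)) :- R²)) ≃-refl o₁ o₂ a₁ a₂ x y)
          (1ℝ · ⟪ eq ⟫)
      ; ⇒on = λ {x} {y} eq → limits-equal (combine (solve 6 (λ o₁ o₂ a₁ a₂ x y →
            let R² = (a₁ :- o₁) :* (a₁ :- o₁) :+ (a₂ :- o₂) :* (a₂ :- o₂) in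
            ((x :- o₁) :* (x :- o₁) :+ (y :- o₂) :* (y :- o₂)) :- R²
            := con 1ℚ :* ((x :* x :+ y :* y :+ (con (ℚ.- ι 2) :* o₁ :* x :+ con (ℚ.- ι 2) :* o₂ :* y)) :- (R² :- (o₁ :* o₁ :+ o₂ :* o₂))))
            ≃-refl o₁ o₂ a₁ a₂ x y)
          (1ℝ · eq))
      }
      where
      square : ∀ {x} → InFrac R x → InFrac R (x * x)
      square x∈ = frac-* (ring R) x∈ x∈

    Determined : RootFree → Point → Set₁
    Determined R P = Extension R (P ∈²_)

    module _ {R p q r p′ q′ r′ x y} (p∈ : InFrac R p) (q∈ : InFrac R q) (r∈ : InFrac R r)
             (p′∈ : InFrac R p′) (q′∈ : InFrac R q′) (r′∈ : InFrac R r′) (onˡ : p * x + q * y ≃ r) where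

      -- Cramer's rule.
      solve-linear : p′ * x + q′ * y ≃ r′ → p * q′ - p′ * q ≄ 0ℝ → (x , y) ∈² R
      solve-linear onˡ′ det≄0 =
          frac-÷ (ring R) det∈ (cross r∈ q′∈ r′∈ q∈) det≄0
            (combine (solve 8 (λ p q r p′ q′ r′ x y → (p :* q′ :- p′ :* q) :* x :- (r :* q′ :- r′ :* q)
              := q′ :* ((p :* x :+ q :* y) :- r) :+ (:- q) :* ((p′ :* x :+ q′ :* y) :- r′)) ≃-refl p q r p′ q′ r′ x y)
              (q′ · onˡ ⊕ (- q) · onˡ′))
        , frac-÷ (ring R) det∈ (cross p∈ r′∈ p′∈ r∈) det≄0
            (combine (solve 8 (λ p q r p′ q′ r′ x y → (p :* q′ :- p′ :* q) :* y :- (p :* r′ :- p′ :* r)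
              := (:- p′) :* ((p :* x :+ q :* y) :- r) :+ p :* ((p′ :* x :+ q′ :* y) :- r′)) ≃-refl p q r p′ q′ r′ x y)
              ((- p′) · onˡ ⊕ p · onˡ′))
        where
        cross : ∀ {a b c d} → InFrac R a → InFrac R b → InFrac R c → InFrac R d → InFrac R (a * b - c * d)
        cross a∈ b∈ c∈ d∈ = frac-minus (ring R) (frac-* (ring R) a∈ b∈) (frac-* (ring R) c∈ d∈)
        det∈ : InFrac R (p * q′ - p′ * q)
        det∈ = cross p∈ q′∈ p′∈ q∈

      -- Substituting q y = r - p x into q² times the circle leaves a quadratic equation for x with
      -- leading coefficient p² + q². Afterwards y is a quotient by q.
      solve-circular : x * x + y * y + (p′ * x + q′ * y) ≃ r′ → q ≄ 0ℝ → Determined R (x , y)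
      solve-circular onᶜ q≄0 = conclude (adjoin-root {R} {x = x}
          (p∈ ⊛ p∈ ⊞ q∈ ⊛ q∈)
          (p′∈ ⊛ (q∈ ⊛ q∈) ⊟ (frac-rational (ring R) (ι 2) ⊛ (p∈ ⊛ r∈) ⊞ p∈ ⊛ (q∈ ⊛ q′∈)))
          (r∈ ⊛ r∈ ⊞ q∈ ⊛ (q′∈ ⊛ r∈) ⊟ r′∈ ⊛ (q∈ ⊛ q∈))
          (λ eq → q≄0 (sum-of-squares≃0⇒≃0 {q} {p} (≃-trans (solve 2 (λ p q → q :* q :+ p :* p := p :* p :+ q :* q) ≃-refl p q) eq)))
          (combine (solve 8 (λ p q r p′ q′ r′ x y →
              (p :* p :+ q :* q) :* (x :* x)
                :+ (p′ :* (q :* q) :- (con (ι 2) :* (p :* r) :+ p :* (q :* q′))) :* x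
                :+ ((r :* r :+ q :* (q′ :* r)) :- r′ :* (q :* q)) :- con 0ℚ
              := (q :* q) :* ((x :* x :+ y :* y :+ (p′ :* x :+ q′ :* y)) :- r′)
                 :+ (:- (q :* y :+ (r :- p :* x) :+ q :* q′)) :* ((p :* x :+ q :* y) :- r))
              ≃-refl p q r p′ q′ r′ x y)
            ((q * q) · onᶜ ⊕ (- (q * y + (r - p * x) + q * q′)) · onˡ)))
        where
        infixl 7 _⊛_
        infixl 6 _⊞_ _⊟_
        _⊛_ : ∀ {a b} → InFrac R a → InFrac R b → InFrac R (a * b)
        _⊛_ = frac-* (ring R)
        _⊞_ : ∀ {a b} → InFrac R a → InFrac R b → InFrac R (a + b)
        _⊞_ = frac-+ (ring R)
        _⊟_ : ∀ {a b} → InFrac R a → InFrac R b → InFrac R (a - b)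
        _⊟_ = frac-minus (ring R)
        conclude : Extension R (λ R′ → InFrac R′ x) → Determined R (x , y)
        conclude (extension {R′} R⊆ x∈) = extension {extended = R′} R⊆ (x∈ , frac-÷ (ring R′) (mono q∈)
            (frac-minus (ring R′) (mono r∈) (frac-* (ring R′) (mono p∈) x∈)) q≄0
            (combine (solve 5 (λ p q r x y → q :* y :- (r :- p :* x) := con 1ℚ :* ((p :* x :+ q :* y) :- r)) ≃-refl p q r x y)
              (1ℝ · onˡ)))
          where
          mono : ∀ {z} → InFrac R z → InFrac R′ z
          mono = frac-mono {R} {R′} R⊆

    meet-circular : ∀ {R p q r p′ q′ r′ x y} → InFrac R p → InFrac R q → InFrac R r →
      InFrac R p′ → InFrac R q′ → InFrac R r′ → ¬ (p ≃ 0ℝ × q ≃ 0ℝ) → p * x + q * y ≃ r →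
      x * x + y * y + (p′ * x + q′ * y) ≃ r′ → ¬ ¬ Determined R (x , y)
    meet-circular {R} {p} {q} {r} {p′} {q′} {r′} {x} {y} p∈ q∈ r∈ p′∈ q′∈ r′∈ nondegenerate onˡ onᶜ k =
      -- If no extension determines the point, q ≠ 0 is refuted by `solve-circular` and p ≠ 0 by the
      -- same with exchanged coordinates; by stability both vanish.
      nondegenerate (≃0-stable (λ p≄0 → k (swap (solve-circular {R} q∈ p∈ r∈ q′∈ p′∈ r′∈
          (≃-trans (solve 4 (λ p q x y → q :* y :+ p :* x := p :* x :+ q :* y) ≃-refl p q x y) onˡ)
          (≃-trans (solve 4 (λ p q x y → y :* y :+ x :* x :+ (q :* y :+ p :* x)
            := x :* x :+ y :* y :+ (p :* x :+ q :* y)) ≃-refl p′ q′ x y) onᶜ) p≄0)))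
        , ≃0-stable (λ q≄0 → k (solve-circular {R} p∈ q∈ r∈ p′∈ q′∈ r′∈ onˡ onᶜ q≄0)))
      where
      swap : Determined R (y , x) → Determined R (x , y)
      swap (extension {R′} R⊆ (y∈ , x∈)) = extension {extended = R′} R⊆ (x∈ , y∈)

    -- The defect t = p′u + q′v - r′ satisfies t p = t q = 0, by the common point (x, y) and the
    -- zero determinant; t ≠ 0 would make the first line degenerate.
    parallel : ∀ {p q r p′ q′ r′ x y u v} → ¬ (p ≃ 0ℝ × q ≃ 0ℝ) → p * q′ - p′ * q ≃ 0ℝ →
      p * x + q * y ≃ r → p′ * x + q′ * y ≃ r′ → p * u + q * v ≃ r → p′ * u + q′ * v ≃ r′
    parallel {p} {q} {r} {p′} {q′} {r′} {x} {y} {u} {v} nondegenerate det≃0 xy xy′ uv =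
      minus≃0⇒≃ (≃0-stable λ t≄0 → nondegenerate
        ( *-cancel-≄0 t≄0 (combine
            (solve 10 (λ p q r p′ q′ r′ x y u v → (p′ :* u :+ q′ :* v :- r′) :* p :- con 0ℚ
              := p′ :* ((p :* u :+ q :* v) :- r) :+ ((:- p′) :* ((p :* x :+ q :* y) :- r)
                :+ (p :* ((p′ :* x :+ q′ :* y) :- r′) :+ (v :- y) :* ((p :* q′ :- p′ :* q) :- con 0ℚ))))
              ≃-refl p q r p′ q′ r′ x y u v)
            (p′ · uv ⊕ (- p′) · xy ⊕ p · xy′ ⊕ (v - y) · det≃0))
        , *-cancel-≄0 t≄0 (combine
            (solve 10 (λ p q r p′ q′ r′ x y u v → (p′ :* u :+ q′ :* v :- r′) :* q :- con 0ℚ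
              := q′ :* ((p :* u :+ q :* v) :- r) :+ ((:- q′) :* ((p :* x :+ q :* y) :- r)
                :+ (q :* ((p′ :* x :+ q′ :* y) :- r′) :+ (x :- u) :* ((p :* q′ :- p′ :* q) :- con 0ℚ))))
              ≃-refl p q r p′ q′ r′ x y u v)
            (q′ · uv ⊕ (- q′) · xy ⊕ q · xy′ ⊕ (x - u) · det≃0)) ))

    meet-linear : ∀ {R K L P} → Linear R K → Linear R L → ¬ SameCurve K L → P on K → P on L →
                  ¬ ¬ Determined R P
    meet-linear {R} {K} {L} {x , y} K-eq L-eq K≢L onK onL k = det≄0 (λ det≃0 → K≢L (same det≃0))
      where
      module K = Linear K-eq
      module L = Linear L-eq
      det≄0 : ¬ K.p * L.q - L.p * K.q ≄ 0ℝ
      det≄0 det≄0 = k (extension {extended = R} (λ x∈ → x∈) (solve-linear {R} K.p∈ K.q∈ K.r∈ L.p∈ L.q∈ L.r∈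
        (K.on⇒ onK) (L.on⇒ onL) det≄0))
      same : K.p * L.q - L.p * K.q ≃ 0ℝ → SameCurve K L
      same det≃0 (u , v) = mk⇔
        (λ on → L.⇒on (parallel K.nondegenerate det≃0 (K.on⇒ onK) (L.on⇒ onL) (K.on⇒ on)))
        (λ on → K.⇒on (parallel L.nondegenerate
          (combine (solve 4 (λ p q p′ q′ → (p′ :* q :- p :* q′) :- con 0ℚ
            := con (ℚ.- 1ℚ) :* ((p :* q′ :- p′ :* q) :- con 0ℚ)) ≃-refl K.p K.q L.p L.q)
            (fromℚ (ℚ.- 1ℚ) · det≃0))
          (L.on⇒ onL) (K.on⇒ onK) (L.on⇒ on)))

    -- The difference of the two equations is the radical line. It is nondegenerate: equal linear
    -- parts and one common point would give equal constants, hence the same circle.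
    meet-circles : ∀ {R K L P} → Circular R K → Circular R L → ¬ SameCurve K L → P on K → P on L →
                   ¬ ¬ Determined R P
    meet-circles {R} {K} {L} {x , y} K-eq L-eq K≢L onK onL = meet-circular {R}
        (frac-minus (ring R) K.p∈ L.p∈) (frac-minus (ring R) K.q∈ L.q∈) (frac-minus (ring R) K.r∈ L.r∈)
        K.p∈ K.q∈ K.r∈ (λ (p≃ , q≃) → K≢L (same p≃ q≃))
        (combine (solve 8 (λ p q r p′ q′ r′ x y → ((p :- p′) :* x :+ (q :- q′) :* y) :- (r :- r′)
            := con 1ℚ :* ((x :* x :+ y :* y :+ (p :* x :+ q :* y)) :- r)
              :+ con (ℚ.- 1ℚ) :* ((x :* x :+ y :* y :+ (p′ :* x :+ q′ :* y)) :- r′)) ≃-refl K.p K.q K.r L.p L.q L.r x y)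
          (1ℝ · K.on⇒ onK ⊕ fromℚ (ℚ.- 1ℚ) · L.on⇒ onL))
        (K.on⇒ onK)
      where
      module K = Circular K-eq
      module L = Circular L-eq
      transfer : ∀ {p q r p′ q′ r′ u v} → p - p′ ≃ 0ℝ → q - q′ ≃ 0ℝ →
        x * x + y * y + (p * x + q * y) ≃ r → x * x + y * y + (p′ * x + q′ * y) ≃ r′ →
        u * u + v * v + (p * u + q * v) ≃ r → u * u + v * v + (p′ * u + q′ * v) ≃ r′
      transfer {p} {q} {r} {p′} {q′} {r′} {u} {v} p≃ q≃ xy xy′ uv = combine
        (solve 10 (λ p q r p′ q′ r′ x y u v →
            (u :* u :+ v :* v :+ (p′ :* u :+ q′ :* v)) :- r′
            := con 1ℚ :* ((u :* u :+ v :* v :+ (p :* u :+ q :* v)) :- r)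
              :+ (con (ℚ.- 1ℚ) :* ((x :* x :+ y :* y :+ (p :* x :+ q :* y)) :- r)
              :+ (con 1ℚ :* ((x :* x :+ y :* y :+ (p′ :* x :+ q′ :* y)) :- r′)
              :+ ((x :- u) :* ((p :- p′) :- con 0ℚ) :+ (y :- v) :* ((q :- q′) :- con 0ℚ)))))
          ≃-refl p q r p′ q′ r′ x y u v)
        (1ℝ · uv ⊕ fromℚ (ℚ.- 1ℚ) · xy ⊕ 1ℝ · xy′ ⊕ (x - u) · p≃ ⊕ (y - v) · q≃)
      flip : ∀ {x y} → x - y ≃ 0ℝ → y - x ≃ 0ℝ
      flip {x} {y} eq = combine (solve 2 (λ x y → (y :- x) :- con 0ℚ := con (ℚ.- 1ℚ) :* ((x :- y) :- con 0ℚ)) ≃-refl x y)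
        (fromℚ (ℚ.- 1ℚ) · eq)
      same : K.p - L.p ≃ 0ℝ → K.q - L.q ≃ 0ℝ → SameCurve K L
      same p≃ q≃ (u , v) = mk⇔
        (λ on → L.⇒on (transfer p≃ q≃ (K.on⇒ onK) (L.on⇒ onL) (K.on⇒ on)))
        (λ on → K.⇒on (transfer (flip p≃) (flip q≃) (L.on⇒ onL) (K.on⇒ onK) (L.on⇒ on)))

    meet : ∀ {R K L P} → Equation R K → Equation R L → ¬ SameCurve K L → P on K → P on L →
           ¬ ¬ Determined R P
    meet {R} (linear k)   (linear l)   = meet-linear {R} k l
    meet {R} (circular k) (circular l) = meet-circles {R} k l
    meet {R} (linear k) (circular l) _ onK onL = meet-circular {R} K.p∈ K.q∈ K.r∈ L.p∈ L.q∈ L.r∈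
        K.nondegenerate (K.on⇒ onK) (L.on⇒ onL)
      where
      module K = Linear k
      module L = Circular l
    meet {R} (circular k) (linear l) _ onK onL = meet-circular {R} L.p∈ L.q∈ L.r∈ K.p∈ K.q∈ K.r∈
        L.nondegenerate (L.on⇒ onL) (K.on⇒ onK)
      where
      module K = Circular k
      module L = Linear l

    widen : ∀ {R R′ P} → R ⊆ R′ → Extension R′ P → Extension R P
    widen R⊆R′ (extension {R″} R′⊆R″ p) = extension {extended = R″} (λ x∈ → R′⊆R″ (R⊆R′ x∈)) p

    -- The second extension is built over the first, and `mono` carries the first property up to it.
    both : ∀ {R} {P Q : RootFree → Set} → (∀ {R R′} → R ⊆ R′ → P R → P R′) →
           ¬ ¬ Extension R P → (∀ R′ → ¬ ¬ Extension R′ Q) → ¬ ¬ Extension R (λ R′ → P R′ × Q R′)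
    both mono p q k = p λ { (extension {R₁} R⊆R₁ p₁) → q R₁ λ { (extension {R₂} R₁⊆R₂ q₂) →
      k (extension {extended = R₂} (λ x∈ → R₁⊆R₂ (R⊆R₁ x∈)) (mono {R₁} {R₂} R₁⊆R₂ p₁ , q₂)) } }

    ∈²-mono : ∀ {P R R′} → R ⊆ R′ → P ∈² R → P ∈² R′
    ∈²-mono {_} {R} {R′} R⊆ (x∈ , y∈) = frac-mono {R} {R′} R⊆ x∈ , frac-mono {R} {R′} R⊆ y∈

    module _ {S : Pred Point 0ℓ} (S-determined : ∀ {A} → A ∈ S → ∀ R → ¬ ¬ Determined R A) where

      -- Quantifying over `R` lets each point be determined over the extension built for the earlier
      -- ones. The double negation absorbs the undecidable distinctions made at intersections.
      constructible⇒determined : ∀ {P} → P ∈ C S → ∀ R → ¬ ¬ Determined R P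
      drawable⇒equation : ∀ {K} → Drawable S K → ∀ R → ¬ ¬ Extension R (λ R′ → Equation R′ K)
      constructible⇒determined {x , y} (given A∈S (x≈ , y≈)) R k = S-determined A∈S R
        λ { (extension {R′} R⊆ (a₁∈ , a₂∈)) → k (extension {extended = R′} R⊆
              ( frac-respects (ring R′) (≃-sym ⟪ x≈ ⟫) a₁∈
              , frac-respects (ring R′) (≃-sym ⟪ y≈ ⟫) a₂∈ )) }
      constructible⇒determined (intersect {K} {L} K-drawn L-drawn K≢L onK onL) R k =
        both {P = λ R → Equation R K} {Q = λ R → Equation R L} (λ {R} {R′} → equation-mono {R} {R′})
          (drawable⇒equation K-drawn R) (drawable⇒equation L-drawn)
          λ { (extension {R′} R⊆ (K-eq , L-eq)) → meet {R′} K-eq L-eq K≢L onK onL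
              λ determined → k (widen R⊆ determined) }
      drawable⇒equation (line {A} {B} A∈ B∈ A≇B) R k =
        both {P = A ∈²_} {Q = B ∈²_} (λ {R} {R′} → ∈²-mono {A} {R} {R′})
          (constructible⇒determined A∈ R) (constructible⇒determined B∈)
          λ { (extension {R′} R⊆ (A∈² , B∈²)) → k (extension {extended = R′} R⊆ (line-equation {R′} A∈² B∈² A≇B)) }
      drawable⇒equation (circle {O} {A} O∈ A∈ _) R k =
        both {P = O ∈²_} {Q = A ∈²_} (λ {R} {R′} → ∈²-mono {O} {R} {R′})
          (constructible⇒determined O∈ R) (constructible⇒determined A∈)
          λ { (extension {R′} R⊆ (O∈² , A∈²)) → k (extension {extended = R′} R⊆ (circle-equation {R′} O∈² A∈²)) }

  -- The trisection cubic and its base field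

  rationals : Subring
  rationals = record
    { Member   = λ x → ∃ λ q → x ≃ fromℚ q
    ; respects = λ { x≃y (q , x≃q) → q , ≃-trans (≃-sym x≃y) x≃q }
    ; rational = λ q → q , ≃-refl
    ; +-closed = λ { (p , x≃p) (q , y≃q) → p ℚ.+ q , ≃-trans (+-cong x≃p y≃q) (pointwise (λ _ → refl)) }
    ; *-closed = λ { (p , x≃p) (q , y≃q) → p ℚ.* q , ≃-trans (*-cong x≃p y≃q) (pointwise (λ _ → refl)) }
    }

  module _ (r : ℚ) (r≢0 : r ≢ 0ℚ) where

    open Tower (r ℚ.* r)
    open Construction (r ℚ.* r)
    open RootFree using (ring)

    no-rational-root : ∀ m v → m ≢ 0ℚ → ¬ Root (fromℚ m) (fromℚ v)
    no-rational-root m v m≢0 root = no-rational-point (v ℚ.* i) r r≢0 (begin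
      v ℚ.* i ℚ.* (v ℚ.* i) ℚ.* (v ℚ.* i)
        ≡⟨ Q.solve 2 (λ v i → v Q.:* i Q.:* (v Q.:* i) Q.:* (v Q.:* i) Q.:= v Q.:* v Q.:* v Q.:* (i Q.:* i Q.:* i)) refl v i ⟩
      v ℚ.* v ℚ.* v ℚ.* (i ℚ.* i ℚ.* i)
        ≡⟨ cong (ℚ._* (i ℚ.* i ℚ.* i)) cubic ⟩
      (ι 3 ℚ.* (m ℚ.* m ℚ.* v) ℚ.+ r ℚ.* r ℚ.* (m ℚ.* m ℚ.* m)) ℚ.* (i ℚ.* i ℚ.* i)
        ≡⟨ Q.solve 4 (λ r m v i →
             (Q.con (ι 3) Q.:* (m Q.:* m Q.:* v) Q.:+ r Q.:* r Q.:* (m Q.:* m Q.:* m)) Q.:* (i Q.:* i Q.:* i)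
             Q.:= r Q.:* r Q.:* (m Q.:* i) Q.:* (m Q.:* i) Q.:* (m Q.:* i)
               Q.:+ Q.con (ι 3) Q.:* (v Q.:* i) Q.:* (m Q.:* i) Q.:* (m Q.:* i)) refl r m v i ⟩
      r ℚ.* r ℚ.* (m ℚ.* i) ℚ.* (m ℚ.* i) ℚ.* (m ℚ.* i) ℚ.+ ι 3 ℚ.* (v ℚ.* i) ℚ.* (m ℚ.* i) ℚ.* (m ℚ.* i)
        ≡⟨ cong (λ t → r ℚ.* r ℚ.* t ℚ.* t ℚ.* t ℚ.+ ι 3 ℚ.* (v ℚ.* i) ℚ.* t ℚ.* t) (ℚ.*-inverseʳ m) ⟩
      r ℚ.* r ℚ.* 1ℚ ℚ.* 1ℚ ℚ.* 1ℚ ℚ.+ ι 3 ℚ.* (v ℚ.* i) ℚ.* 1ℚ ℚ.* 1ℚ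
        ≡⟨ Q.solve 2 (λ r x → r Q.:* r Q.:* Q.con 1ℚ Q.:* Q.con 1ℚ Q.:* Q.con 1ℚ
             Q.:+ Q.con (ι 3) Q.:* x Q.:* Q.con 1ℚ Q.:* Q.con 1ℚ Q.:= r Q.:* r Q.:+ Q.con (ι 3) Q.:* x) refl r (v ℚ.* i) ⟩
      r ℚ.* r ℚ.+ ι 3 ℚ.* (v ℚ.* i) ∎)
      where
      open ≡-Reasoning
      module Q = +-*-Solver
      instance
        m-nonZero : ℚ.NonZero m
        m-nonZero = ℚ.≢-nonZero m≢0
      i : ℚ
      i = ℚ.1/ m
      cubic : v ℚ.* v ℚ.* v ≡ ι 3 ℚ.* (m ℚ.* m ℚ.* v) ℚ.+ r ℚ.* r ℚ.* (m ℚ.* m ℚ.* m)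
      cubic = fromℚ-injective (≃-trans (pointwise (λ _ → refl)) (≃-trans root (pointwise (λ _ → refl))))

    rational-field : RootFree
    rational-field = record
      { ring   = rationals
      ; noRoot = λ { (m , n≃m) (v , u≃v) n≄0 root → no-rational-root m v
          (λ { refl → n≄0 n≃m }) (root-respects n≃m u≃v root) }
      }

    module _ {α : ℝ} (a≃2cosα : fromℚ (r ℚ.* r) ≃ fromℚ (ι 2) * cos α) where

      private
        c : ℚ
        c = r ℚ.* r ℚ.* ℚ.½

        cosα≃c : cos α ≃ fromℚ c
        cosα≃c = ≃-trans
          (combine (solve 2 (λ a x → x :- a :* con ℚ.½ := con (ℚ.- ℚ.½) :* (a :- con (ι 2) :* x)) ≃-refl (fromℚ (r ℚ.* r)) (cos α))
            (fromℚ (ℚ.- ℚ.½) · a≃2cosα))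
          (pointwise (λ _ → refl))

      data-determined : ∀ {A} → A ∈ trisectionData α → ∀ R → ¬ ¬ Determined R A
      data-determined (inj₁ (x≈ , y≈)) R k = k (extension {extended = R} (λ x∈ → x∈)
        ( frac-respects (ring R) (≃-sym ⟪ x≈ ⟫) (frac-rational (ring R) 0ℚ)
        , frac-respects (ring R) (≃-sym ⟪ y≈ ⟫) (frac-rational (ring R) 0ℚ) ))
      data-determined (inj₂ (inj₁ (x≈ , y≈))) R k = k (extension {extended = R} (λ x∈ → x∈)
        ( frac-respects (ring R) (≃-sym ⟪ x≈ ⟫) (frac-rational (ring R) 1ℚ)
        , frac-respects (ring R) (≃-sym ⟪ y≈ ⟫) (frac-rational (ring R) 0ℚ) ))
      -- cos α is the rational c = a/2, and sin α solves s² + (c² - 1) = 0.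
      data-determined (inj₂ (inj₂ (x≈ , y≈))) R k = k (with-sine (adjoin-root {R}
          (frac-rational (ring R) 1ℚ) (frac-rational (ring R) 0ℚ) (frac-minus (ring R) (frac-* (ring R) (frac-rational (ring R) c) (frac-rational (ring R) c)) (frac-rational (ring R) 1ℚ)) 1≄0
          (combine (solve 3 (λ s x c → con 1ℚ :* (s :* s) :+ con 0ℚ :* s :+ (c :* c :- con 1ℚ) :- con 0ℚ
              := con 1ℚ :* ((x :* x :+ s :* s) :- con 1ℚ) :+ (:- (x :+ c)) :* (x :- c)) ≃-refl (sin α) (cos α) (fromℚ c))
            (1ℝ · cos²+sin² α ⊕ (- (cos α + fromℚ c)) · cosα≃c))))
        where
        with-sine : Extension R (λ R′ → InFrac R′ (sin α)) → Determined R _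
        with-sine (extension {R′} R⊆ sin∈) = extension {extended = R′} R⊆
          ( frac-respects (ring R′) (≃-sym (≃-trans ⟪ x≈ ⟫ cosα≃c)) (frac-rational (ring R′) c)
          , frac-respects (ring R′) (≃-sym ⟪ y≈ ⟫) sin∈ )

      α/3 : ℝ
      α/3 = fromℚ (ℤ.+ 1 ℚ./ 3) * α

      -- The triple-angle formula at α/3: X = 2 cos (α/3) satisfies X³ - 3X = 2 cos α = a.
      root-2cos : ∀ {n u} → n * cos α/3 ≃ u → Root n (fromℚ (ι 2) * u)
      root-2cos {n} {u} eq = combine
        (solve 5 (λ n u x y a →
          let w = con (ι 2) :* u ; z = con (ι 2) :* (n :* x) in
          w :* w :* w :- (con (ι 3) :* (n :* n :* w) :+ a :* (n :* n :* n))
          -- w³ - z³ = (w - z)(w² + w z + z²) with w - z = -2(n x - u); the 6n² comes from the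
          -- linear term of the cubic.
          := (con (ι 6) :* (n :* n) :- con (ι 2) :* (w :* w :+ w :* z :+ z :* z)) :* (n :* x :- u)
            :+ ((con (ℚ.- ι 2) :* (n :* n :* n)) :* (y :- (con (ι 4) :* (x :* x :* x) :- con (ι 3) :* x))
            :+ (:- (n :* n :* n)) :* (a :- con (ι 2) :* y)))
          ≃-refl n u (cos α/3) (cos α) (fromℚ (r ℚ.* r)))
        ((fromℚ (ι 6) * (n * n) - fromℚ (ι 2) * (w * w + w * z + z * z)) · eq
          ⊕ (fromℚ (ℚ.- ι 2) * (n * n * n)) · ≃-trans (cos-pointwise thrice) (cos-triple α/3)
          ⊕ (- (n * n * n)) · a≃2cosα)
        where
        w z : ℝ
        w = fromℚ (ι 2) * u
        z = fromℚ (ι 2) * (n * cos α/3)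
        thrice : ∀ n → seq α n ≡ seq (α/3 + α/3 + α/3) n
        thrice n = Q.solve 1 (λ q → q Q.:= Q.con (ℤ.+ 1 ℚ./ 3) Q.:* q Q.:+ Q.con (ℤ.+ 1 ℚ./ 3) Q.:* q Q.:+ Q.con (ℤ.+ 1 ℚ./ 3) Q.:* q) refl (seq α n)
          where module Q = +-*-Solver

      -- Starting from the rationals, the abscissa cos (α/3) becomes a fraction over some root-free
      -- ring, where its double would be a root.
      not-trisectable : ¬ Trisectable α
      not-trisectable trisectable = constructible⇒determined data-determined trisectable rational-field
        λ { (extension {R} _ (frac n∈ u∈ n≄0 eq , _)) → RootFree.noRoot R n∈
              (RootFree.*-closed R (RootFree.rational R (ι 2)) u∈) n≄0 (root-2cos eq) }

open import Defs using (fromℚ; Tri)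
open import Data.Integer.Base using (+_)
open import Data.Product using (∃-syntax; _,_)
open import Data.Rational.Base using (ℚ; 0ℚ; _≤_; _*_; -_; _/_)
open import Relation.Binary.PropositionalEquality using (_≡_; _≢_; refl)
open import Relation.Unary using (_∉_)
open Reals using (⟪_⟫)
open Constructibility using (not-trisectable)

proposition3p2 : ∀ (a : ℚ) → - (+ 2 / 1) ≤ a → a ≤ + 2 / 1 → a ≢ 0ℚ →
    (∃[ r ] a ≡ r * r) → fromℚ a ∉ Tri
proposition3p2 _ _ _ a≢0 (r , refl) (α , trisectable , a≈2cosα) =
  not-trisectable r (λ { refl → a≢0 refl }) {α} ⟪ a≈2cosα ⟫ trisectable
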